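{- Consider Shisen-Sho positions on a board whose width and height are at most $n$, in the computation model with $n$-bit large registers and small registers described in the context. If playing and unplaying a tile is allowed to take $\mathrm{O}(\log n)$ steps, then testing whether two tiles form a matching pair can be done in $\mathrm{O}(\log n)$ steps; that is, there is a data structure using $\mathrm{O}(n)$ registers which represents the set of occupied cells of the current position, can be updated in $\mathrm{O}(\log n)$ steps whenever a single tile is played or unplayed, and allows one to test in $\mathrm{O}(\log n)$ steps whether two given distinct tiles form a matching pair. If, in addition, bit scan techniques are available on all (large and small) registers, then the bound for testing whether two tiles at distance $d$ from each other form a matching pair improves to $\mathrm{O}(\log d)$ steps (with playing and unplaying a tile still taking $\mathrm{O}(\log n)$ steps).
   Context: A Shisen-Sho position on a rectangular board consists of tiles occupying some of the cells of a rectangle of the integer grid $\mathbb{Z}^2$, at most one tile per cell, each tile having a kind. Two tiles are equal if they have the same kind. A cell is empty if it carries no tile; in particular all cells outside the rectangle are empty. Playing a tile means removing it from its cell; unplaying a tile means putting it back on its cell. Two distinct equal tiles form a matching pair (playable pair) if they are either horizontally or vertically adjacent, or can be connected by at most $3$ horizontal and vertical free lines; that is, there is a path from the cell of one tile to the cell of the other consisting of at most three straight consecutive segments, each horizontal or vertical, such that all cells on the path, except for the cells of the two tiles themselves, are empty. The path may run outside the rectangle. The distance $d\ge 1$ is the Manhattan distance between the cells of the two tiles (any other standard distance on the grid changes $d$ by at most a constant factor). Bounds $\mathrm{O}(\log n)$ and $\mathrm{O}(\log d)$ are understood as $\mathrm{O}(1+\log n)$ and $\mathrm{O}(1+\log d)$.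 Computation model. There are large registers with $n$ bits and small registers, with more than $\log n$ bits, which can hold the values $0,1,2,\ldots,n$. Each of the following takes one step: bitwise logic on large registers, including testing whether a register is zero; setting the first $k$ bits and clearing the last $n-k$ bits of a large register, where $k$ is given in a small register; all of these operations on small registers as well; addition and subtraction on small registers; access to a memory register indexed by small registers. The memory consists of $\mathrm{O}(n)$ registers. The kinds and coordinates of the two tiles to be tested (and the coordinates of a tile to be played or unplayed) are given. Bit scan techniques being available on a type of registers means that the index of the first (lowest) set bit and the index of the last (highest) set bit of a nonzero register of that type can be computed in $\mathrm{O}(1)$ steps. -}

module Defs where

open import Data.Bool using (Bool; true; false; if_then_else_)
open import Data.Fin as Fin using (Fin; toℕ)
open import Data.Fin.Patterns using (0F; 1F; 2F; 3F; 4F; 5F; 6F; 7F)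
open import Data.Integer as ℤ using (ℤ; +_)
open import Data.Maybe using (Maybe; just; nothing; is-just)
open import Data.Nat using (ℕ; zero; suc; _+_; _*_; _∸_; _^_; _≤_; _<_; _<ᵇ_; _≡ᵇ_; _%_; ⌊_/2⌋; ∣_-_∣)
open import Data.Nat.Logarithm using (⌊log₂_⌋)
open import Data.Product using (_×_; _,_; ∃-syntax)
open import Data.Sum using (_⊎_)
open import Data.Vec using (Vec; []; _∷_; lookup; replicate; tabulate; zipWith)
open import Data.Vec.Functional using (Vector; updateAt)
open import Function using (const)
open import Function.Bundles using (_⇔_; _↣_; Injection)
open import Relation.Binary.PropositionalEquality using (_≡_; _≢_)
open import Relation.Nullary using (¬_)

------------------------------------------------------------------------
-- Shisen-Sho

-- The rectangle has been translated so that its cells are the integer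
-- points (x , y) with 0 ≤ x < W and 0 ≤ y < H.
Position : Set → ℕ → ℕ → Set
Position K W H = Fin W → Fin H → Maybe K

Cell : ℕ → ℕ → Set
Cell W H = Fin W × Fin H

tile : ∀ {K W H} → Position K W H → Cell W H → Maybe K
tile P (x , y) = P x y

occupied : ∀ {K W H} → Position K W H → Fin W → Fin H → Bool
occupied P x y = is-just (P x y)

setTile : ∀ {K W H} → Maybe K → Cell W H → Position K W H → Position K W H
setTile t (x , y) P = updateAt P x (λ column → updateAt column y (const t))

play : ∀ {K W H} → Cell W H → Position K W H → Position K W H
play = setTile nothing

unplay : ∀ {K W H} → K → Cell W H → Position K W H → Position K W H
unplay κ = setTile (just κ)

Point : Set
Point = ℤ × ℤ

point : ∀ {W H} → Cell W H → Point
point (x , y) = + toℕ x , + toℕ y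

-- Vacuously true for points outside the rectangle.
Empty : ∀ {K W H} → Position K W H → Point → Set
Empty P r = ∀ c → point c ≡ r → tile P c ≡ nothing

Straight : Point → Point → Set
Straight (x , y) (x′ , y′) = x ≡ x′ ⊎ y ≡ y′

-- The bounding box of two points; this is the segment joining them
-- when they are on a common horizontal or vertical line.
OnSegment : Point → Point → Point → Set
OnSegment (x , y) (x′ , y′) (a , b) =
  (x ℤ.⊓ x′ ℤ.≤ a × a ℤ.≤ x ℤ.⊔ x′) × (y ℤ.⊓ y′ ℤ.≤ b × b ℤ.≤ y ℤ.⊔ y′)

-- Path Free m p q: m consecutive straight segments lead from p to q,
-- and all points on them are free.
data Path (Free : Point → Set) : ℕ → Point → Point → Set where
  done : ∀ {p} → Path Free 0 p p
  line : ∀ {m p q r} → Straight p q → (∀ a → OnSegment p q a → Free a) →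
         Path Free m q r → Path Free (suc m) p r

Connected : ∀ {K W H} → Position K W H → Cell W H → Cell W H → Set
Connected P p q = ∃[ m ] (m ≤ 3 × Path Free m (point p) (point q))
  where
  Free : Point → Set
  Free a = a ≡ point p ⊎ a ≡ point q ⊎ Empty P a

Adjacent : ∀ {W H} → Cell W H → Cell W H → Set
Adjacent (x , y) (x′ , y′) =
  (y ≡ y′ × ∣ toℕ x - toℕ x′ ∣ ≡ 1) ⊎ (x ≡ x′ × ∣ toℕ y - toℕ y′ ∣ ≡ 1)

Matching : ∀ {K W H} → Position K W H → Cell W H → Cell W H → Set
Matching P p q =
  p ≢ q ×
  (∃[ κ ] (tile P p ≡ just κ × tile P q ≡ just κ)) ×
  (Adjacent p q ⊎ Connected P p q)

distance : ∀ {W H} → Cell W H → Cell W H → ℕ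
distance (x , y) (x′ , y′) = ∣ toℕ x - toℕ x′ ∣ + ∣ toℕ y - toℕ y′ ∣

------------------------------------------------------------------------
-- Register contents; bit 0 is the first (lowest) bit

Bits : ℕ → Set
Bits = Vec Bool

value : ∀ {m} → Bits m → ℕ
value []       = 0
value (b ∷ bs) = (if b then 1 else 0) + 2 * value bs

-- Reduction modulo 2 ^ m.
bits : ∀ m → ℕ → Bits m
bits zero    _ = []
bits (suc m) v = (v % 2 ≡ᵇ 1) ∷ bits m ⌊ v /2⌋

firstBits : ∀ m → ℕ → Bits m
firstBits m k = tabulate (λ i → toℕ i <ᵇ k)

IsZero : ∀ {m} → Bits m → Set
IsZero {m} v = v ≡ replicate m false

IsFirstSet IsLastSet : ∀ {m} → Bits m → Fin m → Set
IsFirstSet v i = lookup v i ≡ true × (∀ j → j Fin.< i → lookup v j ≡ false)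
IsLastSet  v i = lookup v i ≡ true × (∀ j → i Fin.< j → lookup v j ≡ false)

------------------------------------------------------------------------
-- The machine

data Size : Set where
  large small : Size

-- Large registers have n bits, small registers have w bits.
width : ℕ → ℕ → Size → ℕ
width n w large = n
width n w small = w

-- Of each size there are k working registers, and b memory banks with
-- n + 1 registers each.  As k and b will not depend on n, there are
-- 2k + 2b(n + 1) = O(n) registers in total.  Several banks are needed
-- because a small register may be unable to hold values above n.
Regs : ℕ → ℕ → ℕ → Set
Regs k n w = ∀ z → Vector (Bits (width n w z)) k

Memory : ℕ → ℕ → ℕ → Set
Memory b n w = ∀ z → Vector (Vector (Bits (width n w z)) (suc n)) b

record State (k b n w : ℕ) : Set where
  constructor ⟪_,_⟫
  field
    regs   : Regs k n w
    memory : Memory b n w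

open State public

putReg : ∀ {k n w} z → Fin k → Bits (width n w z) → Regs k n w → Regs k n w
putReg large i v ρ large = updateAt (ρ large) i (const v)
putReg large i v ρ small = ρ small
putReg small i v ρ large = ρ large
putReg small i v ρ small = updateAt (ρ small) i (const v)

putMem : ∀ {b n w} z → Fin b → Fin (suc n) → Bits (width n w z) →
         Memory b n w → Memory b n w
putMem large β a v μ large = updateAt (μ large) β (λ bank → updateAt bank a (const v))
putMem large β a v μ small = μ small
putMem small β a v μ large = μ large
putMem small β a v μ small = updateAt (μ small) β (λ bank → updateAt bank a (const v))

data Model : Set where
  plain bitScan : Model

-- Register operands: the destination comes first.  The operands of
-- setFirst, load and store that hold a count or an address are small.
data Instr (k b : ℕ) : Model → Set where
  bitwise  : ∀ {M} → Size → (Bool → Bool → Bool) → (d i j : Fin k) → Instr k b M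
  setFirst : ∀ {M} → Size → (d i : Fin k) → Instr k b M
  add sub  : ∀ {M} → (d i j : Fin k) → Instr k b M
  load     : ∀ {M} → Size → (d : Fin k) (bank : Fin b) (address : Fin k) → Instr k b M
  store    : ∀ {M} → Size → (bank : Fin b) (address : Fin k) (i : Fin k) → Instr k b M
  firstSet lastSet : Size → (d i : Fin k) → Instr k b bitScan

-- There is no transition for a memory access at an address above n,
-- nor for a bit scan of a register that is zero.
data Step {k b n w : ℕ} : ∀ {M} → Instr k b M → State k b n w → State k b n w → Set where
  bitwise  : ∀ {M ρ μ} z f d i j →
             Step {M = M} (bitwise z f d i j) ⟪ ρ , μ ⟫
                  ⟪ putReg z d (zipWith f (ρ z i) (ρ z j)) ρ , μ ⟫
  setFirst : ∀ {M ρ μ} z d i →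
             Step {M = M} (setFirst z d i) ⟪ ρ , μ ⟫
                  ⟪ putReg z d (firstBits (width n w z) (value (ρ small i))) ρ , μ ⟫
  add      : ∀ {M ρ μ} d i j →
             Step {M = M} (add d i j) ⟪ ρ , μ ⟫
                  ⟪ putReg small d (bits w (value (ρ small i) + value (ρ small j))) ρ , μ ⟫
  sub      : ∀ {M ρ μ} d i j →
             Step {M = M} (sub d i j) ⟪ ρ , μ ⟫
                  ⟪ putReg small d (bits w ((2 ^ w + value (ρ small i)) ∸ value (ρ small j))) ρ , μ ⟫
  load     : ∀ {M ρ μ} z d β i (a : Fin (suc n)) → value (ρ small i) ≡ toℕ a →
             Step {M = M} (load z d β i) ⟪ ρ , μ ⟫
                  ⟪ putReg z d (μ z β a) ρ , μ ⟫
  store    : ∀ {M ρ μ} z β i j (a : Fin (suc n)) → value (ρ small i) ≡ toℕ a →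
             Step {M = M} (store z β i j) ⟪ ρ , μ ⟫
                  ⟪ ρ , putMem z β a (ρ z j) μ ⟫
  firstSet : ∀ {ρ μ} z d i a → IsFirstSet (ρ z i) a →
             Step (firstSet z d i) ⟪ ρ , μ ⟫
                  ⟪ putReg small d (bits w (toℕ a)) ρ , μ ⟫
  lastSet  : ∀ {ρ μ} z d i a → IsLastSet (ρ z i) a →
             Step (lastSet z d i) ⟪ ρ , μ ⟫
                  ⟪ putReg small d (bits w (toℕ a)) ρ , μ ⟫

data Program (k b : ℕ) (M : Model) : Set where
  skip         : Program k b M
  instr        : Instr k b M → Program k b M
  _⨾_          : Program k b M → Program k b M → Program k b M
  ifZero       : Size → Fin k → (zeroBranch nonzeroBranch : Program k b M) → Program k b M
  whileNonzero : Size → Fin k → Program k b M → Program k b M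

-- Run c t s s′: started in s, the program c halts in s′ after t steps.
-- Each instruction and each test for zero takes one step.
data Run {k b n w : ℕ} {M : Model} :
         Program k b M → ℕ → State k b n w → State k b n w → Set where
  skip   : ∀ {s} → Run skip 0 s s
  instr  : ∀ {ι s s′} → Step ι s s′ → Run (instr ι) 1 s s′
  seq    : ∀ {c c′ t t′ s s′ s″} →
           Run c t s s′ → Run c′ t′ s′ s″ → Run (c ⨾ c′) (t + t′) s s″
  ifZ    : ∀ {z i c c′ t s s′} → IsZero (regs s z i) →
           Run c t s s′ → Run (ifZero z i c c′) (suc t) s s′
  ifNZ   : ∀ {z i c c′ t s s′} → ¬ IsZero (regs s z i) →
           Run c′ t s s′ → Run (ifZero z i c c′) (suc t) s s′
  whileZ : ∀ {z i c s} → IsZero (regs s z i) →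
           Run (whileNonzero z i c) 1 s s
  whileNZ : ∀ {z i c t t′ s s′ s″} → ¬ IsZero (regs s z i) →
            Run c t s s′ → Run (whileNonzero z i c) t′ s′ s″ →
            Run (whileNonzero z i c) (suc (t + t′)) s s″

------------------------------------------------------------------------
-- Data structures for Shisen-Sho

-- The machine state s holds the coordinates of c in small registers i, j.
Holds : ∀ {k b n w W H} → State k b n w → Fin k → Fin k → Cell W H → Set
Holds s i j (x , y) =
  value (regs s small i) ≡ toℕ x × value (regs s small j) ≡ toℕ y

-- One machine, one set of programs and one constant serve all n, all
-- widths w of small registers, and all boards.  Operands are passed in
-- the first working registers; the other working registers are
-- arbitrary, so only the memory survives between operations.
record DataStructure (M : Model) (testBound : (n d : ℕ) → ℕ) : Set₁ where
  field
    extra b constant : ℕ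

  k : ℕ
  k = 8 + extra

  field
    playProgram unplayProgram testProgram : Program k b M

    Represents : ∀ {n w W H} → Memory b n w → (Fin W → Fin H → Bool) → Set

    represents-exists :
      ∀ {n w W H} → n < 2 ^ w → W ≤ n → H ≤ n →
      (o : Fin W → Fin H → Bool) → ∃[ μ ] Represents {n} {w} μ o

    represents-determines :
      ∀ {n w W H} → n < 2 ^ w → W ≤ n → H ≤ n →
      (μ : Memory b n w) (o o′ : Fin W → Fin H → Bool) →
      Represents μ o → Represents μ o′ → ∀ x y → o x y ≡ o′ x y

    play-correct :
      ∀ {n w W H} → n < 2 ^ w → W ≤ n → H ≤ n →
      {K : Set} (P : Position K W H) (c : Cell W H) (κ : K) → tile P c ≡ just κ →
      (s : State k b n w) → Represents (memory s) (occupied P) → Holds s 0F 1F c →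
      ∃[ t ] ∃[ s′ ]
        (Run playProgram t s s′ ×
         t ≤ constant * (1 + ⌊log₂ n ⌋) ×
         Represents (memory s′) (occupied (play c P)))

    unplay-correct :
      ∀ {n w W H} → n < 2 ^ w → W ≤ n → H ≤ n →
      {K : Set} (P : Position K W H) (c : Cell W H) (κ : K) → tile P c ≡ nothing →
      (s : State k b n w) → Represents (memory s) (occupied P) → Holds s 0F 1F c →
      ∃[ t ] ∃[ s′ ]
        (Run unplayProgram t s s′ ×
         t ≤ constant * (1 + ⌊log₂ n ⌋) ×
         Represents (memory s′) (occupied (unplay κ c P)))

    -- A kind is given by two small registers, since the n² tiles that a
    -- board may carry can have more kinds than one small register can
    -- distinguish.
    test-correct :
      ∀ {n w W H} → n < 2 ^ w → W ≤ n → H ≤ n →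
      {K : Set} (code : K ↣ (Bits w × Bits w)) →
      (P : Position K W H) (p q : Cell W H) (κ κ′ : K) → p ≢ q →
      tile P p ≡ just κ → tile P q ≡ just κ′ →
      (s : State k b n w) → Represents (memory s) (occupied P) →
      Holds s 0F 1F p → Holds s 2F 3F q →
      (regs s small 4F , regs s small 5F) ≡ Injection.to code κ →
      (regs s small 6F , regs s small 7F) ≡ Injection.to code κ′ →
      ∃[ t ] ∃[ s′ ]
        (Run testProgram t s s′ ×
         t ≤ constant * (1 + testBound n (distance p q)) ×
         Represents (memory s′) (occupied P) ×
         ((¬ IsZero (regs s′ small 0F)) ⇔ Matching P p q))

{-# OPTIONS --safe #-}

-- Up to merging collinear segments, a path with at most three segments is
-- horizontal-vertical-horizontal or, after transposing the board, again of this
-- form.  Such a path is determined by the column of its middle segment.  In the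
-- two rows of the tiles the nearest obstacles to the left and to the right bound
-- the reachable columns, and the columns blocked between the two rows are given
-- by the union of the rows in between.  This union is read off a segment tree of
-- rows, bottom-up from the leaves, so that m rows take O(log m) steps; an update
-- recomputes the nodes above one leaf.  Columns outside the rectangle only
-- require both rows to be free towards the same side.  An obstacle is found by a
-- bit scan or, without bit scans, by binary search.

module Submission where

open import Defs
open import Data.Bool using (Bool; true; false; not; _∧_; _∨_; _xor_; if_then_else_; T)
open import Data.Bool.Properties using (∨-identityʳ; ∨-zeroʳ; ∧-zeroʳ; ∧-identityʳ; ¬-not)
open import Data.Empty using (⊥-elim)
open import Data.Fin as Fin using (Fin; toℕ; fromℕ<; #_)
open import Data.Fin.Patterns using (0F; 1F; 2F; 3F; 4F; 5F; 6F; 7F)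
open import Data.Fin.Properties using (toℕ<n; toℕ-fromℕ<; toℕ-injective; fromℕ<-toℕ)
open import Data.Integer as ℤ using (ℤ; -[1+_])
import Data.Integer.Properties as ℤₚ
open import Data.Maybe using (Maybe; just; nothing; is-just)
open import Data.Nat
open import Data.Nat.Logarithm using (⌊log₂_⌋; ⌊log₂⌋-mono-≤; ⌊log₂⌊n/2⌋⌋≡⌊log₂n⌋∸1)
open import Data.Nat.Properties
open import Data.Product using (Σ; _×_; _,_; proj₁; proj₂; ∃-syntax)
open import Data.Sum using (_⊎_; inj₁; inj₂; [_,_]′)
open import Data.Unit using (⊤; tt)
open import Data.Vec using (Vec; []; _∷_; lookup; replicate; tabulate; zipWith)
open import Data.Vec.Properties using (lookup-zipWith; lookup∘tabulate; lookup-replicate; tabulate∘lookup; tabulate-cong)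
open import Data.Vec.Functional.Properties using (updateAt-updates; updateAt-minimal)
open import Function using (_∘_; id; case_of_)
open import Function.Bundles using (_⇔_; mk⇔; _↣_; Injection; Equivalence)
open import Relation.Binary.PropositionalEquality
open import Relation.Nullary using (¬_; yes; no; does)

-- Bits and binary lengths

-- Both bounds come from one family of programs, analysed for an arbitrary ℓ: every cost is a
-- constant multiple of 1 + ℓ, and ℓ becomes log n or log d only at the end. What depends on the
-- distance is the number of lines strictly between the tiles, whereas the nearest obstacle in a row
-- can be about n columns away even for neighbouring tiles. Hence locating obstacles is the one task
-- for which bit scans matter, and lines must be united without a walk down from the root, which
-- costs log n whatever the range.
--
-- The board is kept twice, by rows and by columns, each copy with its own tree; the transposed
-- paths are then found by the same program with the coordinates exchanged. As the cells of the two
-- tiles may lie on a path, each tile is deleted from its line before scanning. The corners of a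
-- path are checked in these two lines, so the union covers only the lines strictly in between.
--
-- Lines and trees of both copies fit into six large banks, and no node number above n is ever held
-- in a small register, where it might overflow.

value< : ∀ {m} (v : Bits m) → value v < 2 ^ m
value< []                = s≤s z≤n
value< {suc m} (b ∷ v) = ≤-trans (+-monoˡ-≤ (2 * value v) (bit b))
  (≤-trans (≤-reflexive (sym (*-suc 2 (value v)))) (*-monoʳ-≤ 2 (value< v)))
  where
  bit : ∀ b → suc (if b then 1 else 0) ≤ 2
  bit true  = s≤s (s≤s z≤n)
  bit false = s≤s z≤n

parity-half : ∀ v → (if v % 2 ≡ᵇ 1 then 1 else 0) + 2 * ⌊ v /2⌋ ≡ v
parity-half 0             = refl
parity-half 1             = refl
parity-half (suc (suc v)) =
  trans (cong ((if v % 2 ≡ᵇ 1 then 1 else 0) +_) (*-suc 2 ⌊ v /2⌋))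
        (trans (+-suc _ _) (cong suc (trans (+-suc _ _) (cong suc (parity-half v)))))

⌊2*n/2⌋≡n : ∀ n → ⌊ 2 * n /2⌋ ≡ n
⌊2*n/2⌋≡n zero    = refl
⌊2*n/2⌋≡n (suc n) = trans (cong ⌊_/2⌋ (*-suc 2 n)) (cong suc (⌊2*n/2⌋≡n n))

half-< : ∀ {v m} → v < 2 * m → ⌊ v /2⌋ < m
half-< {v} {m} v<2m = *-cancelˡ-< 2 ⌊ v /2⌋ m
  (<-≤-trans (s≤s (≤-trans (m≤n+m (2 * ⌊ v /2⌋) (if v % 2 ≡ᵇ 1 then 1 else 0))
  (≤-reflexive (parity-half v)))) v<2m)

value-bits : ∀ m {v} → v < 2 ^ m → value (bits m v) ≡ v
value-bits zero    {zero}  _       = refl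
value-bits zero    {suc v} (s≤s ())
value-bits (suc m) {v} v<  =
  trans (cong (λ u → (if v % 2 ≡ᵇ 1 then 1 else 0) + 2 * u) (value-bits m (half-< v<))) (parity-half v)

bit-cong : ∀ a b {u v} → (if a then 1 else 0) + 2 * u ≡ (if b then 1 else 0) + 2 * v → a ≡ b × u ≡ v
bit-cong true  true  eq = refl , *-cancelˡ-≡ _ _ 2 (suc-injective eq)
bit-cong false false eq = refl , *-cancelˡ-≡ _ _ 2 eq
bit-cong true  false {u} {v} eq = ⊥-elim (odd≢even u v eq)
  where
  odd≢even : ∀ u v → suc (2 * u) ≢ 2 * v
  odd≢even u (suc v) eq rewrite *-suc 2 v with u
  ... | zero  = case eq of λ ()
  ... | suc u rewrite *-suc 2 u = odd≢even u v (suc-injective (suc-injective eq))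
bit-cong false true  {u} {v} eq = let (a≡b , u≡v) = bit-cong true false {v} {u} (sym eq) in sym a≡b ,
  sym u≡v

value-injective : ∀ {m} {u v : Bits m} → value u ≡ value v → u ≡ v
value-injective {u = []}    {[]}    _  = refl
value-injective {u = a ∷ u} {b ∷ v} eq =
  let (a≡b , eq′) = bit-cong a b eq in cong₂ _∷_ a≡b (value-injective eq′)

lookup-ext : ∀ {m} {A : Set} {u v : Vec A m} → (∀ i → lookup u i ≡ lookup v i) → u ≡ v
lookup-ext {u = u} {v} eq = trans (sym (tabulate∘lookup u)) (trans (tabulate-cong eq) (tabulate∘lookup v))

IsZero-lookup : ∀ {m} {v : Bits m} → IsZero v → ∀ i → lookup v i ≡ false
IsZero-lookup v≡0 i = trans (cong (λ u → lookup u i) v≡0) (lookup-replicate i false)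

lookup-IsZero : ∀ {m} {v : Bits m} → (∀ i → lookup v i ≡ false) → IsZero v
lookup-IsZero eq = lookup-ext (λ i → trans (eq i) (sym (lookup-replicate i false)))

IsZero? : ∀ {m} (v : Bits m) → IsZero v ⊎ ∃[ i ] lookup v i ≡ true
IsZero? []          = inj₁ refl
IsZero? (true ∷ v)  = inj₂ (0F , refl)
IsZero? (false ∷ v) with IsZero? v
... | inj₁ v≡0       = inj₁ (cong (false ∷_) v≡0)
... | inj₂ (i , eq) = inj₂ (Fin.suc i , eq)

true≢false : true ≢ false
true≢false ()

nonzero : ∀ {m} {v : Bits m} i → lookup v i ≡ true → ¬ IsZero v
nonzero i eq v≡0 = true≢false (trans (sym eq) (IsZero-lookup v≡0 i))

value-zero : ∀ m → value (replicate m false) ≡ 0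
value-zero zero    = refl
value-zero (suc m) = cong (2 *_) (value-zero m)

IsZero-value : ∀ {m} {v : Bits m} → IsZero v → value v ≡ 0
IsZero-value {m} v≡0 = trans (cong value v≡0) (value-zero m)

value-IsZero : ∀ {m} {v : Bits m} → value v ≡ 0 → IsZero v
value-IsZero {m} eq = value-injective (trans eq (sym (value-zero m)))

xor-self : ∀ {m} (u : Bits m) → IsZero (zipWith _xor_ u u)
xor-self []          = refl
xor-self (true ∷ u)  = cong (false ∷_) (xor-self u)
xor-self (false ∷ u) = cong (false ∷_) (xor-self u)

xor-zero : ∀ {m} (u v : Bits m) → IsZero (zipWith _xor_ u v) → u ≡ v
xor-zero []          []          _  = refl
xor-zero (true ∷ u)  (true ∷ v)  eq = cong (true ∷_) (xor-zero u v (cong Data.Vec.tail eq))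
xor-zero (false ∷ u) (false ∷ v) eq = cong (false ∷_) (xor-zero u v (cong Data.Vec.tail eq))
xor-zero (true ∷ u)  (false ∷ v) ()
xor-zero (false ∷ u) (true ∷ v)  ()

zipWith-const : ∀ {m} (u v : Bits m) → zipWith (λ a _ → a) u v ≡ u
zipWith-const []      []      = refl
zipWith-const (a ∷ u) (b ∷ v) = cong (a ∷_) (zipWith-const u v)

<ᵇ-true : ∀ {i k} → i < k → (i <ᵇ k) ≡ true
<ᵇ-true {i} {k} i<k with i <ᵇ k | <⇒<ᵇ i<k
... | true | _ = refl

<ᵇ-false : ∀ {i k} → k ≤ i → (i <ᵇ k) ≡ false
<ᵇ-false {i} {k} k≤i with i <ᵇ k in eq
... | false = refl
... | true  = ⊥-elim (<⇒≱ (<ᵇ⇒< i k (subst T (sym eq) tt)) k≤i)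

lookup-firstBits : ∀ m k i → lookup (firstBits m k) i ≡ (toℕ i <ᵇ k)
lookup-firstBits m k i = lookup∘tabulate (λ i → toℕ i <ᵇ k) i

andNot : Bool → Bool → Bool
andNot a b = a ∧ not b

lookup-∨-false : ∀ {m} (u v : Bits m) i → lookup u i ≡ false → lookup v i ≡ false → lookup
  (zipWith _∨_ u v) i ≡ false
lookup-∨-false u v i eq eq′ rewrite lookup-zipWith _∨_ i u v | eq | eq′ = refl

∨-false-lookup : ∀ {m} (u v : Bits m) i → lookup (zipWith _∨_ u v) i ≡ false → lookup u i ≡ false ×
  lookup v i ≡ false
∨-false-lookup u v i eq rewrite lookup-zipWith _∨_ i u v with lookup u i | lookup v i
... | false | false = refl , refl

-- The number of binary digits. Unlike `⌊log₂_⌋`, which takes the same value at 0 and 1, it drops at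
-- every halving down to 0 and so counts the iterations of a loop that ends at 0.
bitLength : ℕ → ℕ
bitLength zero    = 0
bitLength (suc m) = suc ⌊log₂ suc m ⌋

⌊log₂⌋-half : ∀ m → ⌊log₂ suc (suc m) ⌋ ≡ suc ⌊log₂ suc ⌊ m /2⌋ ⌋
⌊log₂⌋-half m = trans (sym (m+[n∸m]≡n {1} positive)) (cong suc (sym (⌊log₂⌊n/2⌋⌋≡⌊log₂n⌋∸1 (suc (suc m)))))
  where
  positive : 1 ≤ ⌊log₂ suc (suc m) ⌋
  positive = ⌊log₂⌋-mono-≤ {2} {suc (suc m)} (s≤s (s≤s z≤n))

bitLength-mono : ∀ {m n} → m ≤ n → bitLength m ≤ bitLength n
bitLength-mono {zero}          _   = z≤n
bitLength-mono {suc m} {suc n} m≤n = s≤s (⌊log₂⌋-mono-≤ m≤n)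

bitLength-half : ∀ {m m′} → m′ ≤ ⌊ suc m /2⌋ → suc (bitLength m′) ≤ bitLength (suc m)
bitLength-half {zero}  z≤n = s≤s z≤n
bitLength-half {suc m} m′≤ = s≤s (≤-trans (bitLength-mono m′≤) (≤-reflexive (sym (⌊log₂⌋-half m))))

bitLength≤ : ∀ {m n} → m ≤ n → bitLength m ≤ suc ⌊log₂ n ⌋
bitLength≤ {m} {zero}  z≤n = z≤n
bitLength≤ {m} {suc n} m≤n = bitLength-mono m≤n

-- Total correctness of programs with time bounds

infixr 15 _▸_ _»_

_▸_ : ∀ {k b M} → Instr k b M → Program k b M → Program k b M
ι ▸ c = instr ι ⨾ c

_»_ : ∀ {k b M} → Program k b M → Program k b M → Program k b M
c » c′ = c ⨾ c′

-- Costs are measured in units of 1 + ℓ.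
record Ends {k b n w M} (ℓ : ℕ) (c : Program k b M) (s : State k b n w) (C : ℕ) (Q : State k b n w → Set)
  : Set where
  constructor ends
  field
    {time}  : ℕ
    {final} : State k b n w
    run     : Run c time s final
    bound   : time ≤ C * suc ℓ
    result  : Q final

module _ {k b n w : ℕ} {M : Model} where

  private
    St = State k b n w
    Pr = Program k b M

  ends-mono : ∀ {ℓ C C′} {c : Pr} {s : St} {Q Q′ : St → Set} → C ≤ C′ → (∀ s′ → Q s′ → Q′ s′) →
              Ends ℓ c s C Q → Ends ℓ c s C′ Q′
  ends-mono {ℓ} C≤C′ Q⇒Q′ (ends run t≤ q) =
    ends run (≤-trans t≤ (*-monoˡ-≤ (suc ℓ) C≤C′)) (Q⇒Q′ _ q)

  ends-map : ∀ {ℓ C} {c : Pr} {s : St} {Q Q′ : St → Set} → (∀ s′ → Q s′ → Q′ s′) →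
             Ends ℓ c s C Q → Ends ℓ c s C Q′
  ends-map = ends-mono ≤-refl

  ends-then : ∀ {ℓ C} {c : Pr} {s : St} {Q Q′ : St → Set} → Ends ℓ c s C Q → (∀ s′ → Q s′ → Q′ s′) →
              Ends ℓ c s C Q′
  ends-then e f = ends-map f e

  ends-skip : ∀ {ℓ} {s : St} {Q : St → Set} → Q s → Ends {M = M} ℓ skip s 0 Q
  ends-skip q = ends skip z≤n q

  ends-instr : ∀ {ℓ} {ι : Instr k b M} {s s′ : St} {Q : St → Set} → Step ι s s′ → Q s′ → Ends ℓ
    (instr ι) s 1 Q
  ends-instr step q = ends (instr step) (s≤s z≤n) q

  ends-seq : ∀ {ℓ C C′} {c c′ : Pr} {s : St} {Q Q′ : St → Set} →
             Ends ℓ c s C Q → (∀ s′ → Q s′ → Ends ℓ c′ s′ C′ Q′) → Ends ℓ (c ⨾ c′) s (C + C′) Q′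
  ends-seq {ℓ} {C} {C′} (ends run t≤ q) next =
    let ends run′ t′≤ q′ = next _ q
    in ends (seq run run′) (≤-trans (+-mono-≤ t≤ t′≤) (≤-reflexive (sym (*-distribʳ-+ (suc ℓ) C C′)))) q′

  ends-step : ∀ {ℓ C} {ι : Instr k b M} {c : Pr} {s s′ : St} {Q : St → Set} →
              Step ι s s′ → Ends ℓ c s′ C Q → Ends ℓ (ι ▸ c) s (suc C) Q
  ends-step step (ends run t≤ q) = ends (seq (instr step) run) (+-mono-≤ (s≤s z≤n) t≤) q

  ends-ifZero : ∀ {ℓ C z i} {c c′ : Pr} {s : St} {Q : St → Set} →
                (IsZero (regs s z i) → Ends ℓ c s C Q) →
                (¬ IsZero (regs s z i) → Ends ℓ c′ s C Q) →
                Ends ℓ (ifZero z i c c′) s (suc C) Q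
  ends-ifZero {z = z} {i} {s = s} zeroCase nonzeroCase with IsZero? (regs s z i)
  ... | inj₁ v≡0       =
    let ends run t≤ q = zeroCase v≡0 in ends (ifZ v≡0 run) (+-mono-≤ (s≤s z≤n) t≤) q
  ... | inj₂ (j , eq) =
    let v≢0 = nonzero j eq ; ends run t≤ q = nonzeroCase v≢0
    in ends (ifNZ v≢0 run) (+-mono-≤ (s≤s z≤n) t≤) q

  -- Taking the body at ℓ = 0 makes `C` a bound on its actual number of steps. An iteration with its
  -- test then takes at most `C + 1` steps, there are at most `bitLength m` of them, and the last
  -- test adds one step; together this stays within `2 + C` units.
  while-halving : ∀ {C z i} {c : Pr} (Inv : ℕ → St → Set) →
    (∀ s → Inv 0 s → IsZero (regs s z i)) →
    (∀ m s → Inv (suc m) s → ¬ IsZero (regs s z i) ×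
      Ends 0 c s C (λ s′ → ∃[ m′ ] (m′ ≤ ⌊ suc m /2⌋ × Inv m′ s′))) →
    ∀ ℓ m s → bitLength m ≤ suc ℓ → Inv m s → Ends ℓ (whileNonzero z i c) s (2 + C) (Inv 0)
  while-halving {C} {z} {i} {c} Inv stop body ℓ m s m≤ℓ inv =
    let (t , s′ , run , t≤ , inv′) = loop m m s ≤-refl inv
    in ends run (≤-trans t≤ bound) inv′
    where
    bound : suc (suc C * bitLength m) ≤ (2 + C) * suc ℓ
    bound = +-mono-≤ (s≤s (z≤n {ℓ})) (*-monoʳ-≤ (suc C) m≤ℓ)

    -- The next measure is only known to be at most half of the present one, so `fuel` carries the
    -- structural recursion.
    loop : ∀ fuel m s → m ≤ fuel → Inv m s →
           ∃[ t ] ∃[ s′ ] (Run (whileNonzero z i c) t s s′ × t ≤ suc (suc C * bitLength m) × Inv 0 s′)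
    loop _          zero    s _        inv = 1 , s , whileZ (stop s inv) , s≤s z≤n , inv
    loop (suc fuel) (suc m) s (s≤s m≤) inv =
      let (guard , ends run t≤ (m′ , m′≤ , inv′)) = body m s inv
          (t′ , s″ , run′ , t′≤ , inv″) = loop fuel m′ _ (≤-trans m′≤ (≤-trans (≤-pred (⌊n/2⌋<n m)) m≤))
            inv′
      in _ , s″ , whileNZ guard run run′ , s≤s (time t≤ t′≤ (bitLength-half m′≤)) , inv″
      where
      time : ∀ {t t′ L L′} → t ≤ C * 1 → t′ ≤ suc (suc C * L′) → suc L′ ≤ L → t + t′ ≤ suc C * L
      time {t} {t′} {L} {L′} t≤ t′≤ L′<L = begin
        t + t′                  ≤⟨ +-mono-≤ t≤ t′≤ ⟩
        C * 1 + suc (suc C * L′) ≡⟨ cong (_+ suc (suc C * L′)) (*-identityʳ C) ⟩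
        C + suc (suc C * L′)    ≡⟨ +-suc C _ ⟩
        suc C + suc C * L′      ≡⟨ *-suc (suc C) L′ ⟨
        suc C * suc L′          ≤⟨ *-monoʳ-≤ (suc C) L′<L ⟩
        suc C * L               ∎
        where open ≤-Reasoning

-- Frame conditions: what a program leaves unchanged

sameSize : Size → Size → Bool
sameSize large large = true
sameSize small small = true
sameSize large small = false
sameSize small large = false

same : ∀ {k} → Size → Fin k → Size → Fin k → Bool
same z i z′ i′ = sameSize z z′ ∧ does (i Fin.≟ i′)

instrWrites : ∀ {k b M} → Instr k b M → Size → Fin k → Bool
instrWrites (bitwise z f d i j) = same z d
instrWrites (setFirst z d i)    = same z d
instrWrites (add d i j)         = same small d
instrWrites (sub d i j)         = same small d
instrWrites (load z d β i)      = same z d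
instrWrites (store z β i j)     = λ _ _ → false
instrWrites (firstSet z d i)    = same small d
instrWrites (lastSet z d i)     = same small d

-- A syntactic overapproximation. For a concrete program and register it evaluates, so that frame
-- conditions are proved by `refl`.
writes : ∀ {k b M} → Program k b M → Size → Fin k → Bool
writes skip                 z′ i′ = false
writes (instr ι)            z′ i′ = instrWrites ι z′ i′
writes (c ⨾ c′)             z′ i′ = writes c z′ i′ ∨ writes c′ z′ i′
writes (ifZero z i c c′)    z′ i′ = writes c z′ i′ ∨ writes c′ z′ i′
writes (whileNonzero z i c) z′ i′ = writes c z′ i′

instrStores : ∀ {k b M} → Instr k b M → Size → Fin b → Bool
instrStores (bitwise z f d i j) = λ _ _ → false
instrStores (setFirst z d i)    = λ _ _ → false
instrStores (add d i j)         = λ _ _ → false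
instrStores (sub d i j)         = λ _ _ → false
instrStores (load z d β i)      = λ _ _ → false
instrStores (store z β i j)     = same z β
instrStores (firstSet z d i)    = λ _ _ → false
instrStores (lastSet z d i)     = λ _ _ → false

stores : ∀ {k b M} → Program k b M → Size → Fin b → Bool
stores skip                 z′ β = false
stores (instr ι)            z′ β = instrStores ι z′ β
stores (c ⨾ c′)             z′ β = stores c z′ β ∨ stores c′ z′ β
stores (ifZero z i c c′)    z′ β = stores c z′ β ∨ stores c′ z′ β
stores (whileNonzero z i c) z′ β = stores c z′ β

instrStoreFree : ∀ {k b M} → Instr k b M → Bool
instrStoreFree (store z β i j) = false
instrStoreFree _               = true

-- `stores` yields equality of memories bank by bank. Memories being functions, this would give
-- equality of the whole memory only with function extensionality, so programs without stores are
-- recognised separately.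
storeFree : ∀ {k b M} → Program k b M → Bool
storeFree skip                 = true
storeFree (instr ι)            = instrStoreFree ι
storeFree (c ⨾ c′)             = storeFree c ∧ storeFree c′
storeFree (ifZero z i c c′)    = storeFree c ∧ storeFree c′
storeFree (whileNonzero z i c) = storeFree c

∧-true : ∀ a b → a ∧ b ≡ true → a ≡ true × b ≡ true
∧-true true b eq = refl , eq

∨-false : ∀ a b → a ∨ b ≡ false → a ≡ false × b ≡ false
∨-false false b eq = refl , eq

different : ∀ {k} (d i : Fin k) → does (d Fin.≟ i) ≡ false → i ≢ d
different d i eq i≡d with d Fin.≟ i
... | no d≢i = d≢i (sym i≡d)

putReg-other : ∀ {k n w} z d (v : Bits (width n w z)) (ρ : Regs k n w) z′ i →
               same z d z′ i ≡ false → putReg z d v ρ z′ i ≡ ρ z′ i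
putReg-other large d v ρ large i eq = updateAt-minimal i d (ρ large) (different d i eq)
putReg-other large d v ρ small i eq = refl
putReg-other small d v ρ large i eq = refl
putReg-other small d v ρ small i eq = updateAt-minimal i d (ρ small) (different d i eq)

putMem-other : ∀ {b n w} z β a (v : Bits (width n w z)) (μ : Memory b n w) z′ β′ →
               same z β z′ β′ ≡ false → putMem z β a v μ z′ β′ ≡ μ z′ β′
putMem-other large d a v μ large i eq = updateAt-minimal i d (μ large) (different d i eq)
putMem-other large d a v μ small i eq = refl
putMem-other small d a v μ large i eq = refl
putMem-other small d a v μ small i eq = updateAt-minimal i d (μ small) (different d i eq)

module _ {k b n w : ℕ} {M : Model} where

  private
    St = State k b n w
    Pr = Program k b M

  step-regs : ∀ {ι : Instr k b M} {s s′ : St} → Step ι s s′ →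
              ∀ z i → instrWrites ι z i ≡ false → regs s′ z i ≡ regs s z i
  step-regs (bitwise {ρ = ρ} z f d i j) z′ i′ eq = putReg-other z d _ ρ z′ i′ eq
  step-regs (setFirst {ρ = ρ} z d i)    z′ i′ eq = putReg-other z d _ ρ z′ i′ eq
  step-regs (add {ρ = ρ} d i j)         z′ i′ eq = putReg-other small d _ ρ z′ i′ eq
  step-regs (sub {ρ = ρ} d i j)         z′ i′ eq = putReg-other small d _ ρ z′ i′ eq
  step-regs (load {ρ = ρ} z d β i a _)  z′ i′ eq = putReg-other z d _ ρ z′ i′ eq
  step-regs (store z β i j a _)         z′ i′ eq = refl
  step-regs (firstSet {ρ = ρ} z d i a _) z′ i′ eq = putReg-other small d _ ρ z′ i′ eq
  step-regs (lastSet {ρ = ρ} z d i a _)  z′ i′ eq = putReg-other small d _ ρ z′ i′ eq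

  run-regs : ∀ {c : Pr} {t} {s s′ : St} → Run c t s s′ →
             ∀ z i → writes c z i ≡ false → regs s′ z i ≡ regs s z i
  run-regs skip             z i eq = refl
  run-regs (instr step)     z i eq = step-regs step z i eq
  run-regs (seq r r′)       z i eq =
    let (e , e′) = ∨-false _ _ eq in trans (run-regs r′ z i e′) (run-regs r z i e)
  run-regs (ifZ {c = c} _ r)        z i eq = run-regs r z i (proj₁ (∨-false (writes c z i) _ eq))
  run-regs (ifNZ {c = c} _ r)       z i eq = run-regs r z i (proj₂ (∨-false (writes c z i) _ eq))
  run-regs (whileZ _)       z i eq = refl
  run-regs (whileNZ _ r r′) z i eq = trans (run-regs r′ z i eq) (run-regs r z i eq)

  step-memory : ∀ {ι : Instr k b M} {s s′ : St} → Step ι s s′ →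
                ∀ z β → instrStores ι z β ≡ false → memory s′ z β ≡ memory s z β
  step-memory (bitwise _ _ _ _ _)             z′ β′ eq = refl
  step-memory (setFirst _ _ _)                z′ β′ eq = refl
  step-memory (add _ _ _)                     z′ β′ eq = refl
  step-memory (sub _ _ _)                     z′ β′ eq = refl
  step-memory (load _ _ _ _ _ _)              z′ β′ eq = refl
  step-memory (store {ρ = ρ} {μ} z β i j a _) z′ β′ eq = putMem-other z β a (ρ z j) μ z′ β′ eq
  step-memory (firstSet _ _ _ _ _)            z′ β′ eq = refl
  step-memory (lastSet _ _ _ _ _)             z′ β′ eq = refl

  run-memory : ∀ {c : Pr} {t} {s s′ : St} → Run c t s s′ →
               ∀ z β → stores c z β ≡ false → memory s′ z β ≡ memory s z β
  run-memory skip             z β eq = refl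
  run-memory (instr step)     z β eq = step-memory step z β eq
  run-memory (seq r r′)       z β eq =
    let (e , e′) = ∨-false _ _ eq in trans (run-memory r′ z β e′) (run-memory r z β e)
  run-memory (ifZ {c = c} _ r)        z β eq = run-memory r z β (proj₁ (∨-false (stores c z β) _ eq))
  run-memory (ifNZ {c = c} _ r)       z β eq = run-memory r z β (proj₂ (∨-false (stores c z β) _ eq))
  run-memory (whileZ _)       z β eq = refl
  run-memory (whileNZ _ r r′) z β eq = trans (run-memory r′ z β eq) (run-memory r z β eq)

  run-storeFree : ∀ {c : Pr} {t} {s s′ : St} → Run c t s s′ → storeFree c ≡ true → memory s′ ≡ memory s
  run-storeFree skip                      eq = refl
  run-storeFree (instr (bitwise _ _ _ _ _))    eq = refl
  run-storeFree (instr (setFirst _ _ _))       eq = refl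
  run-storeFree (instr (add _ _ _))            eq = refl
  run-storeFree (instr (sub _ _ _))            eq = refl
  run-storeFree (instr (load _ _ _ _ _ _))     eq = refl
  run-storeFree (instr (firstSet _ _ _ _ _))   eq = refl
  run-storeFree (instr (lastSet _ _ _ _ _))    eq = refl
  run-storeFree (seq {c = c} r r′)        eq =
    let (e , e′) = ∧-true (storeFree c) _ eq in trans (run-storeFree r′ e′) (run-storeFree r e)
  run-storeFree (ifZ {c = c} _ r)         eq = run-storeFree r (proj₁ (∧-true (storeFree c) _ eq))
  run-storeFree (ifNZ {c = c} _ r)        eq = run-storeFree r (proj₂ (∧-true (storeFree c) _ eq))
  run-storeFree (whileZ _)                eq = refl
  run-storeFree (whileNZ _ r r′)          eq = trans (run-storeFree r′ eq) (run-storeFree r eq)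

  record Frame (c : Pr) (s s′ : St) : Set where
    constructor frame
    field
      kept   : ∀ z i → writes c z i ≡ false → regs s′ z i ≡ regs s z i
      intact : ∀ z β → stores c z β ≡ false → memory s′ z β ≡ memory s z β
      fixed  : storeFree c ≡ true → memory s′ ≡ memory s

  -- Adds frame conditions to a specification afterwards, so that postconditions can be confined to
  -- what a program computes.
  framed : ∀ {ℓ C} {c : Pr} {s : St} {Q : St → Set} →
           Ends ℓ c s C Q → Ends ℓ c s C (λ s′ → Q s′ × Frame c s s′)
  framed (ends run t≤ q) = ends run t≤ (q , frame (run-regs run) (run-memory run) (run-storeFree run))

open Frame public

-- Finding set bits

K : ℕ
K = 24

-- Small registers 0 to 7 hold the operands and stay untouched until the result is written, because
-- the second, transposed pass reads them again. Of the others, `rL` and `rR` are the ends of a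
-- range, or in a binary search its low end and its length; `rH` and `rC` are halves rounded down
-- and up, `rG` is mostly a guard, and `rS` is the verdict.
rX rY rX′ rY′ rL rR rH rC rH′ rC′ rG rS : Fin K
rX  = # 8
rY  = # 9
rX′ = # 10
rY′ = # 11
rL  = # 12
rR  = # 13
rH  = # 14
rC  = # 15
rH′ = # 16
rC′ = # 17
rG  = # 18
rS  = # 19

lAcc lRow lRow′ lArg lTmp lLeft lRight lThis : Fin K
lAcc   = 0F
lRow   = 1F
lRow′  = 2F
lArg   = 3F
lTmp   = 4F
lLeft  = 5F
lRight = 6F
lThis  = 7F

Prog : Model → Set
Prog M = Program K 6 M

-- The machine has neither shifts nor constants; tables provide them.
table : ℕ → Fin 6 → ℕ → ℕ
table n 0F a = ⌊ a /2⌋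
table n 1F a = ⌈ a /2⌉
table n 2F a = ⌊ n + a /2⌋
table n 3F a = ⌈ n + a /2⌉
table n 4F a = n
table n 5F a = suc a ⊓ n

Tables : ∀ {n w} → Memory 6 n w → Set
Tables {n} μ = ∀ β a → value (μ small β a) ≡ table n β (toℕ a)

-- Addresses above n are clamped.
slot : ∀ {n} → ℕ → Fin (suc n)
slot {n} v = fromℕ< (s≤s (m⊓n≤n v n))

toℕ-slot : ∀ {n v} → v ≤ n → toℕ (slot {n} v) ≡ v
toℕ-slot v≤n = trans (toℕ-fromℕ< _) (m≤n⇒m⊓n≡m v≤n)

mov : ∀ {M} → Size → (d i : Fin K) → Instr K 6 M
mov z d i = bitwise z (λ a _ → a) d i i

module _ {n w : ℕ} {M : Model} {ℓ C : ℕ} {c : Prog M} {s : State K 6 n w} {Q : State K 6 n w → Set} where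

  -- The continuation gets the new contents as a variable with an equation, and in several rules
  -- below with its value or its bits; otherwise the terms for the registers would grow with every
  -- instruction.
  ends-bitwise : ∀ z f d i j →
    (∀ u → u ≡ zipWith f (regs s z i) (regs s z j) → Ends ℓ c ⟪ putReg z d u (regs s) , memory s ⟫ C Q) →
    Ends ℓ (bitwise z f d i j ▸ c) s (suc C) Q
  ends-bitwise z f d i j next = ends-step (bitwise z f d i j) (next _ refl)

  ends-mov : ∀ z d i → Ends ℓ c ⟪ putReg z d (regs s z i) (regs s) , memory s ⟫ C Q →
             Ends ℓ (mov z d i ▸ c) s (suc C) Q
  ends-mov z d i next =
    ends-bitwise z _ d i i (λ u eq → subst (λ u → Ends ℓ c ⟪ putReg z d u (regs s) , memory s ⟫ C Q)
                                           (sym (trans eq (zipWith-const _ _))) next)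

  ends-setFirst : ∀ d i {v} → value (regs s small i) ≡ v →
    (∀ u → (∀ j → lookup u j ≡ (toℕ j <ᵇ v)) → Ends ℓ c ⟪ putReg large d u (regs s) , memory s ⟫ C Q) →
    Ends ℓ (setFirst large d i ▸ c) s (suc C) Q
  ends-setFirst d i eq next =
    ends-step (setFirst large d i) (next _ (λ j → trans (lookup-firstBits n (value (regs s small i)) j)
      (cong (toℕ j <ᵇ_) eq)))

  ends-add : ∀ d i j {a b} → value (regs s small i) ≡ a → value (regs s small j) ≡ b → a + b < 2 ^ w →
    (∀ u → value u ≡ a + b → Ends ℓ c ⟪ putReg small d u (regs s) , memory s ⟫ C Q) →
    Ends ℓ (add d i j ▸ c) s (suc C) Q
  ends-add d i j refl refl a+b< next = ends-step (add d i j) (next _ (value-bits w a+b<))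

  ends-load : ∀ z d β i {v} → value (regs s small i) ≡ v → v ≤ n →
    Ends ℓ c ⟪ putReg z d (memory s z β (slot v)) (regs s) , memory s ⟫ C Q →
    Ends ℓ (load z d β i ▸ c) s (suc C) Q
  ends-load z d β i eq v≤n next = ends-step (load z d β i (slot _) (trans eq (sym (toℕ-slot v≤n)))) next

  ends-store : ∀ β i j {v} → value (regs s small i) ≡ v → v ≤ n →
    Ends ℓ c ⟪ regs s , putMem large β (slot v) (regs s large j) (memory s) ⟫ C Q →
    Ends ℓ (store large β i j ▸ c) s (suc C) Q
  ends-store β i j eq v≤n next = ends-step (store large β i j (slot _) (trans eq (sym (toℕ-slot v≤n)))) next

  ends-table : Tables (memory s) → ∀ d β i {v} → value (regs s small i) ≡ v → v ≤ n →
    (∀ u → value u ≡ table n β v → Ends ℓ c ⟪ putReg small d u (regs s) , memory s ⟫ C Q) →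
    Ends ℓ (load small d β i ▸ c) s (suc C) Q
  ends-table tables d β i eq v≤n next =
    ends-load small d β i eq v≤n (next _ (trans (tables β _) (cong (table n β) (toℕ-slot v≤n))))

raise lower : ∀ {M} → Prog M
raise = mov small rL rG ▸ mov small rR rC ▸ skip
lower = mov small rR rH ▸ skip

branch : ∀ {M} → Bool → Prog M
branch true  = raise
branch false = lower

-- `rG` becomes the middle of the window, and `f` combines the vector with the prefix of bits below
-- it. For `_∧_` a zero result means that the first set bit is at or above the middle, for `andNot`
-- that the last set bit is below it; `up` says whether zero moves the window up.
searchBody : ∀ {M} → (Bool → Bool → Bool) → Bool → Prog M
searchBody f up =
  load small rC 1F rR ▸ add rG rL rH ▸ setFirst large lTmp rG ▸ bitwise large f lTmp lArg lTmp ▸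
  ifZero large lTmp (branch up) (branch (not up)) » load small rH 0F rR ▸ skip

search : ∀ {M} → (Bool → Bool → Bool) → Bool → Prog M
search f up =
  -- The self-xor produces zero, which is the low end of the window and also a valid address for
  -- reading the constant `n` from table 4.
  bitwise small _xor_ rL rL rL ▸ load small rR 4F rL ▸ load small rH 0F rR ▸
  whileNonzero small rH (searchBody f up)

Side : Bool → ℕ → ℕ → Set
Side true  m a = m ≤ a
Side false m a = a < m

half-pred : ∀ m → ⌊ suc m /2⌋ ≤ suc ⌊ m /2⌋
half-pred zero    = z≤n
half-pred (suc m) = s≤s (⌊n/2⌋-mono (n≤1+n m))

module Search {n w : ℕ} (n<2^w : n < 2 ^ w) {M : Model} (f : Bool → Bool → Bool) (up : Bool)
              (v : Bits n) (a : ℕ) (a<n : a < n)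
              (onZero : ∀ m u → (∀ j → lookup u j ≡ (toℕ j <ᵇ m)) → IsZero (zipWith f v u) → Side up m a)
              (onNonzero : ∀ m u → (∀ j → lookup u j ≡ (toℕ j <ᵇ m)) → ¬ IsZero (zipWith f v u) → Side
                (not up) m a)
              where

  record Window (lo len : ℕ) (s : State K 6 n w) : Set where
    constructor window
    field
      tables : Tables (memory s)
      arg    : regs s large lArg ≡ v
      low    : value (regs s small rL) ≡ lo
      length : value (regs s small rR) ≡ len
      lo≤a   : lo ≤ a
      a<     : a < lo + len
      fits   : lo + len ≤ n

  -- The measure is the window length minus one. The upper part of a window of length `suc m` has
  -- length ⌈suc m /2⌉ = suc ⌊m /2⌋, which can exceed half of `suc m`, but after subtracting one it
  -- is at most half of `m`. Measure 0 leaves a single candidate.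
  Inv : ℕ → State K 6 n w → Set
  Inv m s = ∃[ lo ] (Window lo (suc m) s × value (regs s small rH) ≡ ⌊ suc m /2⌋)

  branch-correct : ∀ e {lo m} (s : State K 6 n w) → Window lo (suc m) s →
    value (regs s small rH) ≡ ⌊ suc m /2⌋ → value (regs s small rC) ≡ ⌈ suc m /2⌉ →
    value (regs s small rG) ≡ lo + ⌊ suc m /2⌋ → ⌊ suc m /2⌋ ≢ 0 → Side e (lo + ⌊ suc m /2⌋) a →
    Ends {M = M} 0 (branch e) s 2 (λ s′ → ∃[ lo′ ] ∃[ m′ ] (m′ ≤ ⌊ m /2⌋ × Window lo′ (suc m′) s′))
  branch-correct true {lo} {m} s (window t ar l le lo≤a a< fits) h c g _ side =
    ends-mov small rL rG (ends-mov small rR rC (ends-skip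
      (lo + ⌊ suc m /2⌋ , ⌊ m /2⌋ , ≤-refl ,
       window t ar g c side (subst (a <_) (sym whole) a<) (subst (_≤ n) (sym whole) fits))))
    where
    whole : lo + ⌊ suc m /2⌋ + ⌈ suc m /2⌉ ≡ lo + suc m
    whole = trans (+-assoc lo _ _) (cong (lo +_) (⌊n/2⌋+⌈n/2⌉≡n (suc m)))
  branch-correct false {lo} {m} s (window t ar l le lo≤a a< fits) h c g h≢0 side with ⌊ suc m /2⌋ in eq
  ... | zero   = ⊥-elim (h≢0 refl)
  ... | suc m′ =
    ends-mono (s≤s z≤n) (λ _ q → q) (ends-mov small rR rH (ends-skip
      (lo , m′ , ≤-pred (subst (_≤ suc ⌊ m /2⌋) eq (half-pred m)) ,
       window t ar l h lo≤a side (≤-trans (+-monoʳ-≤ lo (subst (_≤ suc m) eq (⌊n/2⌋≤n (suc m)))) fits))))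

  body-correct : ∀ m s → Inv (suc m) s → ¬ IsZero (regs s small rH) ×
    Ends {M = M} 0 (searchBody f up) s 8 (λ s′ → ∃[ m′ ] (m′ ≤ ⌊ suc m /2⌋ × Inv m′ s′))
  body-correct m s (lo , window t ar l le lo≤a a< fits , h) =
    (λ h≡0 → case trans (sym h) (IsZero-value h≡0) of λ ()) ,
    ends-table t rC 1F rR le (≤-trans (m≤n+m _ lo) fits) λ c eqc →
    ends-add rG rL rH l h (≤-<-trans middle n<2^w) λ g eqg →
    ends-setFirst lTmp rG eqg λ u equ →
    ends-bitwise large f lTmp lArg lTmp λ x eqx →
    ends-seq {C = 3}
      (ends-ifZero
        (λ z → branch-correct up _ (window t ar l le lo≤a a< fits) h eqc eqg (λ ())
                 (onZero _ u equ (subst IsZero (trans eqx (cong (λ v → zipWith f v u) ar)) z)))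
        (λ z → branch-correct (not up) _ (window t ar l le lo≤a a< fits) h eqc eqg (λ ())
                 (onNonzero _ u equ (λ z′ → z
                   (subst IsZero (sym (trans eqx (cong (λ v → zipWith f v u) ar))) z′)))))
      λ s′ (lo′ , m′ , m′≤ , win@(window t′ ar′ l′ le′ lo≤a′ a<′ fits′)) →
    ends-table t′ rH 0F rR le′ (≤-trans (m≤n+m _ lo′) fits′) λ h′ eqh′ →
    ends-skip (m′ , m′≤ , lo′ , window t′ ar′ l′ le′ lo≤a′ a<′ fits′ , eqh′)
    where
    middle : lo + ⌊ suc (suc m) /2⌋ ≤ n
    middle = ≤-trans (+-monoʳ-≤ lo (⌊n/2⌋≤n (suc (suc m)))) fits

  search-correct : ∀ ℓ → bitLength n ≤ suc ℓ → (s : State K 6 n w) → Tables (memory s) →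
    regs s large lArg ≡ v →
    Ends {M = M} ℓ (search f up) s 13 (λ s′ → value (regs s′ small rL) ≡ a)
  search-correct ℓ n≤ℓ s t ar =
    ends-bitwise small _xor_ rL rL rL λ z eqz →
    let low = IsZero-value (subst IsZero (sym eqz) (xor-self _)) in
    ends-table t rR 4F rL low z≤n λ r eqr →
    ends-table t rH 0F rR eqr ≤-refl λ h eqh →
    ends-map (λ s′ (lo , window _ _ l _ lo≤a a< _ , _) →
               trans l (≤-antisym lo≤a (≤-pred (subst (a <_) (+-comm lo 1) a<))))
      (while-halving Inv stop body-correct ℓ (n ∸ 1) _ (≤-trans (bitLength-mono (m∸n≤m n 1)) n≤ℓ)
        (0 , window t ar low (trans eqr (sym pos)) z≤n (subst (a <_) (sym pos) a<n) (≤-reflexive pos) ,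
         trans eqh (cong ⌊_/2⌋ (sym pos))))
    where
    pos : suc (n ∸ 1) ≡ n
    pos = m+[n∸m]≡n (≤-trans (s≤s z≤n) a<n)

    stop : ∀ s → Inv 0 s → IsZero (regs s small rH)
    stop s (_ , _ , h) = value-IsZero h

findFirst findLast : ∀ M → Prog M
findFirst plain   = search _∧_ true
findFirst bitScan = instr (firstSet large rL lArg)
findLast  plain   = search andNot false
findLast  bitScan = instr (lastSet large rL lArg)

-- The only point at which the models put different conditions on ℓ: binary search runs over all `n`
-- columns, while a bit scan takes one step whatever ℓ is.
FindBound : Model → (n ℓ : ℕ) → Set
FindBound plain   n ℓ = bitLength n ≤ suc ℓ
FindBound bitScan n ℓ = ⊤

module _ {n w : ℕ} (n<2^w : n < 2 ^ w) where

  findFirst-correct : ∀ M {ℓ} → FindBound M n ℓ → (s : State K 6 n w) → Tables (memory s) →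
    ∀ a → IsFirstSet (regs s large lArg) a → Ends ℓ (findFirst M) s 13 (λ s′ → value (regs s′ small rL)
      ≡ toℕ a)
  findFirst-correct plain {ℓ} bound s t a (at , below) =
    Search.search-correct n<2^w _∧_ true (regs s large lArg) (toℕ a) (toℕ<n a) onZero onNonzero ℓ bound s
      t refl
    where
    v = regs s large lArg
    onZero : ∀ m u → (∀ j → lookup u j ≡ (toℕ j <ᵇ m)) → IsZero (zipWith _∧_ v u) → m ≤ toℕ a
    onZero m u equ z = ≮⇒≥ λ a<m → true≢false (trans (sym (trans (lookup-zipWith _∧_ a v u)
      (cong₂ _∧_ at (trans (equ a) (<ᵇ-true a<m))))) (IsZero-lookup z a))
    onNonzero : ∀ m u → (∀ j → lookup u j ≡ (toℕ j <ᵇ m)) → ¬ IsZero (zipWith _∧_ v u) → toℕ a < m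
    onNonzero m u equ nz = ≰⇒> λ m≤a → nz (lookup-IsZero λ j → trans (lookup-zipWith _∧_ j v u)
      (rest m≤a j))
      where
      rest : m ≤ toℕ a → ∀ j → lookup v j ∧ lookup u j ≡ false
      rest m≤a j with toℕ j <? toℕ a
      ... | yes j<a rewrite below j j<a = refl
      ... | no  j≮a rewrite equ j | <ᵇ-false (≤-trans m≤a (≮⇒≥ j≮a)) = ∧-zeroʳ _
  findFirst-correct bitScan bound s t a isFirst =
    ends-mono (s≤s z≤n) (λ _ q → q) (ends-instr (firstSet large rL lArg a isFirst)
      (value-bits w (<-trans (toℕ<n a) n<2^w)))

  findLast-correct : ∀ M {ℓ} → FindBound M n ℓ → (s : State K 6 n w) → Tables (memory s) →
    ∀ a → IsLastSet (regs s large lArg) a → Ends ℓ (findLast M) s 13 (λ s′ → value (regs s′ small rL)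
      ≡ toℕ a)
  findLast-correct plain {ℓ} bound s t a (at , above) =
    Search.search-correct n<2^w andNot false (regs s large lArg) (toℕ a) (toℕ<n a) onZero onNonzero ℓ
      bound s t refl
    where
    v = regs s large lArg
    onZero : ∀ m u → (∀ j → lookup u j ≡ (toℕ j <ᵇ m)) → IsZero (zipWith andNot v u) → toℕ a < m
    onZero m u equ z = ≰⇒> λ m≤a → true≢false (trans (sym (trans (lookup-zipWith andNot a v u)
      (cong₂ andNot at (trans (equ a) (<ᵇ-false m≤a))))) (IsZero-lookup z a))
    onNonzero : ∀ m u → (∀ j → lookup u j ≡ (toℕ j <ᵇ m)) → ¬ IsZero (zipWith andNot v u) → m ≤ toℕ a
    onNonzero m u equ nz = ≮⇒≥ λ a<m → nz (lookup-IsZero λ j → trans (lookup-zipWith andNot j v u)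
      (rest a<m j))
      where
      rest : toℕ a < m → ∀ j → lookup v j ∧ not (lookup u j) ≡ false
      rest a<m j with toℕ a <? toℕ j
      ... | yes a<j rewrite above j a<j = refl
      ... | no  a≮j rewrite equ j | <ᵇ-true (≤-<-trans (≮⇒≥ a≮j) a<m) = ∧-zeroʳ _
  findLast-correct bitScan bound s t a isLast =
    ends-mono (s≤s z≤n) (λ _ q → q) (ends-instr (lastSet large rL lArg a isLast)
      (value-bits w (<-trans (toℕ<n a) n<2^w)))

-- Columns reachable along a row

⇒ : {A B : Set} → A ⇔ B → A → B
⇒ = Equivalence.to

⇐ : {A B : Set} → A ⇔ B → B → A
⇐ = Equivalence.from

-- With `M` a variable, `writes (c M)` is stuck at `findFirst M` or `findLast M`; the disjunction
-- over both models evaluates.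
keeps : ∀ {n w} (c : ∀ M → Prog M) z i → writes (c plain) z i ∨ writes (c bitScan) z i ≡ false →
        ∀ M {s s′ : State K 6 n w} → Frame (c M) s s′ → regs s′ z i ≡ regs s z i
keeps c z i eq plain   F = kept F z i (proj₁ (∨-false _ _ eq))
keeps c z i eq bitScan F = kept F z i (proj₂ (∨-false (writes (c plain) z i) _ eq))

keepsMemory : ∀ {n w} (c : ∀ M → Prog M) → storeFree (c plain) ∧ storeFree (c bitScan) ≡ true →
              ∀ M {s s′ : State K 6 n w} → Frame (c M) s s′ → memory s′ ≡ memory s
keepsMemory c eq plain   F = fixed F (proj₁ (∧-true _ _ eq))
keepsMemory c eq bitScan F = fixed F (proj₂ (∧-true (storeFree (c plain)) _ eq))

firstSet-exists : ∀ {m} (v : Bits m) → ¬ IsZero v → ∃[ i ] IsFirstSet v i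
firstSet-exists []          v≢0 = ⊥-elim (v≢0 refl)
firstSet-exists (true ∷ v)  v≢0 = 0F , refl , λ j ()
firstSet-exists (false ∷ v) v≢0 =
  let (i , at , below) = firstSet-exists v (λ v≡0 → v≢0 (cong (false ∷_) v≡0))
  in Fin.suc i , at , λ { 0F _ → refl ; (Fin.suc j) (s≤s j<i) → below j j<i }

lastSet-exists : ∀ {m} (v : Bits m) → ¬ IsZero v → ∃[ i ] IsLastSet v i
lastSet-exists []      v≢0 = ⊥-elim (v≢0 refl)
lastSet-exists (b ∷ v) v≢0 with IsZero? v
... | inj₂ (j , eq) =
  let (i , at , above) = lastSet-exists v (nonzero j eq)
  in Fin.suc i , at , λ { (Fin.suc j) (s≤s i<j) → above j i<j }
lastSet-exists (true ∷ v)  v≢0 | inj₁ v≡0 = 0F , refl , λ { (Fin.suc j) _ → IsZero-lookup v≡0 j }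
lastSet-exists (false ∷ v) v≢0 | inj₁ v≡0 = ⊥-elim (v≢0 (cong (false ∷_) v≡0))

orNot : Bool → Bool → Bool
orNot a b = a ∨ not b

-- `lArg` holds the obstacles on one side of the tile, and the nearest of them blocks all columns
-- beyond it. On the right the columns added to `lAcc` include the obstacle; on the left they stop
-- short of it, `scan` having already added it as an occupied cell.
markLeft markRight : ∀ M → Prog M
markLeft M =
  ifZero large lArg skip (findLast M » setFirst large lTmp rL ▸ bitwise large _∨_ lAcc lAcc lTmp ▸ skip)
markRight M =
  ifZero large lArg skip (findFirst M » setFirst large lTmp rL ▸ bitwise large orNot lAcc lAcc lTmp ▸ skip)

-- `rH′` is the column of the tile. `lLeft` and `lRight` collect the obstacles on either side over
-- both rows: if one of them is zero in the end, both tiles can leave the rectangle on that side.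
scan : ∀ M → Prog M
scan M =
  setFirst large lTmp rH′ ▸ bitwise large _∧_ lArg lThis lTmp ▸ bitwise large _∨_ lLeft lLeft lArg ▸
  bitwise large _∨_ lAcc lAcc lThis ▸ markLeft M »
  setFirst large lTmp rH′ ▸ bitwise large andNot lArg lThis lTmp ▸ bitwise large _∨_ lRight lRight lArg ▸
  markRight M

-- Depending on the side of `x` on which `c` lies, one clause is vacuous, so the cells from the
-- tile's column `x` to `c` are covered without a case distinction. Column `x` is included only when
-- `x ≤ c`; the rows to which this is applied have the tile's own bit cleared.
Clear : ∀ {n} → Bits n → ℕ → Fin n → Set
Clear v x c =
  (∀ j → toℕ c ≤ toℕ j → toℕ j < x → lookup v j ≡ false) ×
  (∀ j → x ≤ toℕ j → toℕ j ≤ toℕ c → lookup v j ≡ false)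

∨⇔ : ∀ {n} (u v u′ : Bits n) → u′ ≡ zipWith _∨_ u v → ∀ c →
      lookup u′ c ≡ false ⇔ (lookup u c ≡ false × lookup v c ≡ false)
∨⇔ u v u′ refl c = mk⇔ (∨-false-lookup u v c) (λ (e , e′) → lookup-∨-false u v c e e′)

below⇔ : ∀ {n} (v u m : Bits n) (x : ℕ) → (∀ j → lookup m j ≡ (toℕ j <ᵇ x)) → u ≡ zipWith _∧_ v m → ∀ c →
         lookup u c ≡ false ⇔ (toℕ c < x → lookup v c ≡ false)
below⇔ v u m x eqm refl c rewrite lookup-zipWith _∧_ c v m | eqm c with toℕ c <? x
... | yes c<x rewrite <ᵇ-true c<x | ∧-identityʳ (lookup v c) = mk⇔ (λ e _ → e) (λ e → e c<x)
... | no  c≮x rewrite <ᵇ-false (≮⇒≥ c≮x) = mk⇔ (λ _ c<x → ⊥-elim (c≮x c<x)) (λ _ → ∧-zeroʳ _)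

above⇔ : ∀ {n} (v u m : Bits n) (x : ℕ) → (∀ j → lookup m j ≡ (toℕ j <ᵇ x)) → u ≡ zipWith andNot v m → ∀ c →
         lookup u c ≡ false ⇔ (x ≤ toℕ c → lookup v c ≡ false)
above⇔ v u m x eqm refl c rewrite lookup-zipWith andNot c v m | eqm c with toℕ c <? x
... | yes c<x rewrite <ᵇ-true c<x = mk⇔ (λ _ x≤c → ⊥-elim (<⇒≱ c<x x≤c)) (λ _ → ∧-zeroʳ _)
... | no  c≮x rewrite <ᵇ-false (≮⇒≥ c≮x) | ∧-identityʳ (lookup v c) = mk⇔ (λ e _ → e) (λ e → e (≮⇒≥ c≮x))

module _ {n w : ℕ} (n<2^w : n < 2 ^ w) where

  markLeft-correct : ∀ M {ℓ} → FindBound M n ℓ → (s : State K 6 n w) → Tables (memory s) →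
    Ends ℓ (markLeft M) s 16 (λ s′ → ∀ c → lookup (regs s′ large lAcc) c ≡ false ⇔
      (lookup (regs s large lAcc) c ≡ false × (∀ j → toℕ c < toℕ j → lookup (regs s large lArg) j ≡ false)))
  markLeft-correct M bound s t = ends-ifZero
    (λ z → ends-mono z≤n (λ _ q → q) (ends-skip λ c → mk⇔ (λ e → e , λ j _ → IsZero-lookup z j) proj₁))
    (λ nz → let (a , last@(at , above)) = lastSet-exists _ nz in
      ends-seq (framed (findLast-correct n<2^w M bound s t a last)) λ s′ (eqa , F) →
      ends-setFirst lTmp rL eqa λ u equ →
      ends-bitwise large _∨_ lAcc lAcc lTmp λ u′ equ′ →
      ends-skip λ c →
      let acc′≡ : lookup u′ c ≡ lookup (regs s large lAcc) c ∨ (toℕ c <ᵇ toℕ a)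
          acc′≡ = trans (cong (λ r → lookup r c) equ′) (trans (lookup-zipWith _∨_ c (regs s′ large lAcc) u)
                    (cong₂ _∨_ (cong (λ r → lookup r c) (keeps findLast large lAcc refl M F)) (equ c)))
      in mk⇔
        (λ e → let (e₁ , e₂) = ∨-false _ _ (trans (sym acc′≡) e)
               in e₁ , λ j c<j → above j (≤-<-trans
                 (≮⇒≥ (λ c<a → true≢false (trans (sym (<ᵇ-true c<a)) e₂))) c<j))
        (λ (e , clear) → trans acc′≡
          (cong₂ _∨_ e (<ᵇ-false (≮⇒≥ λ c<a → true≢false (trans (sym at) (clear a c<a)))))))

  markRight-correct : ∀ M {ℓ} → FindBound M n ℓ → (s : State K 6 n w) → Tables (memory s) →
    Ends ℓ (markRight M) s 16 (λ s′ → ∀ c → lookup (regs s′ large lAcc) c ≡ false ⇔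
      (lookup (regs s large lAcc) c ≡ false × (∀ j → toℕ j ≤ toℕ c → lookup (regs s large lArg) j ≡ false)))
  markRight-correct M bound s t = ends-ifZero
    (λ z → ends-mono z≤n (λ _ q → q) (ends-skip λ c → mk⇔ (λ e → e , λ j _ → IsZero-lookup z j) proj₁))
    (λ nz → let (a , first@(at , below)) = firstSet-exists _ nz in
      ends-seq (framed (findFirst-correct n<2^w M bound s t a first)) λ s′ (eqa , F) →
      ends-setFirst lTmp rL eqa λ u equ →
      ends-bitwise large orNot lAcc lAcc lTmp λ u′ equ′ →
      ends-skip λ c →
      let acc′≡ : lookup u′ c ≡ lookup (regs s large lAcc) c ∨ not (toℕ c <ᵇ toℕ a)
          acc′≡ = trans (cong (λ r → lookup r c) equ′)
            (trans (lookup-zipWith orNot c (regs s′ large lAcc) u)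
                    (cong₂ orNot (cong (λ r → lookup r c) (keeps findFirst large lAcc refl M F)) (equ c)))
      in mk⇔
        (λ e → let (e₁ , e₂) = ∨-false _ _ (trans (sym acc′≡) e)
               in e₁ , λ j j≤c → below j (≤-<-trans j≤c
                 (≰⇒> λ a≤c → true≢false (trans (sym (cong not (<ᵇ-false a≤c))) e₂))))
        (λ (e , clear) → trans acc′≡
          (cong₂ orNot e (<ᵇ-true (≰⇒> λ a≤c → true≢false (trans (sym at) (clear a a≤c)))))))

  record Scanned (s s′ : State K 6 n w) (v : Bits n) (x : ℕ) : Set where
    constructor scanned
    field
      acc⇔   : ∀ c → lookup (regs s′ large lAcc) c ≡ false ⇔ (lookup (regs s large lAcc) c ≡ false ×
        Clear v x c)
      left⇔  : ∀ c → lookup (regs s′ large lLeft) c ≡ false ⇔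
                 (lookup (regs s large lLeft) c ≡ false × (toℕ c < x → lookup v c ≡ false))
      right⇔ : ∀ c → lookup (regs s′ large lRight) c ≡ false ⇔
                 (lookup (regs s large lRight) c ≡ false × (x ≤ toℕ c → lookup v c ≡ false))

  scan-correct : ∀ M {ℓ} → FindBound M n ℓ → (s : State K 6 n w) → Tables (memory s) → ∀ x →
    value (regs s small rH′) ≡ x → Ends ℓ (scan M) s 39 (λ s′ → Scanned s s′ (regs s large lThis) x)
  scan-correct M bound s t x eqx =
    ends-setFirst lTmp rH′ eqx λ m eqm →
    ends-bitwise large _∧_ lArg lThis lTmp λ p eqp →
    ends-bitwise large _∨_ lLeft lLeft lArg λ l eql →
    ends-bitwise large _∨_ lAcc lAcc lThis λ a eqa →
    ends-seq (framed (markLeft-correct M bound _ t)) λ s₁ (acc₁ , F) →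
    let this₁ : regs s₁ large lThis ≡ v
        this₁ = keeps markLeft large lThis refl M F
        right₁ : regs s₁ large lRight ≡ regs s large lRight
        right₁ = keeps markLeft large lRight refl M F
        t₁ : Tables (memory s₁)
        t₁ = subst Tables (sym (keepsMemory markLeft refl M F)) t
    in
    ends-setFirst lTmp rH′ (trans (cong value (keeps markLeft small rH′ refl M F)) eqx) λ m′ eqm′ →
    ends-bitwise large andNot lArg lThis lTmp λ p′ eqp′ →
    ends-bitwise large _∨_ lRight lRight lArg λ r eqr →
    ends-then (framed (markRight-correct M bound _ t₁)) (λ s₂ (acc₂ , F₂) → record
      { acc⇔ = λ c → mk⇔
          (λ e → let (e₁ , right) = ⇒ (acc₂ c) e
                     (e₂ , left)  = ⇒ (acc₁ c) e₁
                     (e₃ , here)  = ⇒ (∨⇔ _ _ a eqa c) e₂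
                 in e₃ ,
                    -- An obstacle strictly to the right of `c` is excluded by `markLeft`, one at
                    -- `c` itself by the occupied cells in `lAcc`.
                    (λ j c≤j j<x → case m≤n⇒m<n∨m≡n c≤j of λ
                       { (inj₁ c<j) → ⇒ (below⇔ v p m x eqm eqp j) (left j c<j) j<x
                       ; (inj₂ c≡j) → subst (λ i → lookup v i ≡ false) (toℕ-injective c≡j) here }) ,
                    (λ j x≤j j≤c → ⇒ (above⇔ v p′ m′ x eqm′
                      (trans eqp′ (cong (λ v → zipWith andNot v m′) this₁)) j)
                                     (right j j≤c) x≤j))
          (λ (e , before , after) →
            ⇐ (acc₂ c)
              ( ⇐ (acc₁ c)
                  ( ⇐ (∨⇔ _ _ a eqa c)
                      (e , (case toℕ c <? x of λ { (yes c<x) → before c ≤-refl c<x ; (no c≮x) → after c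
                        (≮⇒≥ c≮x) ≤-refl }))
                  , λ j c<j → ⇐ (below⇔ v p m x eqm eqp j) (before j (<⇒≤ c<j)))
              , λ j j≤c → ⇐ (above⇔ v p′ m′ x eqm′ (trans eqp′ (cong (λ v → zipWith andNot v m′) this₁)) j)
                            (λ x≤j → after j x≤j j≤c)))
      ; left⇔ = λ c → subst (λ u → lookup u c ≡ false ⇔ _)
          (sym (trans (keeps markRight large lLeft refl M F₂) (keeps markLeft large lLeft refl M F)))
          (combine (∨⇔ _ p l eql c) (below⇔ v p m x eqm eqp c))
      ; right⇔ = λ c → subst (λ u → lookup u c ≡ false ⇔ _)
          (sym (keeps markRight large lRight refl M F₂))
          (combine (∨⇔ _ p′ r (trans eqr (cong (λ u → zipWith _∨_ u p′) right₁)) c)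
                   (above⇔ v p′ m′ x eqm′ (trans eqp′ (cong (λ v → zipWith andNot v m′) this₁)) c))
      })
    where
    v = regs s large lThis

    combine : {A B C D : Set} → A ⇔ (B × C) → C ⇔ D → A ⇔ (B × D)
    combine f g = mk⇔ (λ a → let (b , c) = ⇒ f a in b , ⇒ g c)
                      (λ (b , d) → ⇐ f (b , ⇐ g d))

-- Segment trees

isOdd : ℕ → Bool
isOdd v = v % 2 ≡ᵇ 1

double-odd : ∀ {v} → isOdd v ≡ true → suc (2 * ⌊ v /2⌋) ≡ v
double-odd {v} odd with parity-half v
... | eq rewrite odd = eq

double-even : ∀ {v} → isOdd v ≡ false → 2 * ⌊ v /2⌋ ≡ v
double-even {v} even with parity-half v
... | eq rewrite even = eq

ceil-odd : ∀ v → isOdd v ≡ true → ⌈ v /2⌉ ≡ suc ⌊ v /2⌋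
ceil-odd 1             odd = refl
ceil-odd (suc (suc v)) odd = cong suc (ceil-odd v odd)

ceil-even : ∀ v → isOdd v ≡ false → ⌈ v /2⌉ ≡ ⌊ v /2⌋
ceil-even 0             even = refl
ceil-even (suc (suc v)) even = cong suc (ceil-even v even)

isOdd-2* : ∀ u → isOdd (2 * u) ≡ false
isOdd-2* zero    = refl
isOdd-2* (suc u) = trans (cong isOdd (*-suc 2 u)) (isOdd-2* u)

isOdd-1+2* : ∀ u → isOdd (suc (2 * u)) ≡ true
isOdd-1+2* zero    = refl
isOdd-1+2* (suc u) = trans (cong (isOdd ∘ suc) (*-suc 2 u)) (isOdd-1+2* u)

⌊1+2*n/2⌋≡n : ∀ n → ⌊ suc (2 * n) /2⌋ ≡ n
⌊1+2*n/2⌋≡n zero    = refl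
⌊1+2*n/2⌋≡n (suc n) = trans (cong (⌊_/2⌋ ∘ suc) (*-suc 2 n)) (cong suc (⌊1+2*n/2⌋≡n n))

rowBank evenBank oddBank : Bool → Fin 6
rowBank  false = 0F
rowBank  true  = 3F
evenBank false = 1F
evenBank true  = 4F
oddBank  false = 2F
oddBank  true  = 5F

nodeBank : Bool → ℕ → Fin 6
nodeBank d v = if isOdd v then oddBank d else evenBank d

-- The tree has root 1, node u has the children 2u and 2u + 1, and the leaf
-- n + y stands for line y.  Siblings share an address in two banks, which
-- keeps all addresses below n + 1.
node : ∀ {n w} → Memory 6 n w → Bool → ℕ → Bits n
node μ d v = μ large (nodeBank d v) (slot ⌊ v /2⌋)

lineAt : ∀ {n w} → Memory 6 n w → Bool → ℕ → Bits n
lineAt μ d y = μ large (rowBank d) (slot y)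

-- When `n` is not a power of two, an inner node may join lines that are not consecutive. Queries
-- therefore work with ranges of node numbers, for which only the relation between parent and
-- children counts. The lines are also kept in banks of their own, so that line `y` can be loaded by
-- its number.
record Tree {n w} (μ : Memory 6 n w) (d : Bool) : Set where
  constructor tree
  field
    leaf  : ∀ y → y < n → node μ d (n + y) ≡ lineAt μ d y
    inner : ∀ u → 1 ≤ u → u < n → node μ d u ≡ zipWith _∨_ (node μ d (2 * u)) (node μ d (suc (2 * u)))

AllFrom : (ℕ → Set) → ℕ → ℕ → Set
AllFrom P a b = ∀ v → a ≤ v → v < b → P v

ceil≤ : ∀ {a u} → a ≤ 2 * u → ⌈ a /2⌉ ≤ u
ceil≤ {a} {u} a≤ = ≤-trans (⌈n/2⌉-mono a≤) (≤-reflexive (⌊1+2*n/2⌋≡n u))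

≤ceil : ∀ {a u} → ⌈ a /2⌉ ≤ u → a ≤ 2 * u
≤ceil {a} {u} ≤u with isOdd a in parity
... | true  = ≤-trans (≤-reflexive (sym (double-odd parity)))
  (≤-trans (n≤1+n _) (≤-trans (≤-reflexive (sym (*-suc 2 ⌊ a /2⌋)))
                (*-monoʳ-≤ 2 (≤-trans (≤-reflexive (sym (ceil-odd a parity))) ≤u))))
... | false = ≤-trans (≤-reflexive (sym (double-even parity)))
  (*-monoʳ-≤ 2 (≤-trans (≤-reflexive (sym (ceil-even a parity))) ≤u))

<half : ∀ {b u} → suc (2 * u) < b → u < ⌊ b /2⌋
<half {b} {u} u< = ≤-trans (≤-reflexive (sym (trans (cong ⌊_/2⌋ (sym (*-suc 2 u))) (⌊2*n/2⌋≡n (suc u)))))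
  (⌊n/2⌋-mono u<)

half< : ∀ {b u} → u < ⌊ b /2⌋ → suc (2 * u) < b
half< {b} {u} u< = ≤-trans (≤-reflexive (sym (*-suc 2 u)))
  (≤-trans (*-monoʳ-≤ 2 u<) (≤-trans (m≤n+m _ (if isOdd b then 1 else 0)) (≤-reflexive (parity-half b))))

-- Passing to the parents loses only an odd first node and the node before an odd
-- bound, whose siblings lie outside the range.
module _ {n : ℕ} (P : ℕ → Set) (children : ∀ u → 1 ≤ u → u < n → P u ⇔ (P (2 * u) × P (suc (2 * u)))) where

  contract : ∀ {a b} → 1 ≤ a → b ≤ 2 * n → AllFrom P a b ⇔
    ((isOdd a ≡ true → a < b → P (suc (2 * ⌊ a /2⌋))) × (isOdd b ≡ true → a < b → P (2 * ⌊ b /2⌋)) ×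
      AllFrom P ⌈ a /2⌉ ⌊ b /2⌋)
  contract {a} {b} 1≤a b≤2n = mk⇔
    (λ all → (λ odd a<b → subst P (sym (double-odd odd)) (all a ≤-refl a<b)) ,
             (λ odd a<b → all (2 * ⌊ b /2⌋) (≤-pred (subst (a <_) (sym (double-odd odd)) a<b))
               (≤-reflexive (double-odd odd))) ,
             (λ u ≤u u< → ⇐ (children u (≤-trans (⌈n/2⌉-mono 1≤a) ≤u) (<-≤-trans u< half≤n))
                 (all (2 * u) (≤ceil ≤u) (<-trans (n<1+n _) (half< u<)) , all (suc (2 * u))
                   (≤-trans (≤ceil ≤u) (n≤1+n _)) (half< u<))))
    back
    where
    half≤n : ⌊ b /2⌋ ≤ n
    half≤n = ≤-trans (⌊n/2⌋-mono b≤2n) (≤-reflexive (⌊2*n/2⌋≡n n))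

    back : _ → AllFrom P a b
    back (first , last , inside) v a≤v v<b with isOdd v in parity
    back (first , last , inside) v a≤v v<b | true with ⌈ a /2⌉ ≤? ⌊ v /2⌋
    ... | yes ≤u = subst P (double-odd parity)
      (proj₂ (⇒ (children ⌊ v /2⌋ (≤-trans (⌈n/2⌉-mono 1≤a) ≤u) (<-≤-trans u< half≤n)) (inside _ ≤u u<)))
      where
      u< : ⌊ v /2⌋ < ⌊ b /2⌋
      u< = <half (subst (_< b) (sym (double-odd parity)) v<b)
    ... | no  ≰u = subst P (trans (double-odd (subst (λ v → isOdd v ≡ true) (sym a≡v) parity)) a≡v)
                     (first (subst (λ v → isOdd v ≡ true) (sym a≡v) parity) (≤-<-trans a≤v v<b))
      where
      a≡v : a ≡ v
      a≡v = ≤-antisym a≤v (≮⇒≥ λ a<v → ≰u (ceil≤ (≤-pred (subst (a <_) (sym (double-odd parity)) a<v))))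
    back (first , last , inside) v a≤v v<b | false with ⌊ v /2⌋ <? ⌊ b /2⌋
    ... | yes u< = subst P (double-even parity)
      (proj₁ (⇒ (children ⌊ v /2⌋ (≤-trans (⌈n/2⌉-mono 1≤a) ≤u) (<-≤-trans u< half≤n)) (inside _ ≤u u<)))
      where
      ≤u : ⌈ a /2⌉ ≤ ⌊ v /2⌋
      ≤u = ceil≤ (subst (a ≤_) (sym (double-even parity)) a≤v)
    ... | no  u≮ with isOdd b in parity-b
    ...   | true  = subst P (trans (cong (2 *_) (≤-antisym (≮⇒≥ u≮) (⌊n/2⌋-mono (<⇒≤ v<b))))
      (double-even parity)) (last refl (≤-<-trans a≤v v<b))
    ...   | false = ⊥-elim (<⇒≱ v<b (≤-trans (≤-reflexive (sym (double-even parity-b)))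
      (≤-trans (*-monoʳ-≤ 2 (≮⇒≥ u≮)) (≤-reflexive (double-even parity)))))

-- The ends of a nonempty range do not cross on passing to the parents, so a loop may continue as
-- long as they differ, which a xor detects.
ceil≤half : ∀ {a b} → a < b → ⌈ a /2⌉ ≤ ⌊ b /2⌋
ceil≤half a<b = ⌊n/2⌋-mono a<b

-- Rounding moves both ends inwards, so a range at least halves from level to level. This makes the
-- number of rounds logarithmic in the number of lines rather than in `n`.
half∸ceil : ∀ a b → ⌊ b /2⌋ ∸ ⌈ a /2⌉ ≤ ⌊ b ∸ a /2⌋
half∸ceil zero          b             = ≤-refl
half∸ceil (suc zero)    zero          = z≤n
half∸ceil (suc zero)    (suc zero)    = z≤n
half∸ceil (suc zero)    (suc (suc b)) = ⌊n/2⌋-mono (n≤1+n b)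
half∸ceil (suc (suc a)) zero          = z≤n
half∸ceil (suc (suc a)) (suc zero)    = z≤n
half∸ceil (suc (suc a)) (suc (suc b)) = half∸ceil a b

-- Unions of consecutive lines

addNode : ∀ {M} → Fin 6 → Fin K → Prog M
addNode β h = ifZero small rG skip (load large lTmp β h ▸ bitwise large _∨_ lAcc lAcc lTmp ▸ skip)

-- One level up. An odd left end `a` contributes node `a`, at address ⌊a /2⌋ of the odd bank; an odd
-- bound `b` contributes the even node before it, at address ⌊b /2⌋ of the even bank. The tables are
-- parameters because the leaves `n + l` and `n + r` may exceed what a small register holds: the
-- first round passes from the line numbers directly to the parents of the leaves.
narrow : ∀ {M} → Bool → (th tc : Fin 6) → Prog M
narrow d th tc =
  load small rH th rL ▸ load small rC tc rL ▸ load small rH′ th rR ▸ load small rC′ tc rR ▸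
  bitwise small _xor_ rG rH rC ▸ addNode (oddBank d) rH »
  bitwise small _xor_ rG rH′ rC′ ▸ addNode (evenBank d) rH′ »
  mov small rL rC ▸ mov small rR rH′ ▸ bitwise small _xor_ rG rL rR ▸ skip

-- The first test is l < r: some bit is below r but not below l.
query : ∀ {M} → Bool → Prog M
query d =
  setFirst large lTmp rR ▸ setFirst large lArg rL ▸ bitwise large andNot lTmp lTmp lArg ▸
  ifZero large lTmp skip (narrow d 2F 3F » whileNonzero small rG (narrow d 0F 1F))

FreeNode : ∀ {n w} → Memory 6 n w → Bool → Fin n → ℕ → Set
FreeNode μ d c v = lookup (node μ d v) c ≡ false

module _ {n w : ℕ} {M : Model} where

  addNode-correct : ∀ {ℓ} (s : State K 6 n w) β h a → value (regs s small h) ≡ ⌊ a /2⌋ → ⌊ a /2⌋ ≤ n →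
    (IsZero (regs s small rG) ⇔ isOdd a ≡ false) →
    Ends {M = M} ℓ (addNode β h) s 3 (λ s′ → ∀ c → lookup (regs s′ large lAcc) c ≡ false ⇔
      (lookup (regs s large lAcc) c ≡ false × (isOdd a ≡ true → lookup (memory s large β (slot ⌊ a /2⌋))
        c ≡ false)))
  addNode-correct s β h a eqh h≤n guard = ends-ifZero
    (λ z → ends-mono z≤n (λ _ q → q) (ends-skip λ c → mk⇔
       (λ e → e , λ odd → ⊥-elim (true≢false (trans (sym odd) (⇒ guard z)))) proj₁))
    (λ nz → ends-load large lTmp β h eqh h≤n (ends-bitwise large _∨_ lAcc lAcc lTmp λ u equ → ends-skip
      λ c → mk⇔
       (λ e → let (e₁ , e₂) = ∨-false-lookup (regs s large lAcc) (memory s large β (slot ⌊ a /2⌋)) c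
                    (trans (cong (λ r → lookup r c) (sym equ)) e) in e₁ , λ _ → e₂)
       (λ (e , free) → trans (cong (λ r → lookup r c) equ) (lookup-∨-false (regs s large lAcc) _ c e
         (free (odd nz))))))
    where
    odd : ¬ IsZero (regs s small rG) → isOdd a ≡ true
    odd nz with isOdd a
    ... | true  = refl
    ... | false = ⊥-elim (nz (⇐ guard refl))

  -- The halves rounded down and up agree exactly for even numbers, so a xor of two table entries
  -- reveals the parity.
  parity-guard : ∀ a (g h c : Bits w) → value h ≡ ⌊ a /2⌋ → value c ≡ ⌈ a /2⌉ → g ≡ zipWith _xor_ h c →
                 IsZero g ⇔ isOdd a ≡ false
  parity-guard a g h c eqh eqc refl = mk⇔ even
    (λ parity → subst (λ c → IsZero (zipWith _xor_ h c))
       (value-injective (trans eqh (trans (sym (ceil-even a parity)) (sym eqc)))) (xor-self h))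
    where
    even : IsZero (zipWith _xor_ h c) → isOdd a ≡ false
    even z with isOdd a in parity
    ... | false = refl
    ... | true  = ⊥-elim (1+n≢n (trans (sym (ceil-odd a parity))
      (trans (sym eqc) (trans (cong value (sym (xor-zero h c z))) eqh))))

  -- In `acc` the nodes already read and those still to be read are taken together, because a round
  -- moves conditions from the second kind to the first and preserves only the conjunction.
  record Narrowed (μ : Memory 6 n w) (d : Bool) (s : State K 6 n w) (a b : ℕ) (s′ : State K 6 n w) : Set
    where
    constructor narrowed
    field
      mem   : memory s′ ≡ μ
      left  : value (regs s′ small rL) ≡ ⌈ a /2⌉
      right : value (regs s′ small rR) ≡ ⌊ b /2⌋
      guard : regs s′ small rG ≡ zipWith _xor_ (regs s′ small rL) (regs s′ small rR)
      acc   : ∀ c → (lookup (regs s′ large lAcc) c ≡ false × AllFrom (FreeNode μ d c) ⌈ a /2⌉ ⌊ b /2⌋) ⇔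
                    (lookup (regs s large lAcc) c ≡ false × AllFrom (FreeNode μ d c) a b)

  FreeNode-children : ∀ {μ : Memory 6 n w} {d} → Tree μ d → ∀ c u → 1 ≤ u → u < n →
    FreeNode μ d c u ⇔ (FreeNode μ d c (2 * u) × FreeNode μ d c (suc (2 * u)))
  FreeNode-children {μ} {d} tr c u 1≤u u<n rewrite Tree.inner tr u 1≤u u<n =
    ∨⇔ (node μ d (2 * u)) (node μ d (suc (2 * u))) _ refl c

  node-odd : ∀ (μ : Memory 6 n w) d a → node μ d (suc (2 * ⌊ a /2⌋)) ≡ μ large (oddBank d) (slot ⌊ a /2⌋)
  node-odd μ d a rewrite isOdd-1+2* ⌊ a /2⌋ | ⌊1+2*n/2⌋≡n ⌊ a /2⌋ = refl

  node-even : ∀ (μ : Memory 6 n w) d a → node μ d (2 * ⌊ a /2⌋) ≡ μ large (evenBank d) (slot ⌊ a /2⌋)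
  node-even μ d a rewrite isOdd-2* ⌊ a /2⌋ | ⌊2*n/2⌋≡n ⌊ a /2⌋ = refl

  -- The registers contain `l` and `r`, which stand for the nodes `a` and `b`: these are `n + l` and
  -- `n + r` in the first round, `l` and `r` themselves afterwards.
  narrow-correct : ∀ {ℓ} (s : State K 6 n w) d → Tables (memory s) → Tree (memory s) d → ∀ th tc {l r a b} →
    value (regs s small rL) ≡ l → value (regs s small rR) ≡ r → l ≤ n → r ≤ n →
    table n th l ≡ ⌊ a /2⌋ → table n tc l ≡ ⌈ a /2⌉ → table n th r ≡ ⌊ b /2⌋ → table n tc r ≡ ⌈ b /2⌉ →
    1 ≤ a → a < b → b ≤ 2 * n →
    Ends {M = M} ℓ (narrow d th tc) s 15 (Narrowed (memory s) d s a b)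
  narrow-correct s d t tr th tc {l} {r} {a} {b} eql eqr l≤n r≤n tha tca thb tcb 1≤a a<b b≤2n =
    ends-table t rH th rL eql l≤n λ h eqh →
    ends-table t rC tc rL eql l≤n λ c eqc →
    ends-table t rH′ th rR eqr r≤n λ h′ eqh′ →
    ends-table t rC′ tc rR eqr r≤n λ c′ eqc′ →
    ends-bitwise small _xor_ rG rH rC λ g eqg →
    ends-seq (framed (addNode-correct _ (oddBank d) rH a (trans eqh tha) half-a≤n
      (parity-guard a g h c (trans eqh tha) (trans eqc tca) eqg))) λ s₁ (acc₁ , F₁) →
    ends-bitwise small _xor_ rG rH′ rC′ λ g′ eqg′ →
    ends-seq (framed (addNode-correct _ (evenBank d) rH′ b (trans (cong value (kept F₁ small rH′ refl))
      (trans eqh′ thb)) half-b≤n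
      (parity-guard b g′ h′ c′ (trans eqh′ thb) (trans eqc′ tcb)
        (trans eqg′ (cong₂ (zipWith _xor_) (kept F₁ small rH′ refl) (kept F₁ small rC′ refl)))))) λ s₂
          (acc₂ , F₂) →
    ends-mov small rL rC (ends-mov small rR rH′ (ends-bitwise small _xor_ rG rL rR λ g″ eqg″ → ends-skip (
    let mem₁ = fixed F₁ refl
        mem₂ = trans (fixed F₂ refl) mem₁
        C≡ = trans (kept F₂ small rC refl) (kept F₁ small rC refl)
        H′≡ = trans (kept F₂ small rH′ refl) (kept F₁ small rH′ refl)
        parts = λ k → contract {n} (FreeNode (memory s) d k) (FreeNode-children tr k) 1≤a b≤2n
        bank₂ : ∀ k → lookup (memory s₁ large (evenBank d) (slot ⌊ b /2⌋)) k ≡ false ⇔ FreeNode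
          (memory s) d k (2 * ⌊ b /2⌋)
        bank₂ = λ k → subst₂ (λ u v → lookup u k ≡ false ⇔ lookup v k ≡ false)
          (cong (λ μ → μ large (evenBank d) (slot ⌊ b /2⌋)) (sym mem₁)) (sym (node-even (memory s) d b))
            (mk⇔ id id)
        bank₁ : ∀ k → lookup (memory s large (oddBank d) (slot ⌊ a /2⌋)) k ≡ false ⇔ FreeNode
          (memory s) d k (suc (2 * ⌊ a /2⌋))
        bank₁ = λ k → subst (λ v → lookup (memory s large (oddBank d) (slot ⌊ a /2⌋)) k ≡ false
          ⇔ lookup v k ≡ false) (sym (node-odd (memory s) d a)) (mk⇔ id id)
    in narrowed mem₂ (trans (cong value C≡) (trans eqc tca)) (trans (cong value H′≡) (trans eqh′ thb)) eqg″
         (λ k → mk⇔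
           (λ (e , inside) →
              let (e₁ , last)  = ⇒ (acc₂ k) e
                  (e₀ , first) = ⇒ (acc₁ k) e₁
              in e₀ , ⇐ (parts k) ((λ odd _ → ⇒ (bank₁ k) (first odd)) ,
                (λ odd _ → ⇒ (bank₂ k) (last odd)) , inside))
           (λ (e₀ , all) →
              let (first , last , inside) = ⇒ (parts k) all
              in ⇐ (acc₂ k) (⇐ (acc₁ k) (e₀ , λ odd → ⇐ (bank₁ k) (first odd a<b)) , λ odd → ⇐ (bank₂ k)
                (last odd a<b)) , inside)))))
    where
    half-b≤n : ⌊ b /2⌋ ≤ n
    half-b≤n = ≤-trans (⌊n/2⌋-mono b≤2n) (≤-reflexive (⌊2*n/2⌋≡n n))

    half-a≤n : ⌊ a /2⌋ ≤ n
    half-a≤n = ≤-trans (⌊n/2⌋-mono (<⇒≤ a<b)) half-b≤n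

  query-correct : ∀ {ℓ} (s : State K 6 n w) d → Tables (memory s) → Tree (memory s) d → ∀ {l r} →
    value (regs s small rL) ≡ l → value (regs s small rR) ≡ r → l ≤ n → r ≤ n → bitLength (r ∸ l) ≤ suc ℓ →
    Ends {M = M} ℓ (query d) s 36 (λ s′ → ∀ c → lookup (regs s′ large lAcc) c ≡ false ⇔
      (lookup (regs s large lAcc) c ≡ false × AllFrom (λ v → lookup (lineAt (memory s) d v) c ≡ false) l r))
  query-correct {ℓ} s d t tr {l} {r} eql eqr l≤n r≤n len =
    ends-setFirst lTmp rR eqr λ u equ →
    ends-setFirst lArg rL eql λ v eqv →
    ends-bitwise large andNot lTmp lTmp lArg λ x eqx →
    ends-ifZero
      (λ z → ends-mono z≤n (λ _ q → q) (ends-skip λ c → mk⇔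
        (λ e → e , λ y l≤y y<r → ⊥-elim (true≢false (trans (sym (inside u v x equ eqv eqx y l≤y y<r))
          (IsZero-lookup z _))))
        proj₁))
      (λ nz → let l<r = nonempty u v x equ eqv eqx nz in
        ends-seq (narrow-correct _ d t tr 2F 3F eql eqr l≤n r≤n refl refl refl refl
                    (≤-trans (≤-trans (s≤s z≤n) (≤-trans l<r r≤n)) (m≤m+n n l)) (+-monoʳ-< n l<r)
                    (≤-trans (+-monoʳ-≤ n r≤n) (≤-reflexive (cong (n +_) (sym (+-identityʳ n))))))
          λ s₁ (narrowed mem left right guard acc) →
        ends-then (while-halving (Inv s₁) (stop s₁) (body s₁) ℓ (⌊ n + r /2⌋ ∸ ⌈ n + l /2⌉) s₁
                    -- The offset `n` cancels: after the first round at most half of `r ∸ l` nodes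
                    -- are left for the loop.
                    (≤-trans (bitLength-mono (≤-trans (half∸ceil (n + l) (n + r))
                      (≤-trans (⌊n/2⌋≤n _) (≤-reflexive ([m+n]∸[m+o]≡n∸o n r l))))) len)
                    (_ , _ , left , right , guard , refl , ceil≤half (+-monoʳ-< n l<r) ,
                     ⌈n/2⌉-mono (≤-trans (≤-trans (s≤s z≤n) (≤-trans l<r r≤n)) (m≤m+n n l)) , half≤n ,
                       mem , λ c → mk⇔ id id))
          λ s₂ (a , b , _ , _ , _ , b∸a≡0 , _ , _ , _ , _ , acc₂) c →
        mk⇔ (λ e → let (e₀ , all) = ⇒ (acc c)
                         (⇒ (acc₂ c) (e , λ y a≤y y<b → ⊥-elim (<⇒≱ (≤-<-trans a≤y y<b) (m∸n≡0⇒m≤n b∸a≡0))))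
                   in e₀ , λ y l≤y y<r → subst (λ u → lookup u c ≡ false)
                     (Tree.leaf tr y (<-≤-trans y<r r≤n)) (all (n + y) (+-monoʳ-≤ n l≤y) (+-monoʳ-< n y<r)))
            (λ (e₀ , all) → proj₁ (⇐ (acc₂ c) (⇐ (acc c) (e₀ , leaves c all)))))
    where
    half≤n : ⌊ n + r /2⌋ ≤ n
    half≤n = ≤-trans (⌊n/2⌋-mono (+-monoʳ-≤ n r≤n))
      (≤-reflexive (trans (cong (λ m → ⌊ n + m /2⌋) (sym (+-identityʳ n))) (⌊2*n/2⌋≡n n)))

    leaves : ∀ c → AllFrom (λ v → lookup (lineAt (memory s) d v) c ≡ false) l r → AllFrom
      (FreeNode (memory s) d c) (n + l) (n + r)
    leaves c all v n+l≤v v<n+r =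
      subst (FreeNode (memory s) d c) n+y≡v
        (subst (λ u → lookup u c ≡ false) (sym (Tree.leaf tr y (<-≤-trans y<r r≤n)))
          (all y (+-cancelˡ-≤ n l y (subst (n + l ≤_) (sym n+y≡v) n+l≤v)) y<r))
      where
      y = v ∸ n
      n+y≡v : n + y ≡ v
      n+y≡v = m+[n∸m]≡n (≤-trans (m≤m+n n l) n+l≤v)
      y<r : y < r
      y<r = +-cancelˡ-< n y r (subst (_< n + r) (sym n+y≡v) v<n+r)

    module _ (u v x : Bits n) (equ : ∀ j → lookup u j ≡ (toℕ j <ᵇ r))
      (eqv : ∀ j → lookup v j ≡ (toℕ j <ᵇ l))
             (eqx : x ≡ zipWith andNot u v) where

      lookup-x : ∀ j → lookup x j ≡ andNot (toℕ j <ᵇ r) (toℕ j <ᵇ l)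
      lookup-x j = trans (cong (λ x → lookup x j) eqx) (trans (lookup-zipWith andNot j u v)
        (cong₂ andNot (equ j) (eqv j)))

      inside : ∀ y → l ≤ y → (y<r : y < r) → lookup x (fromℕ< (<-≤-trans y<r r≤n)) ≡ true
      inside y l≤y y<r = trans (lookup-x _) (cong₂ andNot
        (<ᵇ-true (subst (_< r) (sym (toℕ-fromℕ< (<-≤-trans y<r r≤n))) y<r))
        (<ᵇ-false (subst (l ≤_) (sym (toℕ-fromℕ< (<-≤-trans y<r r≤n))) l≤y)))

      nonempty : ¬ IsZero x → l < r
      nonempty nz = ≰⇒> λ r≤l → nz (lookup-IsZero λ j → trans (lookup-x j) (outside r≤l j))
        where
        outside : r ≤ l → ∀ j → andNot (toℕ j <ᵇ r) (toℕ j <ᵇ l) ≡ false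
        outside r≤l j with toℕ j <? r
        ... | yes j<r rewrite <ᵇ-true (<-≤-trans j<r r≤l) = ∧-zeroʳ _
        ... | no  j≮r rewrite <ᵇ-false (≮⇒≥ j≮r) = refl

    Inv : State K 6 n w → ℕ → State K 6 n w → Set
    Inv s₁ m s₂ = ∃[ a ] ∃[ b ] (value (regs s₂ small rL) ≡ a × value (regs s₂ small rR) ≡ b ×
      regs s₂ small rG ≡ zipWith _xor_ (regs s₂ small rL) (regs s₂ small rR) ×
      b ∸ a ≡ m × a ≤ b × 1 ≤ a × b ≤ n × memory s₂ ≡ memory s ×
      (∀ c → (lookup (regs s₂ large lAcc) c ≡ false × AllFrom (FreeNode (memory s) d c) a b) ⇔
             (lookup (regs s₁ large lAcc) c ≡ false × AllFrom (FreeNode (memory s) d c) ⌈ n + l /2⌉ ⌊ n +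
               r /2⌋)))

    stop : ∀ s₁ s₂ → Inv s₁ 0 s₂ → IsZero (regs s₂ small rG)
    stop s₁ s₂ (a , b , eqa , eqb , guard , b∸a≡0 , a≤b , _) =
      subst IsZero (sym guard) (subst (λ v → IsZero (zipWith _xor_ (regs s₂ small rL) v))
        (value-injective (trans eqa (trans (≤-antisym a≤b (m∸n≡0⇒m≤n b∸a≡0)) (sym eqb)))) (xor-self _))

    body : ∀ s₁ m s₂ → Inv s₁ (suc m) s₂ → ¬ IsZero (regs s₂ small rG) ×
           Ends {M = M} 0 (narrow d 0F 1F) s₂ 15 (λ s₃ → ∃[ m′ ] (m′ ≤ ⌊ suc m /2⌋ × Inv s₁ m′ s₃))
    body s₁ m s₂ (a , b , eqa , eqb , guard , b∸a , a≤b , 1≤a , b≤n , refl , acc) =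
      (λ z → <⇒≢ a<b (trans (sym eqa) (trans (cong value (xor-zero _ _ (subst IsZero guard z))) eqb))) ,
      ends-then (narrow-correct s₂ d t tr 0F 1F eqa eqb (≤-trans a≤b b≤n) b≤n refl refl refl refl 1≤a a<b
        (≤-trans b≤n (m≤m+n n _)))
        λ s₃ (narrowed mem left right guard′ acc′) →
      ⌊ b /2⌋ ∸ ⌈ a /2⌉ , subst (λ k → ⌊ b /2⌋ ∸ ⌈ a /2⌉ ≤ ⌊ k /2⌋) b∸a (half∸ceil a b) ,
      _ , _ , left , right , guard′ , refl , ceil≤half a<b , ⌈n/2⌉-mono 1≤a , ≤-trans (⌊n/2⌋≤n b) b≤n ,
        mem ,
      λ c → mk⇔ (⇒ (acc c) ∘ ⇒ (acc′ c)) (⇐ (acc′ c) ∘ ⇐ (acc c))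
      where
      a<b : a < b
      a<b = m<n∸o⇒m+o<n′ b∸a
        where
        m<n∸o⇒m+o<n′ : ∀ {a b m} → b ∸ a ≡ suc m → a < b
        m<n∸o⇒m+o<n′ {a} {b} eq = ≰⇒> λ b≤a → case trans (sym eq) (m≤n⇒m∸n≡0 b≤a) of λ ()

-- Changing one bit

singleBit : ∀ {M} → Fin K → Prog M
singleBit i =
  setFirst large lArg i ▸ load small rG 5F i ▸ setFirst large lTmp rG ▸ bitwise large andNot lTmp lTmp
    lArg ▸ skip

putNode : ∀ {M} → Bool → Prog M
putNode d = ifZero small rG (store large (evenBank d) rH lRow ▸ skip) (store large (oddBank d) rH lRow ▸
  skip)

-- Both children of node `h` have address `h`, so they are loaded without doubling an index; the
-- parity of `h` decides into which bank their union goes. The root leads to 0, which ends the loop.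
climb : ∀ {M} → Bool → Prog M
climb d =
  load large lRow (evenBank d) rH ▸ load large lTmp (oddBank d) rH ▸ bitwise large _∨_ lRow lRow lTmp ▸
  mov small rL rH ▸ load small rH 0F rL ▸ load small rC 1F rL ▸ bitwise small _xor_ rG rH rC ▸ putNode d

change : ∀ {M} → (Bool → Bool → Bool) → Bool → Prog M
change f d =
  singleBit rX » load large lRow (rowBank d) rY ▸ bitwise large f lRow lRow lTmp ▸
  store large (rowBank d) rY lRow ▸
  load small rH 2F rY ▸ load small rC 3F rY ▸ bitwise small _xor_ rG rH rC ▸
  putNode d » whileNonzero small rH (climb d)

andNot-<ᵇ : ∀ j x → andNot (j <ᵇ suc x) (j <ᵇ x) ≡ (j ≡ᵇ x)
andNot-<ᵇ zero    zero    = refl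
andNot-<ᵇ zero    (suc x) = refl
andNot-<ᵇ (suc j) zero    = refl
andNot-<ᵇ (suc j) (suc x) = andNot-<ᵇ j x

rowBank≢nodeBank : ∀ d d′ v → rowBank d ≢ nodeBank d′ v
rowBank≢nodeBank false false v eq with isOdd v | eq
... | true  | ()
... | false | ()
rowBank≢nodeBank false true  v eq with isOdd v | eq
... | true  | ()
... | false | ()
rowBank≢nodeBank true  false v eq with isOdd v | eq
... | true  | ()
... | false | ()
rowBank≢nodeBank true  true  v eq with isOdd v | eq
... | true  | ()
... | false | ()

nodeBank-isOdd : ∀ d u v → nodeBank d u ≡ nodeBank d v → isOdd u ≡ isOdd v
nodeBank-isOdd d u v eq with isOdd u | isOdd v
nodeBank-isOdd d     u v eq | true  | true  = refl
nodeBank-isOdd d     u v eq | false | false = refl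
nodeBank-isOdd false u v () | true  | false
nodeBank-isOdd true  u v () | true  | false
nodeBank-isOdd false u v () | false | true
nodeBank-isOdd true  u v () | false | true

isOdd-half-injective : ∀ {u v} → isOdd u ≡ isOdd v → ⌊ u /2⌋ ≡ ⌊ v /2⌋ → u ≡ v
isOdd-half-injective {u} {v} odd half =
  trans (sym (parity-half u)) (trans (cong₂ (λ b h → (if b then 1 else 0) + 2 * h) odd half)
    (parity-half v))

slot-injective : ∀ {n u v} → u ≤ n → v ≤ n → slot {n} u ≡ slot v → u ≡ v
slot-injective u≤n v≤n eq = trans (sym (toℕ-slot u≤n)) (trans (cong toℕ eq) (toℕ-slot v≤n))

module _ {n w : ℕ} where

  putMem-same : ∀ β a r (μ : Memory 6 n w) → putMem large β a r μ large β a ≡ r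
  putMem-same β a r μ = trans (cong (λ bank → bank a) (updateAt-updates β (μ large)))
    (updateAt-updates a (μ large β))

  putMem-bank : ∀ β a r (μ : Memory 6 n w) β′ a′ → β′ ≢ β → putMem large β a r μ large β′ a′ ≡ μ large β′ a′
  putMem-bank β a r μ β′ a′ β′≢β = cong (λ bank → bank a′) (updateAt-minimal β′ β (μ large) β′≢β)

  putMem-slot : ∀ β a r (μ : Memory 6 n w) β′ a′ → a′ ≢ a → putMem large β a r μ large β′ a′ ≡ μ large β′ a′
  putMem-slot β a r μ β′ a′ a′≢a with β′ Fin.≟ β
  ... | no β′≢β = putMem-bank β a r μ β′ a′ β′≢β
  ... | yes refl = trans (cong (λ bank → bank a′) (updateAt-updates β (μ large)))
    (updateAt-minimal a′ a (μ large β) a′≢a)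

  putLine : Bool → ℕ → Bits n → Memory 6 n w → Memory 6 n w
  putLine d y = putMem large (rowBank d) (slot y)

  putAt : Bool → ℕ → Bits n → Memory 6 n w → Memory 6 n w
  putAt d v = putMem large (nodeBank d v) (slot ⌊ v /2⌋)

  line-putLine : ∀ d y r μ → lineAt (putLine d y r μ) d y ≡ r
  line-putLine d y r μ = putMem-same (rowBank d) (slot y) r μ

  line-putLine-other : ∀ d y r μ v → y ≤ n → v ≤ n → v ≢ y → lineAt (putLine d y r μ) d v ≡ lineAt μ d v
  line-putLine-other d y r μ v y≤n v≤n v≢y =
    putMem-slot (rowBank d) (slot y) r μ _ _ (λ eq → v≢y (slot-injective v≤n y≤n eq))

  node-putLine : ∀ d y r μ v → node (putLine d y r μ) d v ≡ node μ d v
  node-putLine d y r μ v = putMem-bank (rowBank d) (slot y) r μ _ _ (λ eq → rowBank≢nodeBank d d v (sym eq))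

  line-putAt : ∀ d v r μ y → lineAt (putAt d v r μ) d y ≡ lineAt μ d y
  line-putAt d v r μ y = putMem-bank (nodeBank d v) (slot ⌊ v /2⌋) r μ _ _ (rowBank≢nodeBank d d v)

  node-putAt : ∀ d v r μ → node (putAt d v r μ) d v ≡ r
  node-putAt d v r μ = putMem-same (nodeBank d v) (slot ⌊ v /2⌋) r μ

  -- Bank and address of a node give its parity and its half, hence the node. The bounds keep the
  -- halves at most `n`, where `slot` does not clamp.
  node-putAt-other : ∀ d v r μ u → v < 2 * suc n → u < 2 * suc n → u ≢ v → node (putAt d v r μ) d u
    ≡ node μ d u
  node-putAt-other d v r μ u v≤ u≤ u≢v with nodeBank d u Fin.≟ nodeBank d v
  ... | no  β≢ = putMem-bank (nodeBank d v) (slot ⌊ v /2⌋) r μ _ _ β≢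
  ... | yes β≡ = putMem-slot (nodeBank d v) (slot ⌊ v /2⌋) r μ _ _ λ eq → u≢v
    (isOdd-half-injective (nodeBank-isOdd d u v β≡)
                   (slot-injective (≤-pred (half-< u≤)) (≤-pred (half-< v≤)) eq))

  -- Invariant of `climb`: the tree may be wrong at node `h` alone. Recomputing `h` can spoil only
  -- its parent, and at `h = 0` a full tree is left because inner nodes start at 1.
  record Partial (d : Bool) (h : ℕ) (μ : Memory 6 n w) : Set where
    constructor partial
    field
      leaf  : ∀ y → y < n → node μ d (n + y) ≡ lineAt μ d y
      inner : ∀ u → 1 ≤ u → u < n → u ≢ h → node μ d u ≡ zipWith _∨_ (node μ d (2 * u))
        (node μ d (suc (2 * u)))

  double< : ∀ {u} → u < n → 2 * u < 2 * suc n × suc (2 * u) < 2 * suc n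
  double< {u} u<n = <-trans (n<1+n _) lt , lt
    where
    lt : suc (2 * u) < 2 * suc n
    lt = ≤-trans (≤-reflexive (sym (*-suc 2 u))) (*-monoʳ-≤ 2 (m≤n⇒m≤1+n u<n))

  putAt-leaf : ∀ {d y r μ} → y < n → Tree μ d → Partial d ⌊ n + y /2⌋ (putAt d (n + y) r (putLine d y r μ))
  putAt-leaf {d} {y} {r} {μ} y<n (tree leaf inner) = partial leaf′ inner′
    where
    μ₁ = putLine d y r μ
    bound : ∀ {v} → v < n → n + v < 2 * suc n
    bound v<n = +-mono-≤-< {n} (n≤1+n n) (≤-trans (<⇒≤ (s≤s v<n)) (m≤m+n (suc n) 0))

    other : ∀ {v} → v ≢ n + y → v < 2 * suc n → node (putAt d (n + y) r μ₁) d v ≡ node μ d v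
    other v≢ v< = trans (node-putAt-other d (n + y) r μ₁ _ (bound y<n) v< v≢) (node-putLine d y r μ _)

    leaf′ : ∀ v → v < n → node (putAt d (n + y) r μ₁) d (n + v) ≡ lineAt (putAt d (n + y) r μ₁) d v
    leaf′ v v<n with v ≟ y
    ... | yes refl = trans (node-putAt d (n + y) r μ₁)
      (sym (trans (line-putAt d (n + y) r μ₁ y) (line-putLine d y r μ)))
    ... | no  v≢y  = trans (other (λ eq → v≢y (+-cancelˡ-≡ n v y eq)) (bound v<n)) (trans (leaf v v<n)
                       (sym (trans (line-putAt d (n + y) r μ₁ v) (line-putLine-other d y r μ v (<⇒≤ y<n)
                         (<⇒≤ v<n) v≢y))))

    inner′ : ∀ u → 1 ≤ u → u < n → u ≢ ⌊ n + y /2⌋ → _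
    inner′ u 1≤u u<n u≢ = trans (other (<⇒≢ (<-≤-trans u<n (m≤m+n n y)))
      (<-trans u<n (<-≤-trans (n<1+n n) (m≤m+n (suc n) _))))
      (trans (inner u 1≤u u<n) (sym (cong₂ (zipWith _∨_)
        (other (λ eq → u≢ (trans (sym (⌊2*n/2⌋≡n u)) (cong ⌊_/2⌋ eq))) (proj₁ (double< u<n)))
        (other (λ eq → u≢ (trans (sym (⌊1+2*n/2⌋≡n u)) (cong ⌊_/2⌋ eq))) (proj₂ (double< u<n))))))

  putAt-inner : ∀ {d h μ} → 1 ≤ h → h < n → Partial d h μ →
    Partial d ⌊ h /2⌋ (putAt d h (zipWith _∨_ (node μ d (2 * h)) (node μ d (suc (2 * h)))) μ)
  putAt-inner {d} {h} {μ} 1≤h h<n (partial leaf inner) = partial leaf′ inner′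
    where
    r = zipWith _∨_ (node μ d (2 * h)) (node μ d (suc (2 * h)))

    small< : ∀ {u} → u < n → u < 2 * suc n
    small< u<n = <-trans u<n (<-≤-trans (n<1+n n) (m≤m+n (suc n) _))

    other : ∀ {v} → v ≢ h → v < 2 * suc n → node (putAt d h r μ) d v ≡ node μ d v
    other v≢ v< = node-putAt-other d h r μ _ (small< h<n) v< v≢

    leaf′ : ∀ v → v < n → node (putAt d h r μ) d (n + v) ≡ lineAt (putAt d h r μ) d v
    leaf′ v v<n = trans (other (≢-sym (<⇒≢ (<-≤-trans h<n (m≤m+n n v))))
      (+-mono-≤-< {n} (n≤1+n n) (≤-trans (<⇒≤ (s≤s v<n)) (m≤m+n (suc n) 0))))
                    (trans (leaf v v<n) (sym (line-putAt d h r μ v)))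

    inner′ : ∀ u → 1 ≤ u → u < n → u ≢ ⌊ h /2⌋ → _
    inner′ u 1≤u u<n u≢ = trans current (sym (cong₂ (zipWith _∨_)
        (other (λ eq → u≢ (trans (sym (⌊2*n/2⌋≡n u)) (cong ⌊_/2⌋ eq))) (proj₁ (double< u<n)))
        (other (λ eq → u≢ (trans (sym (⌊1+2*n/2⌋≡n u)) (cong ⌊_/2⌋ eq))) (proj₂ (double< u<n)))))
      where
      current : node (putAt d h r μ) d u ≡ zipWith _∨_ (node μ d (2 * u)) (node μ d (suc (2 * u)))
      current with u ≟ h
      ... | yes refl = node-putAt d h r μ
      ... | no  u≢h  = trans (other u≢h (small< u<n)) (inner u 1≤u u<n u≢h)

module _ {n w : ℕ} {M : Model} where

  singleBit-correct : ∀ {ℓ} (s : State K 6 n w) → Tables (memory s) → ∀ i {x} → value (regs s small i)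
    ≡ x → x < n →
    Ends {M = M} ℓ (singleBit i) s 4 (λ s′ → ∀ j → lookup (regs s′ large lTmp) j ≡ (toℕ j ≡ᵇ x))
  singleBit-correct s t i {x} eqx x<n =
    ends-setFirst lArg i eqx λ v eqv →
    ends-table t rG 5F i eqx (<⇒≤ x<n) λ g eqg →
    ends-setFirst lTmp rG (trans eqg (m≤n⇒m⊓n≡m x<n)) λ u equ →
    ends-bitwise large andNot lTmp lTmp lArg λ r eqr → ends-skip λ j →
    trans (cong (λ r → lookup r j) eqr) (trans (lookup-zipWith andNot j u v)
      (trans (cong₂ andNot (equ j) (eqv j)) (andNot-<ᵇ (toℕ j) x)))

  putNode-correct : ∀ {ℓ} (s : State K 6 n w) d v → value (regs s small rH) ≡ ⌊ v /2⌋ → ⌊ v /2⌋ ≤ n →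
    (IsZero (regs s small rG) ⇔ isOdd v ≡ false) →
    Ends {M = M} ℓ (putNode d) s 2 (λ s′ → memory s′ ≡ putAt d v (regs s large lRow) (memory s))
  putNode-correct s d v eqh h≤n guard = ends-ifZero
    (λ z → ends-store (evenBank d) rH lRow eqh h≤n (ends-skip
      (cong (λ b → putMem large (if b then oddBank d else evenBank d) (slot ⌊ v /2⌋) (regs s large lRow)
        (memory s)) (sym (⇒ guard z)))))
    (λ nz → ends-store (oddBank d) rH lRow eqh h≤n (ends-skip
      (cong (λ b → putMem large (if b then oddBank d else evenBank d) (slot ⌊ v /2⌋) (regs s large lRow)
        (memory s)) (sym (odd nz)))))
    where
    odd : ¬ IsZero (regs s small rG) → isOdd v ≡ true
    odd nz with isOdd v
    ... | true  = refl
    ... | false = ⊥-elim (nz (⇐ guard refl))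

  Climbing : Bool → ℕ → State K 6 n w → Set
  Climbing d h s = Tables (memory s) × value (regs s small rH) ≡ h × h < n × Partial d h (memory s)

  climb-correct : ∀ d m (s : State K 6 n w) → Climbing d (suc m) s → ¬ IsZero (regs s small rH) ×
    Ends {M = M} 0 (climb d) s 9 (λ s′ → ∃[ m′ ] (m′ ≤ ⌊ suc m /2⌋ × Climbing d m′ s′))
  climb-correct d m s (t , eqh , h<n , part) =
    (λ z → case trans (sym eqh) (IsZero-value z) of λ ()) ,
    ends-load large lRow (evenBank d) rH eqh (<⇒≤ h<n) (
    ends-load large lTmp (oddBank d) rH eqh (<⇒≤ h<n) (
    ends-bitwise large _∨_ lRow lRow lTmp λ r eqr →
    ends-mov small rL rH (
    ends-table t rH 0F rL eqh (<⇒≤ h<n) λ h eqh′ →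
    ends-table t rC 1F rL eqh (<⇒≤ h<n) λ c eqc →
    ends-bitwise small _xor_ rG rH rC λ g eqg →
    ends-then (framed (putNode-correct _ d (suc m) eqh′ half≤ (parity-guard {n = n} {M = M}
      (suc m) g h c eqh′ eqc eqg))) λ s′ (mem , F) →
    ⌊ suc m /2⌋ , ≤-refl ,
    (λ β a → trans (cong (λ bank → value (bank a)) (intact F small β refl)) (t β a)) ,
    trans (cong value (kept F small rH refl)) eqh′ ,
    ≤-<-trans (⌊n/2⌋≤n (suc m)) h<n ,
    subst (Partial d ⌊ suc m /2⌋) (sym (trans mem (cong (λ r → putAt d (suc m) r (memory s))
      (trans eqr (cong₂ (zipWith _∨_) (sym even-child) (sym odd-child))))))
        (putAt-inner (s≤s z≤n) h<n part))))
    where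
    half≤ : ⌊ suc m /2⌋ ≤ n
    half≤ = ≤-trans (⌊n/2⌋≤n (suc m)) (<⇒≤ h<n)


    even-child : node (memory s) d (2 * suc m) ≡ memory s large (evenBank d) (slot (suc m))
    even-child = trans (cong (λ b → memory s large (if b then oddBank d else evenBank d)
      (slot ⌊ 2 * suc m /2⌋)) (isOdd-2* (suc m)))
                       (cong (λ h → memory s large (evenBank d) (slot h)) (⌊2*n/2⌋≡n (suc m)))

    odd-child : node (memory s) d (suc (2 * suc m)) ≡ memory s large (oddBank d) (slot (suc m))
    odd-child = trans (cong (λ b → memory s large (if b then oddBank d else evenBank d)
      (slot ⌊ suc (2 * suc m) /2⌋)) (isOdd-1+2* (suc m)))
                      (cong (λ h → memory s large (oddBank d) (slot h)) (⌊1+2*n/2⌋≡n (suc m)))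

  record Changed (f : Bool → Bool → Bool) (d : Bool) (x y : ℕ) (μ μ′ : Memory 6 n w) : Set where
    constructor changed
    field
      tables : Tables μ′
      isTree : Tree μ′ d
      here   : ∀ j → lookup (lineAt μ′ d y) j ≡ f (lookup (lineAt μ d y) j) (toℕ j ≡ᵇ x)
      there  : ∀ v → v ≤ n → v ≢ y → lineAt μ′ d v ≡ lineAt μ d v

  change-correct : ∀ {ℓ} (s : State K 6 n w) → Tables (memory s) → ∀ f d → Tree (memory s) d → ∀ {x y} →
    value (regs s small rX) ≡ x → value (regs s small rY) ≡ y → x < n → y < n → bitLength n ≤ suc ℓ →
    Ends {M = M} ℓ (change f d) s 23 (λ s′ → Changed f d x y (memory s) (memory s′))
  change-correct {ℓ} s t f d tr {x} {y} eqx eqy x<n y<n n≤ℓ =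
    ends-seq (framed (singleBit-correct s t rX eqx x<n)) λ s₁ (bit , F₁) →
    let eqy₁ = trans (cong value (kept F₁ small rY refl)) eqy
        mem₁ = fixed F₁ refl
        μ = memory s₁
    in
    ends-load large lRow (rowBank d) rY eqy₁ (<⇒≤ y<n) (
    ends-bitwise large f lRow lRow lTmp λ r eqr →
    ends-store (rowBank d) rY lRow eqy₁ (<⇒≤ y<n) (
    ends-table {s = ⟪ _ , putLine d y r μ ⟫} (subst Tables (sym mem₁) t) rH 2F rY eqy₁ (<⇒≤ y<n) λ h eqh →
    ends-table {s = ⟪ _ , putLine d y r μ ⟫} (subst Tables (sym mem₁) t) rC 3F rY eqy₁ (<⇒≤ y<n) λ c eqc →
    ends-bitwise small _xor_ rG rH rC λ g eqg →
    ends-seq (framed (putNode-correct _ d (n + y) eqh (<⇒≤ half<n) (parity-guard {n = n} {M = M}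
      (n + y) g h c eqh eqc eqg))) λ s₂ (mem₂ , F₂) →
    ends-then (framed (while-halving (Climbing d) (λ s (_ , eqh , _) → value-IsZero eqh)
      (climb-correct d) ℓ ⌊ n + y /2⌋ s₂
      (≤-trans (bitLength-mono (<⇒≤ half<n)) n≤ℓ)
      ( (λ β a → trans (cong (λ bank → value (bank a)) (intact F₂ small β refl))
          (subst Tables (sym mem₁) t β a))
      , trans (cong value (kept F₂ small rH refl)) eqh , half<n
      , subst (Partial d ⌊ n + y /2⌋) (sym mem₂)
        (putAt-leaf y<n (subst (λ μ → Tree μ d) (sym mem₁) tr))))) λ s₃
        ((t₃ , _ , _ , partial leaf inner) , F₃) →
    let lines : ∀ v → lineAt (memory s₃) d v ≡ lineAt (putLine d y r μ) d v
        lines v = trans (cong (λ bank → bank (slot v)) (intact F₃ large (rowBank d) (rows-intact d)))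
                    (trans (cong (λ μ → lineAt μ d v) mem₂) (line-putAt d (n + y) r (putLine d y r μ) v))
    in changed t₃ (tree leaf λ u 1≤u u<n → inner u 1≤u u<n (≢-sym (<⇒≢ 1≤u)))
      (λ j → trans (cong (λ r → lookup r j) (trans (lines y) (trans (line-putLine d y r μ) eqr)))
        (trans (lookup-zipWith f j (lineAt μ d y) (regs s₁ large lTmp))
          (cong₂ f (cong (λ μ → lookup (lineAt μ d y) j) mem₁) (bit j))))
      (λ v v≤n v≢y → trans (lines v) (trans (line-putLine-other d y r μ v (<⇒≤ y<n) v≤n v≢y)
        (cong (λ μ → lineAt μ d v) mem₁)))))
    where
    half<n : ⌊ n + y /2⌋ < n
    half<n = half-< {m = n} (≤-trans (+-monoʳ-< n y<n) (≤-reflexive (cong (n +_) (sym (+-identityʳ n)))))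

    rows-intact : ∀ d → stores {M = M} (whileNonzero small rH (climb d)) large (rowBank d) ≡ false
    rows-intact true  = refl
    rows-intact false = refl

-- Testing for horizontal-vertical-horizontal paths

prepare between : ∀ {M} → Bool → Prog M
prepare d =
  bitwise large _xor_ lAcc lAcc lAcc ▸ bitwise large _xor_ lLeft lLeft lLeft ▸
  bitwise large _xor_ lRight lRight lRight ▸
  singleBit rX » load large lRow (rowBank d) rY ▸ bitwise large andNot lRow lRow lTmp ▸
  singleBit rX′ » load large lRow′ (rowBank d) rY′ ▸ bitwise large andNot lRow′ lRow′ lTmp ▸
  bitwise small _xor_ rG rY rY′ ▸
  -- If both tiles are on the same line, each copy of it lacks only one of them; the intersection
  -- lacks both.
  ifZero small rG (bitwise large _∧_ lRow lRow lRow′ ▸ mov large lRow′ lRow ▸ skip) skip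
between d =
  -- At least one of the two ranges is empty, so querying both saves ordering the tiles.
  load small rL 5F rY ▸ mov small rR rY′ ▸ query d » load small rL 5F rY′ ▸ mov small rR rY ▸ query d

scans : ∀ M → Prog M
scans M =
  mov large lThis lRow ▸ mov small rH′ rX ▸ scan M » mov large lThis lRow′ ▸ mov small rH′ rX′ ▸ scan M

succeed verdict : ∀ {M} → Prog M
-- Success is any nonzero value, here the successor of a coordinate. As `reach` never clears `rS`, a
-- second pass adds its verdict to that of the first.
succeed = load small rS 5F rX ▸ skip
verdict =
  -- A clear bit of `lAcc` is a column in which the middle segment can run, so it is the complement
  -- that has to be nonzero.
  bitwise large (λ a _ → not a) lTmp lAcc lAcc ▸
  ifZero large lTmp skip succeed » ifZero large lLeft succeed skip » ifZero large lRight succeed skip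

reach : ∀ M → Bool → Prog M
reach M d = prepare d » between d » scans M » verdict

≡ᵇ-true : ∀ j x → (j ≡ᵇ x) ≡ true → j ≡ x
≡ᵇ-true j x eq = ≡ᵇ⇒≡ j x (subst T (sym eq) tt)

≡ᵇ-refl : ∀ x → (x ≡ᵇ x) ≡ true
≡ᵇ-refl zero    = refl
≡ᵇ-refl (suc x) = ≡ᵇ-refl x

andNot⇔ : ∀ a j x → andNot a (j ≡ᵇ x) ≡ false ⇔ (a ≡ false ⊎ j ≡ x)
andNot⇔ a j x = mk⇔ (split a) [ (λ { refl → refl }) ,
  (λ { refl → trans (cong (andNot a) (≡ᵇ-refl j)) (∧-zeroʳ a) }) ]′
  where
  split : ∀ a → andNot a (j ≡ᵇ x) ≡ false → a ≡ false ⊎ j ≡ x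
  split false _  = inj₁ refl
  split true  eq with j ≡ᵇ x in eq′
  ... | true = inj₂ (≡ᵇ-true j x eq′)

∧-false⇔ : ∀ a b → a ∧ b ≡ false ⇔ (a ≡ false ⊎ b ≡ false)
∧-false⇔ false b = mk⇔ (λ _ → inj₁ refl) (λ _ → refl)
∧-false⇔ true  b = mk⇔ inj₂ [ (λ ()) , id ]′

module _ {n w : ℕ} (n<2^w : n < 2 ^ w) (d : Bool) (μ : Memory 6 n w) (x y x′ y′ : ℕ) where

  -- The counterpart in memory of the freeness in `Connected`: a path may occupy the cell.
  Occupiable : ℕ → Fin n → Set
  Occupiable v j = lookup (lineAt μ d v) j ≡ false ⊎ (toℕ j ≡ x × v ≡ y) ⊎ (toℕ j ≡ x′ × v ≡ y′)

  IsRow : Bits n → ℕ → Set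
  IsRow ρ v = ∀ j → lookup ρ j ≡ false ⇔ Occupiable v j

  Between : Fin n → Set
  Between c = AllFrom (λ v → lookup (lineAt μ d v) c ≡ false) (suc y) y′ ×
              AllFrom (λ v → lookup (lineAt μ d v) c ≡ false) (suc y′) y

  Reached : Bits n → Bits n → Set
  Reached ρ ρ′ =
    (∃[ c ] (Between c × Clear ρ x c × Clear ρ′ x′ c)) ⊎
    (∀ c → (toℕ c < x → lookup ρ c ≡ false) × (toℕ c < x′ → lookup ρ′ c ≡ false)) ⊎
    (∀ c → (x ≤ toℕ c → lookup ρ c ≡ false) × (x′ ≤ toℕ c → lookup ρ′ c ≡ false))

  record Operands (s : State K 6 n w) : Set where
    constructor operands
    field
      mem  : memory s ≡ μ
      eqx  : value (regs s small rX) ≡ x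
      eqy  : value (regs s small rY) ≡ y
      eqx′ : value (regs s small rX′) ≡ x′
      eqy′ : value (regs s small rY′) ≡ y′

  Operands-keep : ∀ {s s′} → Operands s → memory s′ ≡ memory s → regs s′ small rX ≡ regs s small rX →
    regs s′ small rY ≡ regs s small rY → regs s′ small rX′ ≡ regs s small rX′ → regs s′ small rY′
      ≡ regs s small rY′ → Operands s′
  Operands-keep (operands mem eqx eqy eqx′ eqy′) m a b a′ b′ =
    operands (trans m mem) (trans (cong value a) eqx) (trans (cong value b) eqy)
      (trans (cong value a′) eqx′) (trans (cong value b′) eqy′)

  module _ (t : Tables μ) (tr : Tree μ d) (x<n : x < n) (y<n : y < n) (x′<n : x′ < n) (y′<n : y′ < n) where

    record Prepared (s : State K 6 n w) : Set where
      constructor prepared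
      field
        row   : IsRow (regs s large lRow) y
        row′  : IsRow (regs s large lRow′) y′
        acc   : IsZero (regs s large lAcc)
        left  : IsZero (regs s large lLeft)
        right : IsZero (regs s large lRight)

    prepare-correct : ∀ {M ℓ} s → Operands s → Ends {M = M} ℓ (prepare d) s 19 Prepared
    prepare-correct {M} s ops@(operands refl eqx eqy eqx′ eqy′) =
      ends-bitwise large _xor_ lAcc lAcc lAcc λ u equ →
      ends-bitwise large _xor_ lLeft lLeft lLeft λ l eql →
      ends-bitwise large _xor_ lRight lRight lRight λ r eqr →
      ends-seq (framed (singleBit-correct _ t rX eqx x<n)) λ s₁ (bit₁ , F₁) →
      ends-load large lRow (rowBank d) rY (trans (cong value (kept F₁ small rY refl)) eqy) (<⇒≤ y<n) (
      ends-bitwise large andNot lRow lRow lTmp λ ρ eqρ →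
      let mem₁ = fixed F₁ refl in
      ends-seq (framed (singleBit-correct _ (subst Tables (sym mem₁) t) rX′
        (trans (cong value (kept F₁ small rX′ refl)) eqx′) x′<n)) λ s₂ (bit₂ , F₂) →
      let eqy₂  = trans (cong value (trans (kept F₂ small rY refl) (kept F₁ small rY refl))) eqy
          eqy′₂ = trans (cong value (trans (kept F₂ small rY′ refl) (kept F₁ small rY′ refl))) eqy′
          mem₂ = trans (fixed F₂ refl) mem₁
      in
      ends-load large lRow′ (rowBank d) rY′ eqy′₂ (<⇒≤ y′<n) (
      ends-bitwise large andNot lRow′ lRow′ lTmp λ ρ′ eqρ′ →
      ends-bitwise small _xor_ rG rY rY′ λ g eqg →
      let row₀ : cleared y x (regs s₂ large lRow)
          row₀ = subst (cleared y x) (sym (kept F₂ large lRow refl))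
                   (clear y x _ ρ _ (cong (λ μ → lineAt μ d y) mem₁) bit₁ eqρ)
          row₀′ : cleared y′ x′ ρ′
          row₀′ = clear y′ x′ _ ρ′ _ (cong (λ μ → lineAt μ d y′) mem₂) bit₂ eqρ′
          acc  = subst IsZero (sym (trans (trans (kept F₂ large lAcc refl) (kept F₁ large lAcc refl))
            equ)) (xor-self _)
          left = subst IsZero (sym (trans (trans (kept F₂ large lLeft refl) (kept F₁ large lLeft refl))
            eql)) (xor-self _)
          right = subst IsZero (sym (trans (trans (kept F₂ large lRight refl)
            (kept F₁ large lRight refl)) eqr)) (xor-self _)
      in
      ends-ifZero
        (λ z →
          let y≡y′ = trans (sym eqy₂) (trans (cong value (xor-zero _ _ (subst IsZero eqg z))) eqy′₂) in
          ends-bitwise large _∧_ lRow lRow lRow′ λ ρ″ eqρ″ → ends-mov large lRow′ lRow (ends-skip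
            (prepared (both-cleared y≡y′ ρ″ eqρ″ row₀ row₀′)
              (subst (IsRow ρ″) y≡y′ (both-cleared y≡y′ ρ″ eqρ″ row₀ row₀′)) acc left right)))
        (λ nz →
          let y≢y′ : y ≢ y′
              y≢y′ eq = nz (subst IsZero (sym
                (trans eqg (cong (λ u → zipWith _xor_ u (regs s₂ small rY′))
                (value-injective {v = regs s₂ small rY′} (trans eqy₂ (trans eq (sym eqy′₂)))))))
                (xor-self (regs s₂ small rY′)))
          in ends-mono z≤n (λ _ q → q) (ends-skip
            (prepared (λ j → mk⇔ ([ inj₁ , (λ e → inj₂ (inj₁ (e , refl))) ]′ ∘ ⇒ (row₀ j))
                                 ([ ⇐ (row₀ j) ∘ inj₁ , [ (λ (e , _) → ⇐ (row₀ j) (inj₂ e)) ,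
                                   (λ (_ , eq) → ⊥-elim (y≢y′ eq)) ]′ ]′))
                      (λ j → mk⇔ ([ inj₁ , (λ e → inj₂ (inj₂ (e , refl))) ]′ ∘ ⇒ (row₀′ j))
                                 ([ ⇐ (row₀′ j) ∘ inj₁ , [ (λ (_ , eq) → ⊥-elim (y≢y′ (sym eq))) ,
                                   (λ (e , _) → ⇐ (row₀′ j) (inj₂ e)) ]′ ]′))
                      acc left right)))))
      where
      cleared : ℕ → ℕ → Bits n → Set
      cleared v a ρ = ∀ j → lookup ρ j ≡ false ⇔ (lookup (lineAt μ d v) j ≡ false ⊎ toℕ j ≡ a)

      clear : ∀ v a u ρ m → u ≡ lineAt μ d v → (∀ j → lookup m j ≡ (toℕ j ≡ᵇ a)) → ρ ≡ zipWith andNot u m →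
        cleared v a ρ
      clear v a _ _ m refl eqm refl j rewrite lookup-zipWith andNot j (lineAt μ d v) m | eqm j =
        andNot⇔ _ (toℕ j) a

      both-cleared : ∀ {ρ ρ′} → y ≡ y′ → ∀ ρ″ → ρ″ ≡ zipWith _∧_ ρ ρ′ → cleared y x ρ →
        cleared y′ x′ ρ′ → IsRow ρ″ y
      both-cleared {ρ} {ρ′} refl _ refl row₀ row₀′ j rewrite lookup-zipWith _∧_ j ρ ρ′ = mk⇔
        ([ [ inj₁ , (λ e → inj₂ (inj₁ (e , refl))) ]′ ∘ ⇒ (row₀ j) , [ inj₁ ,
          (λ e → inj₂ (inj₂ (e , refl))) ]′ ∘ ⇒ (row₀′ j) ]′ ∘ ⇒ (∧-false⇔ _ _))
        ([ ⇐ (∧-false⇔ _ _) ∘ inj₁ ∘ ⇐ (row₀ j) ∘ inj₁ , [ ⇐ (∧-false⇔ _ _) ∘ inj₁ ∘ ⇐ (row₀ j) ∘ inj₂ ∘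
          proj₁ , ⇐ (∧-false⇔ _ _) ∘ inj₂ ∘ ⇐ (row₀′ j) ∘ inj₂ ∘ proj₁ ]′ ]′)

    between-correct : ∀ {M ℓ} s → Operands s → bitLength ∣ y - y′ ∣ ≤ suc ℓ → Ends {M = M} ℓ
      (between d) s 76 (λ s′ → ∀ c →
      lookup (regs s′ large lAcc) c ≡ false ⇔ (lookup (regs s large lAcc) c ≡ false × Between c))
    between-correct {M} s (operands refl eqx eqy eqx′ eqy′) len =
      ends-table t rL 5F rY eqy (<⇒≤ y<n) λ l eql →
      ends-mov small rR rY′ (
      ends-seq (framed (query-correct _ d t tr (trans eql (m≤n⇒m⊓n≡m y<n)) eqy′ y<n (<⇒≤ y′<n)
        (≤-trans (bitLength-mono (≤-trans (∸-monoʳ-≤ y′ (n≤1+n y)) (m∸n≤∣n-m∣′ y y′))) len))) λ s₁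
          (acc₁ , F₁) →
      let mem₁ = fixed F₁ (query-storeFree d)
          t₁ = subst Tables (sym mem₁) t
      in
      ends-table t₁ rL 5F rY′ (trans (cong value (kept F₁ small rY′ refl)) eqy′) (<⇒≤ y′<n) λ l′ eql′ →
      ends-mov small rR rY (
      ends-then (query-correct _ d t₁ (subst (λ μ → Tree μ d) (sym mem₁) tr) (trans eql′ (m≤n⇒m⊓n≡m y′<n))
          (trans (cong value (kept F₁ small rY refl)) eqy) y′<n (<⇒≤ y<n)
          (≤-trans (bitLength-mono (≤-trans (∸-monoʳ-≤ y (n≤1+n y′)) (m∸n≤∣m-n∣ y y′))) len))
            λ s₂ acc₂ c → mk⇔
        (λ e → let (e₁ , below) = ⇒ (acc₂ c) e ; (e₀ , above) = ⇒ (acc₁ c) e₁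
               in e₀ , above , subst (λ μ → AllFrom (λ v → lookup (lineAt μ d v) c ≡ false) (suc y′) y)
                 mem₁ below)
        (λ (e₀ , above , below) → ⇐ (acc₂ c) (⇐ (acc₁ c) (e₀ , above) ,
          subst (λ μ → AllFrom (λ v → lookup (lineAt μ d v) c ≡ false) (suc y′) y) (sym mem₁) below))))
      where
      m∸n≤∣n-m∣′ : ∀ a b → b ∸ a ≤ ∣ a - b ∣
      m∸n≤∣n-m∣′ a b = ≤-trans (m∸n≤∣m-n∣ b a) (≤-reflexive (∣-∣-comm b a))

      query-storeFree : ∀ d → storeFree {M = M} (query d) ≡ true
      query-storeFree true  = refl
      query-storeFree false = refl

    record Scans (s s′ : State K 6 n w) (ρ ρ′ : Bits n) : Set where
      constructor mkScans
      field
        acc⇔   : ∀ c → lookup (regs s′ large lAcc) c ≡ false ⇔ (lookup (regs s large lAcc) c ≡ false ×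
          Clear ρ x c × Clear ρ′ x′ c)
        left⇔  : ∀ c → lookup (regs s′ large lLeft) c ≡ false ⇔ (lookup (regs s large lLeft) c ≡ false ×
                   (toℕ c < x → lookup ρ c ≡ false) × (toℕ c < x′ → lookup ρ′ c ≡ false))
        right⇔ : ∀ c → lookup (regs s′ large lRight) c ≡ false ⇔ (lookup (regs s large lRight) c ≡ false ×
                   (x ≤ toℕ c → lookup ρ c ≡ false) × (x′ ≤ toℕ c → lookup ρ′ c ≡ false))

    scans-correct : ∀ M {ℓ} s → Operands s → FindBound M n ℓ →
      Ends ℓ (scans M) s 82 (λ s′ → Scans s s′ (regs s large lRow) (regs s large lRow′))
    scans-correct M s (operands refl eqx eqy eqx′ eqy′) bound =
      ends-mov large lThis lRow (
      ends-mov small rH′ rX (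
      ends-seq (framed (scan-correct n<2^w M bound _ t x eqx)) λ s₁ (scanned acc₁ left₁ right₁ , F₁) →
      ends-mov large lThis lRow′ (
      ends-mov small rH′ rX′ (
      ends-then (scan-correct n<2^w M bound _ (subst Tables (sym (keepsMemory scan refl M F₁)) t) x′
        (trans (cong value (keeps scan small rX′ refl M F₁)) eqx′)) λ s₂ (scanned acc₂ left₂ right₂) →
      let row′ : regs s₁ large lRow′ ≡ regs s large lRow′
          row′ = keeps scan large lRow′ refl M F₁
      in mkScans
        (λ c → chain (subst (λ ρ′ → _ ⇔ (_ × Clear ρ′ x′ c)) row′ (acc₂ c)) (acc₁ c))
        (λ c → chain (subst (λ ρ′ → _ ⇔ (_ × (toℕ c < x′ → lookup ρ′ c ≡ false))) row′ (left₂ c)) (left₁ c))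
        (λ c → chain (subst (λ ρ′ → _ ⇔ (_ × (x′ ≤ toℕ c → lookup ρ′ c ≡ false))) row′ (right₂ c))
          (right₁ c))))))
      where
      chain : {A B C D E : Set} → A ⇔ (B × C) → B ⇔ (D × E) → A ⇔ (D × E × C)
      chain f g = mk⇔ (λ a → let (b , c) = ⇒ f a ; (d , e) = ⇒ g b in d , e , c)
        (λ (d , e , c) → ⇐ f (⇐ g (d , e) , c))

    succeed-correct : ∀ {M ℓ} s → Operands s → Ends {M = M} ℓ succeed s 1
      (λ s′ → ¬ IsZero (regs s′ small rS))
    succeed-correct s (operands refl eqx _ _ _) =
      ends-table t rS 5F rX eqx (<⇒≤ x<n) λ u equ → ends-skip λ z →
      case trans (sym (IsZero-value z)) (trans equ (m≤n⇒m⊓n≡m x<n)) of λ ()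

    verdict-correct : ∀ {M ℓ} s → Operands s → Ends {M = M} ℓ verdict s 7 (λ s′ →
      (¬ IsZero (regs s′ small rS)) ⇔
      (¬ IsZero (regs s small rS) ⊎ (∃[ c ] lookup (regs s large lAcc) c ≡ false) ⊎
       IsZero (regs s large lLeft) ⊎ IsZero (regs s large lRight)))
    verdict-correct {M} s ops =
      ends-bitwise large (λ a _ → not a) lTmp lAcc lAcc λ u equ →
      let ops₀ = Operands-keep ops refl refl refl refl refl in
      ends-seq (framed (ends-ifZero {C = 1} {Q = λ s′ → (¬ IsZero (regs s′ small rS)) ⇔
                               (¬ IsZero (regs s small rS) ⊎ (∃[ c ] lookup (regs s large lAcc) c ≡ false))}
        (λ z → ends-mono z≤n (λ _ q → q) (ends-skip (mk⇔ inj₁ [ id , (λ (c , e) → ⊥-elim (true≢false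
                 (trans (sym (trans (inverted u equ c) (cong not e))) (IsZero-lookup z c)))) ]′)))
        (λ nz → ends-then (succeed-correct _ ops₀) λ s′ won → mk⇔ (λ _ → inj₂ (hole u equ nz))
          (λ _ → won)))) λ s₁ (res₁ , F₁) →
      let ops₁ = Operands-keep ops₀ (fixed F₁ refl) (kept F₁ small rX refl) (kept F₁ small rY refl)
            (kept F₁ small rX′ refl) (kept F₁ small rY′ refl)
          left₁ : regs s₁ large lLeft ≡ regs s large lLeft
          left₁ = kept F₁ large lLeft refl
      in
      ends-seq (framed (win-if lLeft s₁ ops₁)) λ s₂ (res₂ , F₂) →
      let ops₂ = Operands-keep ops₁ (fixed F₂ refl) (kept F₂ small rX refl) (kept F₂ small rY refl)
            (kept F₂ small rX′ refl) (kept F₂ small rY′ refl)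
          right₂ : regs s₂ large lRight ≡ regs s large lRight
          right₂ = trans (kept F₂ large lRight refl) (kept F₁ large lRight refl)
      in
      ends-then (win-if lRight s₂ ops₂) λ s₃ res₃ → mk⇔
        (λ nz → case ⇒ res₃ nz of λ
          { (inj₂ z) → inj₂ (inj₂ (inj₂ (subst IsZero right₂ z)))
          ; (inj₁ nz₂) → case ⇒ res₂ nz₂ of λ
            { (inj₂ z) → inj₂ (inj₂ (inj₁ (subst IsZero left₁ z)))
            ; (inj₁ nz₁) → case ⇒ res₁ nz₁ of λ { (inj₁ nz₀) → inj₁ nz₀ ; (inj₂ h) → inj₂ (inj₁ h) } } })
        (λ { (inj₁ nz) → ⇐ res₃ (inj₁ (⇐ res₂ (inj₁ (⇐ res₁ (inj₁ nz)))))
           ; (inj₂ (inj₁ h)) → ⇐ res₃ (inj₁ (⇐ res₂ (inj₁ (⇐ res₁ (inj₂ h)))))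
           ; (inj₂ (inj₂ (inj₁ z))) → ⇐ res₃ (inj₁ (⇐ res₂ (inj₂ (subst IsZero (sym left₁) z))))
           ; (inj₂ (inj₂ (inj₂ z))) → ⇐ res₃ (inj₂ (subst IsZero (sym right₂) z)) })
      where
      inverted : ∀ u → u ≡ zipWith (λ a _ → not a) (regs s large lAcc) (regs s large lAcc) → ∀ c →
        lookup u c ≡ not (lookup (regs s large lAcc) c)
      inverted u equ c = trans (cong (λ u → lookup u c) equ) (lookup-zipWith (λ a _ → not a) c
        (regs s large lAcc) (regs s large lAcc))

      hole : ∀ u → u ≡ zipWith (λ a _ → not a) (regs s large lAcc) (regs s large lAcc) → ¬ IsZero u →
        ∃[ c ] lookup (regs s large lAcc) c ≡ false
      hole u equ nz with IsZero? u
      ... | inj₁ z = ⊥-elim (nz z)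
      ... | inj₂ (c , e) with lookup (regs s large lAcc) c in eq
      ...   | false = c , eq
      ...   | true  = ⊥-elim (true≢false (trans (sym e) (trans (inverted u equ c) (cong not eq))))

      win-if : ∀ {ℓ} i s → Operands s → Ends {M = M} ℓ (ifZero large i succeed skip) s 2 (λ s′ →
        (¬ IsZero (regs s′ small rS)) ⇔ (¬ IsZero (regs s small rS) ⊎ IsZero (regs s large i)))
      win-if i s ops = ends-ifZero
        (λ z → ends-then (succeed-correct s ops) λ s′ won → mk⇔ (λ _ → inj₂ z) (λ _ → won))
        (λ nz → ends-mono z≤n (λ _ q → q) (ends-skip (mk⇔ inj₁ [ id , (λ z → ⊥-elim (nz z)) ]′)))

    -- The disjunction with the earlier state of `rS` allows the passes for the two orientations to
    -- be chained. The rows are given up to `IsRow`, the form in which the geometry uses them. The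
    -- constant adds up the four stages: 184 = 19 + 76 + 82 + 7.
    reach-correct : ∀ M {ℓ} s → Operands s → bitLength ∣ y - y′ ∣ ≤ suc ℓ → FindBound M n ℓ →
      Ends ℓ (reach M d) s 184 (λ s′ → ∃[ ρ ] ∃[ ρ′ ] (IsRow ρ y × IsRow ρ′ y′ ×
        ((¬ IsZero (regs s′ small rS)) ⇔ (¬ IsZero (regs s small rS) ⊎ Reached ρ ρ′))))
    reach-correct M s ops len bound =
      ends-seq (framed (prepare-correct s ops)) λ s₁ (prepared row row′ acc₀ left₀ right₀ , F₁) →
      let ops₁ = Operands-keep ops (fixed F₁ refl) (kept F₁ small rX refl) (kept F₁ small rY refl)
            (kept F₁ small rX′ refl) (kept F₁ small rY′ refl)
      in
      ends-seq (framed (between-correct s₁ ops₁ len)) λ s₂ (acc₂ , F₂) →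
      let ops₂ = Operands-keep ops₁ (fixed F₂ refl) (kept F₂ small rX refl) (kept F₂ small rY refl)
            (kept F₂ small rX′ refl) (kept F₂ small rY′ refl)
          left₂ : regs s₂ large lLeft ≡ regs s₁ large lLeft
          left₂ = kept F₂ large lLeft refl
          right₂ : regs s₂ large lRight ≡ regs s₁ large lRight
          right₂ = kept F₂ large lRight refl
          row₂ : regs s₂ large lRow ≡ regs s₁ large lRow
          row₂ = kept F₂ large lRow refl
          row′₂ : regs s₂ large lRow′ ≡ regs s₁ large lRow′
          row′₂ = kept F₂ large lRow′ refl
      in
      ends-seq (framed (scans-correct M s₂ ops₂ bound)) λ s₃ (mkScans acc₃ left₃ right₃ , F₃) →
      let ops₃ = Operands-keep ops₂ (keepsMemory scans refl M F₃) (keeps scans small rX refl M F₃)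
            (keeps scans small rY refl M F₃) (keeps scans small rX′ refl M F₃)
            (keeps scans small rY′ refl M F₃)
          result₃ : regs s₃ small rS ≡ regs s small rS
          result₃ = trans (keeps scans small rS refl M F₃) (trans (kept F₂ small rS refl)
            (kept F₁ small rS refl))
      in
      ends-then (verdict-correct s₃ ops₃) λ s₄ res →
      regs s₂ large lRow , regs s₂ large lRow′ , subst (λ ρ → IsRow ρ y) (sym row₂) row , subst
        (λ ρ → IsRow ρ y′) (sym row′₂) row′ ,
      mk⇔
        (λ nz → case ⇒ res nz of λ
          { (inj₁ nz₃) → inj₁ (subst (λ u → ¬ IsZero u) result₃ nz₃)
          ; (inj₂ (inj₁ (c , e))) → let (e₂ , cl , cl′) = ⇒ (acc₃ c) e in inj₂
              (inj₁ (c , proj₂ (⇒ (acc₂ c) e₂) , cl , cl′))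
          ; (inj₂ (inj₂ (inj₁ z))) → inj₂ (inj₂ (inj₁ λ c → proj₂ (⇒ (left₃ c) (IsZero-lookup z c))))
          ; (inj₂ (inj₂ (inj₂ z))) → inj₂ (inj₂ (inj₂ λ c → proj₂ (⇒ (right₃ c) (IsZero-lookup z c)))) })
        (λ { (inj₁ nz) → ⇐ res (inj₁ (subst (λ u → ¬ IsZero u) (sym result₃) nz))
           ; (inj₂ (inj₁ (c , btw , cl , cl′))) → ⇐ res
               (inj₂ (inj₁ (c , ⇐ (acc₃ c) (⇐ (acc₂ c) (IsZero-lookup acc₀ c , btw) , cl , cl′))))
           ; (inj₂ (inj₂ (inj₁ l))) → ⇐ res
               (inj₂ (inj₂ (inj₁ (lookup-IsZero λ c → ⇐ (left₃ c)
               (IsZero-lookup (subst IsZero (sym left₂) left₀) c , l c)))))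
           ; (inj₂ (inj₂ (inj₂ r))) → ⇐ res
               (inj₂ (inj₂ (inj₂ (lookup-IsZero λ c → ⇐ (right₃ c)
               (IsZero-lookup (subst IsZero (sym right₂) right₀) c , r c))))) })

-- Geometry of paths

-- The segment between two coordinates in either order. The disjunction replaces minimum and
-- maximum, so that segments can be split and joined by cases.
Itv : ℤ → ℤ → ℤ → Set
Itv a b u = (a ℤ.≤ u × u ℤ.≤ b) ⊎ (b ℤ.≤ u × u ℤ.≤ a)

itv-box : ∀ {a b u} → a ℤ.⊓ b ℤ.≤ u → u ℤ.≤ a ℤ.⊔ b → Itv a b u
itv-box {a} {b} {u} low high with ℤₚ.≤-total a b
... | inj₁ a≤b = inj₁ (subst (ℤ._≤ u) (ℤₚ.i≤j⇒i⊓j≡i a≤b) low , subst (u ℤ.≤_) (ℤₚ.i≤j⇒i⊔j≡j a≤b) high)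
... | inj₂ b≤a = inj₂ (subst (ℤ._≤ u) (ℤₚ.i≥j⇒i⊓j≡j b≤a) low , subst (u ℤ.≤_) (ℤₚ.i≥j⇒i⊔j≡i b≤a) high)

box-itv : ∀ {a b u} → Itv a b u → a ℤ.⊓ b ℤ.≤ u × u ℤ.≤ a ℤ.⊔ b
box-itv {a} {b} (inj₁ (a≤u , u≤b)) = ℤₚ.≤-trans (ℤₚ.i⊓j≤i a b) a≤u , ℤₚ.≤-trans u≤b (ℤₚ.i≤j⊔i a b)
box-itv {a} {b} (inj₂ (b≤u , u≤a)) = ℤₚ.≤-trans (ℤₚ.i⊓j≤j a b) b≤u , ℤₚ.≤-trans u≤a (ℤₚ.i≤i⊔j a b)

itv-point : ∀ {a u} → Itv a a u → u ≡ a
itv-point (inj₁ (a≤u , u≤a)) = ℤₚ.≤-antisym u≤a a≤u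
itv-point (inj₂ (a≤u , u≤a)) = ℤₚ.≤-antisym u≤a a≤u

itv-split : ∀ {a c u} b → Itv a c u → Itv a b u ⊎ Itv b c u
itv-split {u = u} b i with ℤₚ.≤-total u b | i
... | inj₁ u≤b | inj₁ (a≤u , _) = inj₁ (inj₁ (a≤u , u≤b))
... | inj₁ u≤b | inj₂ (c≤u , _) = inj₂ (inj₂ (c≤u , u≤b))
... | inj₂ b≤u | inj₁ (_ , u≤c) = inj₂ (inj₁ (b≤u , u≤c))
... | inj₂ b≤u | inj₂ (_ , u≤a) = inj₁ (inj₂ (b≤u , u≤a))

itv-sym : ∀ {a b u} → Itv a b u → Itv b a u
itv-sym (inj₁ i) = inj₂ i
itv-sym (inj₂ i) = inj₁ i

transpose : Point → Point
transpose (x , y) = y , x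

HSeg : (Point → Set) → ℤ → ℤ → ℤ → Set
HSeg F y a b = ∀ u → Itv a b u → F (u , y)

-- Expressed by transposition so that facts about horizontal segments carry over. Transposing twice
-- is the identity by computation, which lets a vertical-horizontal-vertical path be read as an
-- `HVH` for `F ∘ transpose` without conversion.
VSeg : (Point → Set) → ℤ → ℤ → ℤ → Set
VSeg F x = HSeg (F ∘ transpose) x

HVH : (Point → Set) → Point → Point → Set
HVH F (x , y) (x′ , y′) = ∃[ c ] (HSeg F y x c × VSeg F c y y′ × HSeg F y′ c x′)

seg-point : ∀ {P : ℤ → Set} {a} → P a → ∀ u → Itv a a u → P u
seg-point f u i with refl ← itv-point i = f

seg-join : ∀ {P : ℤ → Set} {a c} b → (∀ u → Itv a b u → P u) → (∀ u → Itv b c u → P u) → ∀ u →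
  Itv a c u → P u
seg-join b s s′ u i = [ s u , s′ u ]′ (itv-split b i)

data Line (F : Point → Set) : Point → Point → Set where
  hor : ∀ {x x′ y} → HSeg F y x x′ → Line F (x , y) (x′ , y)
  ver : ∀ {x y y′} → VSeg F x y y′ → Line F (x , y) (x , y′)

straight-line : ∀ {F p q} → Straight p q → (∀ a → OnSegment p q a → F a) → Line F p q
straight-line (inj₁ refl) free = ver λ u i → free _ ((ℤₚ.i⊓j≤i _ _ , ℤₚ.i≤i⊔j _ _) , box-itv i)
straight-line (inj₂ refl) free = hor λ u i → free _ (box-itv i , (ℤₚ.i⊓j≤i _ _ , ℤₚ.i≤i⊔j _ _))

hor-line : ∀ {F m x x′ y q} → HSeg F y x x′ → Path F m (x′ , y) q → Path F (suc m) (x , y) q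
hor-line {F} {x = x} {x′} {y} s = line (inj₂ refl) free
  where
  free : ∀ a → OnSegment (x , y) (x′ , y) a → F a
  free (u , v) ((l , h) , (l′ , h′)) with refl ← itv-point (itv-box l′ h′) = s u (itv-box l h)

ver-line : ∀ {F m x y y′ q} → VSeg F x y y′ → Path F m (x , y′) q → Path F (suc m) (x , y) q
ver-line {F} {x = x} {y} {y′} s = line (inj₁ refl) free
  where
  free : ∀ a → OnSegment (x , y) (x , y′) a → F a
  free (u , v) ((l , h) , (l′ , h′)) with refl ← itv-point (itv-box l h) = s v (itv-box l′ h′)

-- Shorter paths are extended by one-point lines at their end, which leaves only paths of exactly
-- three lines to be analysed.
pad : ∀ {F m p q} k → F q → Path F m p q → Path F (m + k) p q
pad zero    f done = done
pad {q = x , y} (suc k) f done = hor-line (seg-point f) (pad k f done)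
pad k f (line st free path) = line st free (pad k f path)

-- The two alternating patterns are the two alternatives. In each of the other six, neighbouring
-- lines of equal direction merge, and the freed places are filled with one-point lines at `p` or
-- `q`, for which the ends must be free.
three-lines : ∀ {F p r r′ q} → F p → F q → Line F p r → Line F r r′ → Line F r′ q →
              HVH F p q ⊎ HVH (F ∘ transpose) (transpose p) (transpose q)
three-lines fp fq (hor s) (ver s′) (hor s″) = inj₁ (_ , s , s′ , s″)
three-lines fp fq (ver s) (hor s′) (ver s″) = inj₂ (_ , s , s′ , s″)
three-lines fp fq (hor s) (hor s′) (hor s″) = inj₁ (_ , seg-join _ s (seg-join _ s′ s″) , seg-point fq ,
  seg-point fq)
three-lines fp fq (hor s) (hor s′) (ver s″) = inj₁ (_ , seg-join _ s s′ , s″ , seg-point fq)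
three-lines fp fq (hor s) (ver s′) (ver s″) = inj₁ (_ , s , seg-join _ s′ s″ , seg-point fq)
three-lines fp fq (ver s) (ver s′) (hor s″) = inj₁ (_ , seg-point fp , seg-join _ s s′ , s″)
three-lines fp fq (ver s) (hor s′) (hor s″) = inj₁ (_ , seg-point fp , s , seg-join _ s′ s″)
three-lines fp fq (ver s) (ver s′) (ver s″) = inj₁ (_ , seg-point fp , seg-join _ s (seg-join _ s′ s″) ,
  seg-point fq)

path⇔HVH : ∀ {F p q} → F p → F q →
  (∃[ m ] (m ≤ 3 × Path F m p q)) ⇔ (HVH F p q ⊎ HVH (F ∘ transpose) (transpose p) (transpose q))
path⇔HVH {F} {p} {q} fp fq = mk⇔
  (λ (m , m≤3 , path) → exact (subst (λ m → Path F m p q) (m+[n∸m]≡n m≤3) (pad (3 ∸ m) fq path)))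
  [ (λ (c , s , s′ , s″) → 3 , ≤-refl , hor-line s (ver-line s′ (hor-line s″ done)))
  , (λ (c , s , s′ , s″) → 3 , ≤-refl , ver-line s (hor-line s′ (ver-line s″ done))) ]′
  where
  exact : Path F 3 p q → _
  exact (line st f (line st′ f′ (line st″ f″ done))) =
    three-lines fp fq (straight-line st f) (straight-line st′ f′) (straight-line st″ f″)

itv-nat : ∀ {a b u} → Itv (ℤ.+ a) (ℤ.+ b) u → ∃[ k ] (u ≡ ℤ.+ k × ((a ≤ k × k ≤ b) ⊎ (b ≤ k × k ≤ a)))
itv-nat (inj₁ (ℤ.+≤+ a≤k , ℤ.+≤+ k≤b)) = _ , refl , inj₁ (a≤k , k≤b)
itv-nat (inj₂ (ℤ.+≤+ b≤k , ℤ.+≤+ k≤a)) = _ , refl , inj₂ (b≤k , k≤a)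

itv-up : ∀ {a b k} → a ≤ k → k ≤ b → Itv (ℤ.+ a) (ℤ.+ b) (ℤ.+ k)
itv-up a≤k k≤b = inj₁ (ℤ.+≤+ a≤k , ℤ.+≤+ k≤b)

itv-down : ∀ {a b k} → b ≤ k → k ≤ a → Itv (ℤ.+ a) (ℤ.+ b) (ℤ.+ k)
itv-down b≤k k≤a = inj₂ (ℤ.+≤+ b≤k , ℤ.+≤+ k≤a)

itv-minus : ∀ {a m k} → k ≤ a → Itv (ℤ.+ a) -[1+ m ] (ℤ.+ k)
itv-minus k≤a = inj₂ (ℤ.-≤+ , ℤ.+≤+ k≤a)

module _ {n w : ℕ} (n<2^w : n < 2 ^ w) (d : Bool) (μ : Memory 6 n w) (x y x′ y′ : ℕ)
         (x<n : x < n) (y<n : y < n) (x′<n : x′ < n) (y′<n : y′ < n) (F : Point → Set)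
         (inside : ∀ j v → v < n → F (ℤ.+ toℕ j , ℤ.+ v) ⇔ Occupiable n<2^w d μ x y x′ y′ v j)
         (left : ∀ m v → F (-[1+ m ] , v))
         (right : ∀ k v → n ≤ k → F (ℤ.+ k , v))
         (ρ ρ′ : Bits n) (isRow : IsRow n<2^w d μ x y x′ y′ ρ y) (isRow′ : IsRow n<2^w d μ x y x′ y′ ρ′ y′)
         where

  private
    inside-ℕ : ∀ {k v} (k<n : k < n) → v < n → Occupiable n<2^w d μ x y x′ y′ v (fromℕ< k<n) → F
      (ℤ.+ k , ℤ.+ v)
    inside-ℕ k<n v<n o = subst (λ k → F (ℤ.+ k , _)) (toℕ-fromℕ< k<n) (⇐ (inside (fromℕ< k<n) _ v<n) o)

    start : F (ℤ.+ x , ℤ.+ y)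
    start = inside-ℕ x<n y<n (inj₂ (inj₁ (toℕ-fromℕ< x<n , refl)))

    end : F (ℤ.+ x′ , ℤ.+ y′)
    end = inside-ℕ x′<n y′<n (inj₂ (inj₂ (toℕ-fromℕ< x′<n , refl)))

    module Row {z v : ℕ} (σ : Bits n) (z<n : z < n) (v<n : v < n) (here : F (ℤ.+ z , ℤ.+ v))
               (row : IsRow n<2^w d μ x y x′ y′ σ v) where

      bit : ∀ j → F (ℤ.+ toℕ j , ℤ.+ v) → lookup σ j ≡ false
      bit j f = ⇐ (row j) (⇒ (inside j v v<n) f)

      free : ∀ j → lookup σ j ≡ false → F (ℤ.+ toℕ j , ℤ.+ v)
      free j e = ⇐ (inside j v v<n) (⇒ (row j) e)

      free-ℕ : ∀ {k} → k < n → (∀ j → toℕ j ≡ k → lookup σ j ≡ false) → F (ℤ.+ k , ℤ.+ v)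
      free-ℕ k<n e = subst (λ k → F (ℤ.+ k , ℤ.+ v)) (toℕ-fromℕ< k<n)
        (free (fromℕ< k<n) (e (fromℕ< k<n) (toℕ-fromℕ< k<n)))

      to-clear : ∀ c → HSeg F (ℤ.+ v) (ℤ.+ z) (ℤ.+ toℕ c) → Clear σ z c
      to-clear c seg = (λ j c≤j j<z → bit j (seg _ (itv-down c≤j (<⇒≤ j<z)))) ,
        (λ j z≤j j≤c → bit j (seg _ (itv-up z≤j j≤c)))

      to-left : ∀ {m} → HSeg F (ℤ.+ v) (ℤ.+ z) -[1+ m ] → ∀ c → toℕ c < z → lookup σ c ≡ false
      to-left seg c c<z = bit c (seg _ (itv-minus (<⇒≤ c<z)))

      to-right : ∀ {k} → n ≤ k → HSeg F (ℤ.+ v) (ℤ.+ z) (ℤ.+ k) → ∀ c → z ≤ toℕ c → lookup σ c ≡ false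
      to-right n≤k seg c z≤c = bit c (seg _ (itv-up z≤c (≤-trans (<⇒≤ (toℕ<n c)) n≤k)))

      from-clear : ∀ c → Clear σ z c → HSeg F (ℤ.+ v) (ℤ.+ z) (ℤ.+ toℕ c)
      from-clear c (below , above) u i with itv-nat i
      ... | k , refl , inj₁ (z≤k , k≤c) = free-ℕ (≤-<-trans k≤c (toℕ<n c)) λ { j refl → above j z≤k k≤c }
      ... | k , refl , inj₂ (c≤k , k≤z) with m≤n⇒m<n∨m≡n k≤z
      ...   | inj₁ k<z  = free-ℕ (<-trans k<z z<n) λ { j refl → below j c≤k k<z }
      ...   | inj₂ refl = here

      from-left : (∀ c → toℕ c < z → lookup σ c ≡ false) → HSeg F (ℤ.+ v) (ℤ.+ z) -[1+ 0 ]
      from-left clear -[1+ m ]  i = left m _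
      from-left clear (ℤ.+ k) (inj₁ (_ , ()))
      from-left clear (ℤ.+ k) (inj₂ (_ , ℤ.+≤+ k≤z)) with m≤n⇒m<n∨m≡n k≤z
      ... | inj₁ k<z  = free-ℕ (<-trans k<z z<n) λ { j refl → clear j k<z }
      ... | inj₂ refl = here

      from-right : (∀ c → z ≤ toℕ c → lookup σ c ≡ false) → HSeg F (ℤ.+ v) (ℤ.+ z) (ℤ.+ n)
      from-right clear u i with itv-nat i
      ... | k , refl , inj₂ (n≤k , _) = right k _ n≤k
      ... | k , refl , inj₁ (z≤k , _) with k <? n
      ...   | yes k<n = free-ℕ k<n λ { j refl → clear j z≤k }
      ...   | no  k≮n = right k _ (≮⇒≥ k≮n)

    module Row₁ = Row ρ x<n y<n start isRow
    module Row₂ = Row ρ′ x′<n y′<n end isRow′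

    HSeg-sym : ∀ {v a b} → HSeg F v a b → HSeg F v b a
    HSeg-sym s u i = s u (itv-sym i)

    column : ∀ {c v} → v < n → v ≢ y → v ≢ y′ → lookup (lineAt μ d v) c ≡ false ⇔ F (ℤ.+ toℕ c , ℤ.+ v)
    column {c} {v} v<n v≢y v≢y′ = mk⇔ (λ e → ⇐ (inside c v v<n) (inj₁ e)) λ f → case ⇒ (inside c v v<n)
      f of λ
      { (inj₁ e) → e ; (inj₂ (inj₁ (_ , e))) → ⊥-elim (v≢y e) ; (inj₂ (inj₂ (_ , e))) → ⊥-elim (v≢y′ e) }

    to-between : ∀ c → VSeg F (ℤ.+ toℕ c) (ℤ.+ y) (ℤ.+ y′) → Between n<2^w d μ x y x′ y′ c
    to-between c seg =
      (λ v y<v v<y′ → ⇐ (column (<-trans v<y′ y′<n) (≢-sym (<⇒≢ y<v)) (<⇒≢ v<y′))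
        (seg _ (itv-up (<⇒≤ y<v) (<⇒≤ v<y′)))) ,
      (λ v y′<v v<y → ⇐ (column (<-trans v<y y<n) (<⇒≢ v<y) (≢-sym (<⇒≢ y′<v)))
        (seg _ (itv-down (<⇒≤ y′<v) (<⇒≤ v<y))))

    from-between : ∀ c → Between n<2^w d μ x y x′ y′ c → F (ℤ.+ toℕ c , ℤ.+ y) → F (ℤ.+ toℕ c , ℤ.+ y′) →
                   VSeg F (ℤ.+ toℕ c) (ℤ.+ y) (ℤ.+ y′)
    from-between c (up , down) f f′ u i with itv-nat i
    ... | k , refl , range with k ≟ y | k ≟ y′ | range
    ...   | yes refl | _        | _ = f
    ...   | no _     | yes refl | _ = f′
    ...   | no k≢y   | no k≢y′  | inj₁ (y≤k , k≤y′) =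
      ⇒ (column (≤-<-trans k≤y′ y′<n) k≢y k≢y′) (up k (≤∧≢⇒< y≤k (≢-sym k≢y)) (≤∧≢⇒< k≤y′ k≢y′))
    ...   | no k≢y   | no k≢y′  | inj₂ (y′≤k , k≤y) =
      ⇒ (column (≤-<-trans k≤y y<n) k≢y k≢y′) (down k (≤∧≢⇒< y′≤k (≢-sym k≢y′)) (≤∧≢⇒< k≤y k≢y))

  -- The three alternatives distinguish where the middle column lies. All columns left of 0 are
  -- empty and equally good, as are those from `n` on; -1 and `n` represent them. To reach such a
  -- column, a row must be free from its tile to the border, and nothing can block the middle
  -- segment there.
  reached⇔HVH : Reached n<2^w d μ x y x′ y′ ρ ρ′ ⇔ HVH F (ℤ.+ x , ℤ.+ y) (ℤ.+ x′ , ℤ.+ y′)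
  reached⇔HVH = mk⇔
    [ (λ (c , btw , cl , cl′) →
        let s  = Row₁.from-clear c cl
            s′ = Row₂.from-clear c cl′
        in ℤ.+ toℕ c , s ,
           -- The corners of the middle segment are the far ends of the two row segments, which
           -- supply the lines `y` and `y′` left out by `Between`.
           from-between c btw (s _ (inj-end s)) (s′ _ (inj-end s′)) , HSeg-sym s′)
    , [ (λ l → -[1+ 0 ] , Row₁.from-left (λ c → proj₁ (l c)) , (λ v _ → left 0 v) , HSeg-sym
      (Row₂.from-left (λ c → proj₂ (l c))))
      , (λ r → ℤ.+ n , Row₁.from-right (λ c → proj₁ (r c)) , (λ v _ → right n v ≤-refl) , HSeg-sym
        (Row₂.from-right (λ c → proj₂ (r c)))) ]′ ]′
    back
    where
    inj-end : ∀ {v a b} → HSeg F v a b → Itv a b b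
    inj-end {a = a} {b} _ = [ (λ a≤b → inj₁ (a≤b , ℤₚ.≤-refl)) , (λ b≤a → inj₂ (ℤₚ.≤-refl , b≤a)) ]′
      (ℤₚ.≤-total a b)

    back : HVH F (ℤ.+ x , ℤ.+ y) (ℤ.+ x′ , ℤ.+ y′) → Reached n<2^w d μ x y x′ y′ ρ ρ′
    back (-[1+ m ] , s , _ , s′) = inj₂ (inj₁ λ c → Row₁.to-left s c , Row₂.to-left (HSeg-sym s′) c)
    back (ℤ.+ k , s , seg , s′) with k <? n
    ... | no  k≮n = inj₂ (inj₂ λ c → Row₁.to-right (≮⇒≥ k≮n) s c , Row₂.to-right (≮⇒≥ k≮n) (HSeg-sym s′) c)
    ... | yes k<n =
      inj₁ (c , to-between c (subst (λ k → VSeg F (ℤ.+ k) _ _) (sym eq) seg) ,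
        Row₁.to-clear c (subst (λ k → HSeg F _ _ (ℤ.+ k)) (sym eq) s) ,
        Row₂.to-clear c (HSeg-sym (subst (λ k → HSeg F _ (ℤ.+ k) _) (sym eq) s′)))
      where
      c = fromℕ< k<n
      eq : toℕ c ≡ k
      eq = toℕ-fromℕ< k<n

-- Boards in memory

-- The value `false` off the board pads it with empty cells up to width and height `n`. A path that
-- leaves the board but stays within these columns is thus treated like one inside, and the programs
-- do not depend on `W` and `H`.
occAt : ∀ {W H} → (Fin W → Fin H → Bool) → ℕ → ℕ → Bool
occAt {W} {H} o x y with x <? W | y <? H
... | yes x<W | yes y<H = o (fromℕ< x<W) (fromℕ< y<H)
... | _       | _       = false

occAt-cell : ∀ {W H} (o : Fin W → Fin H → Bool) i j → occAt o (toℕ i) (toℕ j) ≡ o i j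
occAt-cell {W} {H} o i j with toℕ i <? W | toℕ j <? H
... | yes p | yes q = cong₂ o (fromℕ<-toℕ i p) (fromℕ<-toℕ j q)
... | yes _ | no ¬q = ⊥-elim (¬q (toℕ<n j))
... | no ¬p | _     = ⊥-elim (¬p (toℕ<n i))

occAt-outside : ∀ {W H x y} → ¬ (x < W × y < H) → ∀ (o : Fin W → Fin H → Bool) → occAt o x y ≡ false
occAt-outside {W} {H} {x} {y} outside o with x <? W | y <? H
... | yes p | yes q = ⊥-elim (outside (p , q))
... | yes _ | no _  = refl
... | no _  | _     = refl

onBoard : ∀ W H x y → (Σ (Cell W H) λ (i , j) → toℕ i ≡ x × toℕ j ≡ y) ⊎ ¬ (x < W × y < H)
onBoard W H x y with x <? W | y <? H
... | yes p | yes q = inj₁ ((fromℕ< p , fromℕ< q) , toℕ-fromℕ< p , toℕ-fromℕ< q)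
... | yes _ | no ¬q = inj₂ (¬q ∘ proj₂)
... | no ¬p | _     = inj₂ (¬p ∘ proj₁)

lineOf : ∀ {W H} → (Fin W → Fin H → Bool) → Bool → ℕ → ℕ → Bool
lineOf o false j v = occAt o j v
lineOf o true  j v = occAt o v j

record Represented {n w W H} (μ : Memory 6 n w) (o : Fin W → Fin H → Bool) : Set where
  constructor represented
  field
    tables : Tables μ
    trees  : ∀ d → Tree μ d
    lines  : ∀ d v → v ≤ n → ∀ j → lookup (lineAt μ d v) j ≡ lineOf o d (toℕ j) v

module Build {n w W H : ℕ} (n<2^w : n < 2 ^ w) (W≤n : W ≤ n) (H≤n : H ≤ n) (o : Fin W → Fin H → Bool) where

  row : Bool → ℕ → Bits n
  row d v = tabulate (λ j → lineOf o d (toℕ j) v)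

  -- Node 0 would be its own child, so the recursion is bounded by fuel.
  nodeValue : Bool → ℕ → ℕ → Bits n
  nodeValue d zero       v = replicate n false
  nodeValue d (suc fuel) v with n ≤? v
  ... | yes _ = row d (v ∸ n)
  ... | no  _ = zipWith _∨_ (nodeValue d fuel (2 * v)) (nodeValue d fuel (suc (2 * v)))

  -- From a node `v ≥ 1` the number grows by at least one per level while the fuel falls by one.
  -- Hence `n ≤ f + v` persists, the leaves are reached before the fuel runs out, and one more unit
  -- changes nothing.
  stable : ∀ d f v → 1 ≤ v → n ≤ f + v → nodeValue d (suc f) v ≡ nodeValue d (suc (suc f)) v
  stable d f v 1≤v n≤ with n ≤? v
  ... | yes _  = refl
  stable d zero    v 1≤v n≤ | no n≰v = ⊥-elim (n≰v n≤)
  stable d (suc f) v 1≤v n≤ | no n≰v =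
    cong₂ (zipWith _∨_) (stable d f (2 * v) (≤-trans 1≤v (m≤m+n v _)) n≤′)
                        (stable d f (suc (2 * v)) (s≤s z≤n) (≤-trans n≤′ (+-monoʳ-≤ f (n≤1+n _))))
    where
    n≤′ : n ≤ f + 2 * v
    n≤′ = ≤-trans n≤ (≤-trans (≤-reflexive (sym (+-suc f v))) (+-monoʳ-≤ f (+-mono-≤ 1≤v (m≤m+n v 0))))

  built : Memory 6 n w
  built small β  a = bits w (table n β (toℕ a))
  built large 0F a = row false (toℕ a)
  built large 1F a = nodeValue false (suc n) (2 * toℕ a)
  built large 2F a = nodeValue false (suc n) (suc (2 * toℕ a))
  built large 3F a = row true (toℕ a)
  built large 4F a = nodeValue true (suc n) (2 * toℕ a)
  built large 5F a = nodeValue true (suc n) (suc (2 * toℕ a))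

  built-row : ∀ d {v} → v ≤ n → lineAt built d v ≡ row d v
  built-row false v≤n = cong (row false) (toℕ-slot v≤n)
  built-row true  v≤n = cong (row true) (toℕ-slot v≤n)

  built-node : ∀ d {v} → ⌊ v /2⌋ ≤ n → node built d v ≡ nodeValue d (suc n) v
  built-node d {v} h≤n with isOdd v in parity
  built-node false h≤n | true  = cong (nodeValue false (suc n))
    (trans (cong (suc ∘ (2 *_)) (toℕ-slot h≤n)) (double-odd parity))
  built-node true  h≤n | true  = cong (nodeValue true (suc n))
    (trans (cong (suc ∘ (2 *_)) (toℕ-slot h≤n)) (double-odd parity))
  built-node false h≤n | false = cong (nodeValue false (suc n)) (trans (cong (2 *_) (toℕ-slot h≤n))
    (double-even parity))
  built-node true  h≤n | false = cong (nodeValue true (suc n)) (trans (cong (2 *_) (toℕ-slot h≤n))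
    (double-even parity))

  leaf-value : ∀ d y → nodeValue d (suc n) (n + y) ≡ row d y
  leaf-value d y with n ≤? n + y
  ... | yes _  = cong (row d) (m+n∸m≡n n y)
  ... | no  n≰ = ⊥-elim (n≰ (m≤m+n n y))

  inner-value : ∀ d u → 1 ≤ u → u < n → nodeValue d (suc n) u ≡ zipWith _∨_ (nodeValue d (suc n) (2 * u))
    (nodeValue d (suc n) (suc (2 * u)))
  inner-value d u 1≤u u<n with n ≤? u
  ... | yes n≤u = ⊥-elim (<⇒≱ u<n n≤u)
  ... | no  _   = cong₂ (zipWith _∨_) (refuel (2 * u) (≤-trans 1≤u (m≤m+n u _)))
    (refuel (suc (2 * u)) (s≤s z≤n))
    where
    refuel : ∀ v → 1 ≤ v → nodeValue d n v ≡ nodeValue d (suc n) v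
    refuel v 1≤v = subst (λ m → nodeValue d m v ≡ nodeValue d (suc m) v) pos
      (stable d (n ∸ 1) v 1≤v (≤-trans (≤-reflexive (trans (sym pos) (+-comm 1 (n ∸ 1))))
        (+-monoʳ-≤ (n ∸ 1) 1≤v)))
      where
      pos : suc (n ∸ 1) ≡ n
      pos = m+[n∸m]≡n (≤-trans (s≤s z≤n) u<n)

  table≤n : ∀ β a → a ≤ n → table n β a ≤ n
  table≤n 0F a a≤n = ≤-trans (⌊n/2⌋≤n a) a≤n
  table≤n 1F a a≤n = ≤-trans (⌈n/2⌉≤n a) a≤n
  table≤n 2F a a≤n = ≤-trans (⌊n/2⌋-mono (+-monoʳ-≤ n (≤-trans a≤n (m≤m+n n 0))))
    (≤-reflexive (⌊2*n/2⌋≡n n))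
  table≤n 3F a a≤n = ceil≤ (+-monoʳ-≤ n (≤-trans a≤n (m≤m+n n 0)))
  table≤n 4F a a≤n = ≤-refl
  table≤n 5F a a≤n = m⊓n≤n (suc a) n

  built-represents : Represented built o
  built-represents = represented
    (λ β a → value-bits w (≤-<-trans (table≤n β (toℕ a) (≤-pred (toℕ<n a))) n<2^w))
    (λ d → tree
      (λ y y<n → trans (built-node d (<⇒≤ (half-< (+-mono-≤-< {n} ≤-refl (<-≤-trans y<n (m≤m+n n 0))))))
        (trans (leaf-value d y) (sym (built-row d (<⇒≤ y<n)))))
      (λ u 1≤u u<n → trans (built-node d (≤-trans (⌊n/2⌋≤n u) (<⇒≤ u<n))) (trans (inner-value d u 1≤u u<n)
        (sym (cong₂ (zipWith _∨_) (built-node d (≤-trans (≤-reflexive (⌊2*n/2⌋≡n u)) (<⇒≤ u<n)))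
                                  (built-node d (≤-trans (≤-reflexive (⌊1+2*n/2⌋≡n u)) (<⇒≤ u<n))))))))
    (λ d v v≤n j → trans (cong (λ r → lookup r j) (built-row d v≤n))
      (lookup∘tabulate (λ j → lineOf o d (toℕ j) v) j))

represented-determines : ∀ {n w W H} → W ≤ n → H ≤ n → (μ : Memory 6 n w) (o o′ : Fin W → Fin H → Bool) →
  Represented μ o → Represented μ o′ → ∀ x y → o x y ≡ o′ x y
represented-determines W≤n H≤n μ o o′ r r′ x y =
  trans (sym (at o r)) (at o′ r′)
  where
  x<n = <-≤-trans (toℕ<n x) W≤n
  at : ∀ o → Represented μ o → lookup (lineAt μ false (toℕ y)) (fromℕ< x<n) ≡ o x y
  at o (represented _ _ lines) = trans (lines false (toℕ y) (≤-trans (<⇒≤ (toℕ<n y)) H≤n) (fromℕ< x<n))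
    (trans (cong (λ i → occAt o i (toℕ y)) (toℕ-fromℕ< x<n)) (occAt-cell o x y))

-- Playing and unplaying a tile

update : ∀ {M} → (Bool → Bool → Bool) → Prog M
update f =
  mov small rX 0F ▸ mov small rY 1F ▸ change f false » mov small rX 1F ▸ mov small rY 0F ▸ change f true

module _ {K : Set} {W H : ℕ} (P : Position K W H) (t : Maybe K) (c : Cell W H) where

  setTile-here : occAt (occupied (setTile t c P)) (toℕ (proj₁ c)) (toℕ (proj₂ c)) ≡ is-just t
  setTile-here = trans (occAt-cell (occupied (setTile t c P)) _ _)
    (cong is-just (trans (cong (λ column → column (proj₂ c)) (updateAt-updates (proj₁ c) P))
      (updateAt-updates (proj₂ c) (P (proj₁ c)))))

  setTile-there : ∀ x y → x ≢ toℕ (proj₁ c) ⊎ y ≢ toℕ (proj₂ c) → occAt (occupied (setTile t c P)) x y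
    ≡ occAt (occupied P) x y
  setTile-there x y away with onBoard W H x y
  ... | inj₂ outside = trans (occAt-outside outside _) (sym (occAt-outside outside _))
  ... | inj₁ ((i , j) , refl , refl) =
    trans (occAt-cell (occupied (setTile t c P)) i j) (trans (cong is-just (unchanged away))
      (sym (occAt-cell (occupied P) i j)))
    where
    unchanged : toℕ i ≢ toℕ (proj₁ c) ⊎ toℕ j ≢ toℕ (proj₂ c) → setTile t c P i j ≡ P i j
    unchanged (inj₁ i≢) = cong (λ column → column j) (updateAt-minimal i (proj₁ c) P
      (λ eq → i≢ (cong toℕ eq)))
    unchanged (inj₂ j≢) with i Fin.≟ proj₁ c
    ... | no  i≢   = cong (λ column → column j) (updateAt-minimal i (proj₁ c) P i≢)
    ... | yes refl = trans (cong (λ column → column j) (updateAt-updates (proj₁ c) P))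
                           (updateAt-minimal j (proj₂ c) (P i) (λ eq → j≢ (cong toℕ eq)))

≡ᵇ-false : ∀ j x → j ≢ x → (j ≡ᵇ x) ≡ false
≡ᵇ-false j x j≢x = ¬-not λ eq → j≢x (≡ᵇ-true j x eq)

module _ {n w : ℕ} where

  -- The two orientations live in disjoint banks; this carries the lines and the tree of one of them
  -- across the update of the other.
  record SameBanks (d : Bool) (μ μ′ : Memory 6 n w) : Set where
    constructor sameBanks
    field
      rows  : μ′ large (rowBank d) ≡ μ large (rowBank d)
      evens : μ′ large (evenBank d) ≡ μ large (evenBank d)
      odds  : μ′ large (oddBank d) ≡ μ large (oddBank d)

  sameBanks-line : ∀ {d μ μ′} → SameBanks d μ μ′ → ∀ v → lineAt μ′ d v ≡ lineAt μ d v
  sameBanks-line (sameBanks rows _ _) v = cong (λ bank → bank (slot v)) rows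

  sameBanks-node : ∀ {d μ μ′} → SameBanks d μ μ′ → ∀ v → node μ′ d v ≡ node μ d v
  sameBanks-node (sameBanks _ evens odds) v with isOdd v
  ... | true  = cong (λ bank → bank (slot ⌊ v /2⌋)) odds
  ... | false = cong (λ bank → bank (slot ⌊ v /2⌋)) evens

  sameBanks-tree : ∀ {d μ μ′} → SameBanks d μ μ′ → Tree μ d → Tree μ′ d
  sameBanks-tree same (tree leaf inner) = tree
    (λ y y<n → trans (sameBanks-node same _) (trans (leaf y y<n) (sym (sameBanks-line same y))))
    (λ u 1≤u u<n → trans (sameBanks-node same u) (trans (inner u 1≤u u<n)
      (sym (cong₂ (zipWith _∨_) (sameBanks-node same (2 * u)) (sameBanks-node same (suc (2 * u)))))))

  update-correct : ∀ {M W H} → W ≤ n → H ≤ n → ∀ {K : Set} (P : Position K W H) (t : Maybe K)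
    (f : Bool → Bool → Bool) →
    (∀ b → f b true ≡ is-just t) → (∀ b → f b false ≡ b) → (c : Cell W H) (s : State 24 6 n w) →
    Represented (memory s) (occupied P) → Holds s 0F 1F c →
    Ends {M = M} ⌊log₂ n ⌋ (update f) s 50 (λ s′ → Represented (memory s′) (occupied (setTile t c P)))
  update-correct {M} W≤n H≤n P t f f-true f-false c@(i , j) s (represented tables trees lines) (eqx , eqy) =
    ends-mov small rX 0F (
    ends-mov small rY 1F (
    ends-seq (framed (change-correct _ tables f false (trees false) eqx eqy x<n y<n (bitLength≤ ≤-refl)))
      λ s₁ (changed tables₁ tree₁ here₁ there₁ , F₁) →
    let same₁ : SameBanks true (memory s) (memory s₁)
        same₁ = sameBanks (intact F₁ large 3F refl) (intact F₁ large 4F refl) (intact F₁ large 5F refl)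
    in
    ends-mov small rX 1F (
    ends-mov small rY 0F (

    ends-then (framed (change-correct _ tables₁ f true (sameBanks-tree same₁ (trees true))
       (trans (cong value (kept F₁ small 1F refl)) eqy) (trans (cong value (kept F₁ small 0F refl)) eqx)
         y<n x<n (bitLength≤ ≤-refl))) λ s₂ (changed tables₂ tree₂ here₂ there₂ , F₂) →
    let same₂ : SameBanks false (memory s₁) (memory s₂)
        same₂ = sameBanks (intact F₂ large 0F refl) (intact F₂ large 1F refl) (intact F₂ large 2F refl)
    in represented tables₂
      (λ { false → sameBanks-tree same₂ tree₁ ; true → tree₂ })
      (λ { false v v≤n k → trans (cong (λ r → lookup r k) (sameBanks-line same₂ v))
        (horizontal (memory s₁) here₁ there₁ v v≤n k)
         ; true  v v≤n k → vertical (memory s₁) (memory s₂) same₁ here₂ there₂ v v≤n k })))))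
    where
    x<n = <-≤-trans (toℕ<n i) W≤n
    y<n = <-≤-trans (toℕ<n j) H≤n
    μ = memory s
    o′ = occupied (setTile t c P)


    horizontal : ∀ (μ₁ : Memory 6 n w) →
      (∀ k → lookup (lineAt μ₁ false (toℕ j)) k ≡ f (lookup (lineAt μ false (toℕ j)) k) (toℕ k ≡ᵇ toℕ i)) →
      (∀ v → v ≤ n → v ≢ toℕ j → lineAt μ₁ false v ≡ lineAt μ false v) →
      ∀ v → v ≤ n → ∀ k → lookup (lineAt μ₁ false v) k ≡ occAt o′ (toℕ k) v
    horizontal μ₁ here there v v≤n k with v ≟ toℕ j | toℕ k ≟ toℕ i
    ... | no v≢   | _        = trans (cong (λ r → lookup r k) (there v v≤n v≢))
      (trans (lines false v v≤n k) (sym (setTile-there P t c _ _ (inj₂ v≢))))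
    ... | yes refl | yes k≡i = trans (here k)
      (trans (cong (f _) (trans (cong (_≡ᵇ toℕ i) k≡i) (≡ᵇ-refl (toℕ i))))
                                 (trans (f-true _) (sym (trans (cong (λ k → occAt o′ k (toℕ j)) k≡i)
                                   (setTile-here P t c)))))
    ... | yes refl | no k≢i  = trans (here k) (trans (cong (f _) (≡ᵇ-false _ _ k≢i))
                                 (trans (f-false _) (trans (lines false v v≤n k)
                                   (sym (setTile-there P t c _ _ (inj₁ k≢i))))))

    vertical : ∀ (μ₁ μ₂ : Memory 6 n w) → SameBanks true μ μ₁ →
      (∀ k → lookup (lineAt μ₂ true (toℕ i)) k ≡ f (lookup (lineAt μ₁ true (toℕ i)) k) (toℕ k ≡ᵇ toℕ j)) →
      (∀ v → v ≤ n → v ≢ toℕ i → lineAt μ₂ true v ≡ lineAt μ₁ true v) →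
      ∀ v → v ≤ n → ∀ k → lookup (lineAt μ₂ true v) k ≡ occAt o′ v (toℕ k)
    vertical μ₁ μ₂ same here there v v≤n k with v ≟ toℕ i | toℕ k ≟ toℕ j
    ... | no v≢   | _        = trans
      (cong (λ r → lookup r k) (trans (there v v≤n v≢) (sameBanks-line same v)))
      (trans (lines true v v≤n k) (sym (setTile-there P t c _ _ (inj₁ v≢))))
    ... | yes refl | yes k≡j = trans (here k)
      (trans (cong (f _) (trans (cong (_≡ᵇ toℕ j) k≡j) (≡ᵇ-refl (toℕ j))))
                                 (trans (f-true _) (sym (trans (cong (occAt o′ (toℕ i)) k≡j)
                                   (setTile-here P t c)))))
    ... | yes refl | no k≢j  = trans (here k) (trans (cong (f _) (≡ᵇ-false _ _ k≢j))
                                 (trans (f-false _) (trans (cong (λ r → lookup r k)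
                                   (sameBanks-line same v)) (trans (lines true v v≤n k)
                                   (sym (setTile-there P t c _ _ (inj₂ k≢j)))))))

-- Testing pairs of tiles

-- A kind occupies two registers, so kinds are equal when the union of both xors is zero. The second
-- pass exchanges the coordinates of each tile and reads the copy of the board by columns.
test : ∀ M → Prog M
test M =
  bitwise small _xor_ rG 4F 6F ▸ bitwise small _xor_ rH 5F 7F ▸ bitwise small _∨_ rG rG rH ▸
  bitwise small _xor_ rS rS rS ▸
  ifZero small rG
    (mov small rX 0F ▸ mov small rY 1F ▸ mov small rX′ 2F ▸ mov small rY′ 3F ▸ reach M false »
     mov small rX 1F ▸ mov small rY 0F ▸ mov small rX′ 3F ▸ mov small rY′ 2F ▸ reach M true)
    skip »
  mov small 0F rS ▸ skip

Free : ∀ {K : Set} {W H} → Position K W H → Cell W H → Cell W H → Point → Set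
Free P p q a = a ≡ point p ⊎ a ≡ point q ⊎ Empty P a

empty⇔ : ∀ {K : Set} {W H} (P : Position K W H) x y → Empty P (ℤ.+ x , ℤ.+ y) ⇔ occAt (occupied P) x y
  ≡ false
empty⇔ {W = W} {H} P x y = mk⇔ to from
  where
  is-just-false : ∀ {A : Set} {m : Maybe A} → is-just m ≡ false → m ≡ nothing
  is-just-false {m = nothing} _ = refl

  to : Empty P (ℤ.+ x , ℤ.+ y) → occAt (occupied P) x y ≡ false
  to empty with onBoard W H x y
  ... | inj₂ outside = occAt-outside outside (occupied P)
  ... | inj₁ ((i , j) , refl , refl) = trans (occAt-cell (occupied P) i j)
    (cong is-just (empty (i , j) refl))

  from : occAt (occupied P) x y ≡ false → Empty P (ℤ.+ x , ℤ.+ y)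
  from eq (i , j) refl = is-just-false (trans (sym (occAt-cell (occupied P) i j)) eq)

between-adjacent : ∀ {a b k} → ∣ a - b ∣ ≡ 1 → (a ≤ k × k ≤ b) ⊎ (b ≤ k × k ≤ a) → k ≡ a ⊎ k ≡ b
between-adjacent {a} {b} {k} eq (inj₁ (a≤k , k≤b)) with m≤n⇒m<n∨m≡n a≤k
... | inj₂ a≡k = inj₁ (sym a≡k)
... | inj₁ a<k = inj₂ (≤-antisym k≤b
  (subst (_≤ k) (trans (+-comm 1 a) (trans (cong (a +_) b∸a) (m+[n∸m]≡n (≤-trans a≤k k≤b)))) a<k))
  where
  b∸a : 1 ≡ b ∸ a
  b∸a = trans (sym eq) (m≤n⇒∣m-n∣≡n∸m (≤-trans a≤k k≤b))
between-adjacent {a} {b} eq (inj₂ r) =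
  [ inj₂ , inj₁ ]′ (between-adjacent (trans (∣-∣-comm b a) eq) (inj₁ r))

module _ {K : Set} {W H : ℕ} (P : Position K W H) (p q : Cell W H) where

  private
    x  = toℕ (proj₁ p)
    y  = toℕ (proj₂ p)
    x′ = toℕ (proj₁ q)
    y′ = toℕ (proj₂ q)

  -- The segment joining neighbouring cells contains only these two cells, both of which `Free`
  -- admits; adjacent tiles are therefore recognised by the test for paths.
  adjacent-connected : Adjacent p q → Connected P p q
  adjacent-connected (inj₁ (refl , eq)) = 1 , s≤s z≤n , hor-line seg done
    where
    seg : HSeg (Free P p q) (ℤ.+ y) (ℤ.+ x) (ℤ.+ x′)
    seg u i with itv-nat i
    ... | k , refl , range = [ (λ { refl → inj₁ refl }) , (λ { refl → inj₂ (inj₁ refl) }) ]′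
      (between-adjacent eq range)
  adjacent-connected (inj₂ (refl , eq)) = 1 , s≤s z≤n , ver-line seg done
    where
    seg : VSeg (Free P p q) (ℤ.+ x) (ℤ.+ y) (ℤ.+ y′)
    seg u i with itv-nat i
    ... | k , refl , range = [ (λ { refl → inj₁ refl }) , (λ { refl → inj₂ (inj₁ refl) }) ]′
      (between-adjacent eq range)

  matching⇔ : ∀ {κ κ′} → p ≢ q → tile P p ≡ just κ → tile P q ≡ just κ′ → Matching P p q ⇔
    (κ ≡ κ′ × Connected P p q)
  matching⇔ p≢q tp tq = mk⇔
    (λ (_ , (_ , tp′ , tq′) , adj) → just-injective (trans (sym tp) (trans tp′ (trans (sym tq′) tq))) ,
      [ adjacent-connected , id ]′ adj)
    (λ { (refl , conn) → p≢q , (_ , tp , tq) , inj₂ conn })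
    where
    just-injective : ∀ {a b : K} → just a ≡ just b → a ≡ b
    just-injective refl = refl

  module _ {n w : ℕ} (n<2^w : n < 2 ^ w) (W≤n : W ≤ n) (H≤n : H ≤ n)
           {μ : Memory 6 n w} (repr : Represented μ (occupied P)) where

    private
      x<n  = <-≤-trans (toℕ<n (proj₁ p)) W≤n
      y<n  = <-≤-trans (toℕ<n (proj₂ p)) H≤n
      x′<n = <-≤-trans (toℕ<n (proj₁ q)) W≤n
      y′<n = <-≤-trans (toℕ<n (proj₂ q)) H≤n

      point-≡ : ∀ {a b c d : ℕ} → _≡_ {A = Point} (ℤ.+ a , ℤ.+ b) (ℤ.+ c , ℤ.+ d) → a ≡ c × b ≡ d
      point-≡ refl = refl , refl

    reached-rows : ∀ ρ ρ′ → IsRow n<2^w false μ x y x′ y′ ρ y → IsRow n<2^w false μ x y x′ y′ ρ′ y′ →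
      Reached n<2^w false μ x y x′ y′ ρ ρ′ ⇔ HVH (Free P p q) (point p) (point q)
    reached-rows ρ ρ′ = reached⇔HVH n<2^w false μ x y x′ y′ x<n y<n x′<n y′<n (Free P p q) inside
      (λ m v → inj₂ (inj₂ λ c ()))
      (λ { k v n≤k → inj₂ (inj₂ λ { (i , j) refl → ⊥-elim (<⇒≱ (<-≤-trans (toℕ<n i) W≤n) n≤k) }) }) ρ ρ′
      where
      inside : ∀ j v → v < n → Free P p q (ℤ.+ toℕ j , ℤ.+ v) ⇔ Occupiable n<2^w false μ x y x′ y′ v j
      inside j v v<n rewrite Represented.lines repr false v (<⇒≤ v<n) j = mk⇔
        [ inj₂ ∘ inj₁ ∘ point-≡ , [ inj₂ ∘ inj₂ ∘ point-≡ , inj₁ ∘ ⇒ (empty⇔ P _ _) ]′ ]′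
        [ inj₂ ∘ inj₂ ∘ ⇐ (empty⇔ P _ _) , [ (λ { (eq , refl) → inj₁ (cong (λ k → ℤ.+ k , ℤ.+ y) eq) }) ,
          (λ { (eq , refl) → inj₂ (inj₁ (cong (λ k → ℤ.+ k , ℤ.+ y′) eq)) }) ]′ ]′

    reached-columns : ∀ ρ ρ′ → IsRow n<2^w true μ y x y′ x′ ρ x → IsRow n<2^w true μ y x y′ x′ ρ′ x′ →
      Reached n<2^w true μ y x y′ x′ ρ ρ′ ⇔ HVH (Free P p q ∘ transpose) (transpose (point p))
        (transpose (point q))
    reached-columns ρ ρ′ = reached⇔HVH n<2^w true μ y x y′ x′ y<n x<n y′<n x′<n (Free P p q ∘ transpose)
      inside
      (λ m v → inj₂ (inj₂ λ c ()))
      (λ { k v n≤k → inj₂ (inj₂ λ { (i , j) refl → ⊥-elim (<⇒≱ (<-≤-trans (toℕ<n j) H≤n) n≤k) }) }) ρ ρ′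
      where
      inside : ∀ j v → v < n → Free P p q (ℤ.+ v , ℤ.+ toℕ j) ⇔ Occupiable n<2^w true μ y x y′ x′ v j
      inside j v v<n rewrite Represented.lines repr true v (<⇒≤ v<n) j = mk⇔
        [ (λ e → let (e₁ , e₂) = point-≡ e in inj₂ (inj₁ (e₂ , e₁))) , [
          (λ e → let (e₁ , e₂) = point-≡ e in inj₂ (inj₂ (e₂ , e₁))) , inj₁ ∘ ⇒ (empty⇔ P _ _) ]′ ]′
        [ inj₂ ∘ inj₂ ∘ ⇐ (empty⇔ P _ _) , [ (λ { (eq , refl) → inj₁ (cong (λ k → ℤ.+ x , ℤ.+ k) eq) }) ,
          (λ { (eq , refl) → inj₂ (inj₁ (cong (λ k → ℤ.+ x′ , ℤ.+ k) eq)) }) ]′ ]′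

    connected⇔ : ∀ ρ ρ′ σ σ′ →
      IsRow n<2^w false μ x y x′ y′ ρ y → IsRow n<2^w false μ x y x′ y′ ρ′ y′ →
      IsRow n<2^w true μ y x y′ x′ σ x → IsRow n<2^w true μ y x y′ x′ σ′ x′ →
      Connected P p q ⇔ (Reached n<2^w false μ x y x′ y′ ρ ρ′ ⊎ Reached n<2^w true μ y x y′ x′ σ σ′)
    connected⇔ ρ ρ′ σ σ′ r r′ c c′ = mk⇔
      ([ inj₁ ∘ ⇐ (reached-rows ρ ρ′ r r′) , inj₂ ∘ ⇐ (reached-columns σ σ′ c c′) ]′ ∘ ⇒ paths)
      (⇐ paths ∘ [ inj₁ ∘ ⇒ (reached-rows ρ ρ′ r r′) , inj₂ ∘ ⇒ (reached-columns σ σ′ c c′) ]′)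
      where
      paths = path⇔HVH {Free P p q} {point p} {point q} (inj₁ refl) (inj₂ (inj₁ refl))

    test-correct : ∀ M {ℓ κ κ′} → (code : _↣_ K (Bits w × Bits w)) → p ≢ q → tile P p ≡ just κ → tile P q
      ≡ just κ′ →
      bitLength ∣ x - x′ ∣ ≤ suc ℓ → bitLength ∣ y - y′ ∣ ≤ suc ℓ → FindBound M n ℓ →
      (s : State 24 6 n w) → memory s ≡ μ → Holds s 0F 1F p → Holds s 2F 3F q →
      (regs s small 4F , regs s small 5F) ≡ Injection.to code κ →
      (regs s small 6F , regs s small 7F) ≡ Injection.to code κ′ →
      Ends ℓ (test M) s 382 (λ s′ → memory s′ ≡ μ × ((¬ IsZero (regs s′ small 0F)) ⇔ Matching P p q))
    test-correct M {κ = κ} {κ′} code p≢q tp tq lenx leny bound s refl (eqx , eqy) (eqx′ , eqy′) kind kind′ =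
      ends-bitwise small _xor_ rG 4F 6F λ g eqg →
      ends-bitwise small _xor_ rH 5F 7F λ h eqh →
      ends-bitwise small _∨_ rG rG rH λ e eqe →
      ends-bitwise small _xor_ rS rS rS λ z eqz →
      ends-seq (ends-ifZero {C = 376} {Q = λ s′ → memory s′ ≡ μ × ((¬ IsZero (regs s′ small rS))
        ⇔ Matching P p q)}
        (λ zero →
          let κ≡κ′ = same-kind g h e eqg eqh eqe zero in
          ends-mov small rX 0F (ends-mov small rY 1F (ends-mov small rX′ 2F (ends-mov small rY′ 3F (
          ends-seq (framed (reach-correct n<2^w false μ x y x′ y′ (Represented.tables repr)
            (Represented.trees repr false) x<n y<n x′<n y′<n
            M _ (operands refl eqx eqy eqx′ eqy′) leny bound)) λ s₁ ((ρ , ρ′ , row , row′ , res₁) , F₁) →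
          let in₁ : ∀ {i v} → regs s₁ small i ≡ regs s small i → value (regs s small i) ≡ v → value
                (regs s₁ small i) ≡ v
              in₁ = λ e₁ e₂ → trans (cong value e₁) e₂
              reachF : ∀ M → Prog M
              reachF = λ M → reach M false
              reachT : ∀ M → Prog M
              reachT = λ M → reach M true
          in
          ends-mov small rX 1F (ends-mov small rY 0F (ends-mov small rX′ 3F (ends-mov small rY′ 2F (
          ends-then (framed (reach-correct n<2^w true μ y x y′ x′ (Represented.tables repr)
            (Represented.trees repr true) y<n x<n y′<n x′<n
            M _ (operands (keepsMemory reachF refl M F₁) (in₁ (keeps reachF small 1F refl M F₁) eqy)
              (in₁ (keeps reachF small 0F refl M F₁) eqx)
                   (in₁ (keeps reachF small 3F refl M F₁) eqy′)
                     (in₁ (keeps reachF small 2F refl M F₁) eqx′)) lenx bound))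
            λ s₂ ((σ , σ′ , column , column′ , res₂) , F₂) →
          trans (keepsMemory reachT refl M F₂) (keepsMemory reachF refl M F₁) ,
          let conn = connected⇔ ρ ρ′ σ σ′ row row′ column column′
              match = matching⇔ p≢q tp tq
          in mk⇔
            (λ nz → ⇐ match (κ≡κ′ , ⇐ conn (case ⇒ res₂ nz of λ
              { (inj₂ r) → inj₂ r
              ; (inj₁ nz₁) → case ⇒ res₁ nz₁ of λ
                { (inj₂ r) → inj₁ r
                ; (inj₁ nz₀) → ⊥-elim (nz₀ (subst IsZero (sym eqz) (xor-self _))) } })))
            (λ m → [ (λ r → ⇐ res₂ (inj₁ (⇐ res₁ (inj₂ r)))) , (λ r → ⇐ res₂ (inj₂ r)) ]′
              (⇒ conn (proj₂ (⇒ match m)))))))))))))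
        (λ nonzero → ends-mono z≤n (λ _ q → q) (ends-skip (refl , mk⇔
          (λ nz → ⊥-elim (nz (subst IsZero (sym eqz) (xor-self _))))
          (λ m → ⊥-elim (nonzero (different-kind g h e eqg eqh eqe
            (proj₁ (⇒ (matching⇔ p≢q tp tq) m)))))))))
      λ s₃ (mem , res) → ends-mov small 0F rS (ends-skip (mem , res))
      where
      same-kind : ∀ (g h e : Bits w) → g ≡ zipWith _xor_ (regs s small 4F) (regs s small 6F) → h
        ≡ zipWith _xor_ (regs s small 5F) (regs s small 7F) →
        e ≡ zipWith _∨_ g h → IsZero e → κ ≡ κ′
      same-kind g h _ refl refl refl z = Injection.injective code (trans (sym kind) (trans (cong₂ _,_
        (xor-zero _ _ (lookup-IsZero λ i → proj₁ (∨-false-lookup g h i (IsZero-lookup z i))))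
        (xor-zero _ _ (lookup-IsZero λ i → proj₂ (∨-false-lookup g h i (IsZero-lookup z i))))) kind′))

      different-kind : ∀ (g h e : Bits w) → g ≡ zipWith _xor_ (regs s small 4F) (regs s small 6F) → h
        ≡ zipWith _xor_ (regs s small 5F) (regs s small 7F) →
        e ≡ zipWith _∨_ g h → κ ≡ κ′ → IsZero e
      different-kind g h _ refl refl refl κ≡κ′ = lookup-IsZero λ i → lookup-∨-false g h i
        (IsZero-lookup (subst (λ u → IsZero (zipWith _xor_ (regs s small 4F) u)) (cong proj₁ codes)
          (xor-self _)) i)
        (IsZero-lookup (subst (λ u → IsZero (zipWith _xor_ (regs s small 5F) u)) (cong proj₂ codes)
          (xor-self _)) i)
        where
        codes : (regs s small 4F , regs s small 5F) ≡ (regs s small 6F , regs s small 7F)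
        codes = trans kind (trans (cong (Injection.to code) κ≡κ′) (sym kind′))

-- In `short`, `e` is the difference of two coordinates, which bounds the lines to be united. It is
-- at most the distance `d` and at most `n`; each model uses the inequality that suits its bound.
dataStructure : ∀ M (bound : ℕ → ℕ → ℕ) →
  (∀ n d e → e ≤ d → e ≤ n → bitLength e ≤ suc (bound n d)) → (∀ n d → FindBound M n (bound n d)) →
    DataStructure M bound
dataStructure M bound short find = record
  { extra = 16
  ; b = 6
  -- The test is the most expensive program: four steps prepare the comparison of kinds, one
  -- branches, two passes take four moves and 184 units each, and one step returns the result. An
  -- update costs 50 units.
  ; constant = 382
  ; playProgram = update andNot
  ; unplayProgram = update _∨_
  ; testProgram = test M
  ; Represents = Represented
  ; represents-exists = λ n<2^w W≤n H≤n o → Build.built n<2^w W≤n H≤n o , Build.built-represents n<2^w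
      W≤n H≤n o
  ; represents-determines = λ n<2^w → represented-determines
  ; play-correct = λ n<2^w W≤n H≤n P c κ _ s repr holds →
      unpack (ends-mono (m≤m+n 50 332) (λ _ q → q) (update-correct W≤n H≤n P nothing andNot ∧-zeroʳ
        ∧-identityʳ c s repr holds))
  ; unplay-correct = λ n<2^w W≤n H≤n P c κ _ s repr holds →
      unpack (ends-mono (m≤m+n 50 332) (λ _ q → q) (update-correct W≤n H≤n P (just κ) _∨_ ∨-zeroʳ
        ∨-identityʳ c s repr holds))
  ; test-correct = λ {n} {w} {W} {H} n<2^w W≤n H≤n code P p q κ κ′ p≢q tp tq s repr holds holds′ kind
      kind′ →
      let ends {t} {s′} run t≤ (mem , res) = test-correct P p q n<2^w W≤n H≤n repr M code p≢q tp tq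
            (short n _ _ (m≤m+n _ _) (gap (proj₁ p) (proj₁ q) W≤n))
            (short n _ _ (m≤n+m _ ∣ toℕ (proj₁ p) - toℕ (proj₁ q) ∣) (gap (proj₂ p) (proj₂ q) H≤n))
            (find n _) s refl holds holds′ kind kind′
      in t , s′ , run , t≤ , subst (λ μ → Represented μ (occupied P)) (sym mem) repr , res
  }
  where
  unpack : ∀ {n w ℓ C} {c : Prog M} {s : State 24 6 n w} {Q : State 24 6 n w → Set} → Ends ℓ c s C Q →
           ∃[ t ] ∃[ s′ ] (Run c t s s′ × t ≤ C * (1 + ℓ) × Q s′)
  unpack (ends run t≤ q) = _ , _ , run , t≤ , q

  gap : ∀ {m n} (i j : Fin m) → m ≤ n → ∣ toℕ i - toℕ j ∣ ≤ n
  gap i j m≤n = ≤-trans (∣m-n∣≤m⊔n (toℕ i) (toℕ j)) (⊔-lub (≤-trans (<⇒≤ (toℕ<n i)) m≤n)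
    (≤-trans (<⇒≤ (toℕ<n j)) m≤n))

theorem3p3 : DataStructure plain (λ n d → ⌊log₂ n ⌋) × DataStructure bitScan (λ n d → ⌊log₂ d ⌋)
theorem3p3 =
  dataStructure plain   _ (λ n d e e≤d e≤n → bitLength≤ e≤n) (λ n d → bitLength≤ ≤-refl) ,
  dataStructure bitScan _ (λ n d e e≤d e≤n → bitLength≤ e≤d) (λ n d → tt)
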